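{- Let $k\geq 3$ and let $H$ be a $k$-graph. Then there exists an integer $n_0=n_0(H)$ such that for all $n\geq n_0$ with $n\equiv 0\pmod{k-1}$, $$R(C^{(k)}_{n,1},H)\leq (\chi(H)-1)(n-1)+4k\binom{\chi(H)-1}{2}+\tau(k-1,\sigma(H))+1.$$
   Context: A $k$-graph is a $k$-uniform hypergraph. $R(G,H)$ is the least $N$ such that every red/blue colouring of the edges of $K^{(k)}_N$ contains a red copy of $G$ or a blue copy of $H$. $\chi(H)$ is the least number of colours in a vertex colouring with no monochromatic edge; $\sigma(H)$ is the smallest possible size of a colour class in such a colouring using $\chi(H)$ colours. For $n=q(k-1)$, $q\ge1$, the loose cycle $C^{(k)}_{n,1}$ has vertices $v_1,\dots,v_n$ and edges $e_i=\{v_{(i-1)(k-1)+1},\dots,v_{i(k-1)+1}\}$ for $i\in[q]$, indices taken with $v_{n+1}=v_1$. For integers $j,\alpha\ge1$, $\tau(j,\alpha)$ is the largest $N$ such that some $j$-uniform hypergraph on $N$ vertices has independence number less than $\alpha$ and no two edges meeting in exactly one vertex. -}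

module Defs where

open import Data.Bool using (Bool; T)
import Data.Bool.Properties as Bool
open import Data.Fin using (Fin; toℕ; _≟_)
open import Data.Fin.Properties using (any?; nonZeroIndex)
open import Data.Fin.Subset using (Subset; _⊆_; _∩_; ∣_∣)
open import Data.Fin.Subset.Properties using (_∈?_)
open import Data.Nat using (ℕ; _+_; _*_; _∸_; _≤_; _<_)
import Data.Nat as ℕ
open import Data.Nat.DivMod using (_%_)
open import Data.Product using (Σ-syntax; ∃-syntax; _×_)
open import Data.Sum using (_⊎_)
open import Data.Vec using (tabulate)
open import Data.Vec.Properties using (≡-dec)
open import Function.Definitions using (Injective)
open import Relation.Binary.PropositionalEquality using (_≡_; _≢_)
open import Relation.Nullary using (¬_; does)
open import Relation.Nullary.Decidable using (_×-dec_)

IsLeast : (ℕ → Set) → ℕ → Set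
IsLeast P n = P n × (∀ m → P m → n ≤ m)

IsGreatest : (ℕ → Set) → ℕ → Set
IsGreatest P n = P n × (∀ m → P m → m ≤ n)

-- A finite hypergraph on the vertex set Fin n, as the indicator function of
-- its set of edges.
Hypergraph : ℕ → Set
Hypergraph n = Subset n → Bool

infix 4 _∈E_

_∈E_ : ∀ {n} → Subset n → Hypergraph n → Set
e ∈E H = T (H e)

Uniform : ∀ {n} → ℕ → Hypergraph n → Set
Uniform k H = ∀ e → e ∈E H → ∣ e ∣ ≡ k

colourClass : ∀ {n m} → (Fin n → Fin m) → Fin m → Subset n
colourClass c i = tabulate λ v → does (c v ≟ i)

Proper : ∀ {n m} → Hypergraph n → (Fin n → Fin m) → Set
Proper H c = ∀ e → e ∈E H → ∀ i → ¬ (e ⊆ colourClass c i)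

IsChromaticNumber : ∀ {n} → Hypergraph n → ℕ → Set
IsChromaticNumber {n} H =
  IsLeast λ m → Σ[ c ∈ (Fin n → Fin m) ] Proper H c

-- σ(H), where χ is the chromatic number of H.  By minimality of χ, every
-- proper colouring into Fin χ uses all χ colours, so no class is empty.
-- The null hypergraph has χ = 0 and no colour class, hence no σ.
IsSmallestColourClass : ∀ {n} → Hypergraph n → (χ : ℕ) → ℕ → Set
IsSmallestColourClass {n} H χ =
  IsLeast λ s → Σ[ c ∈ (Fin n → Fin χ) ]
    Proper H c × ∃[ i ] ∣ colourClass c i ∣ ≡ s

Independent : ∀ {n} → Hypergraph n → Subset n → Set
Independent H S = ∀ e → e ∈E H → ¬ (e ⊆ S)

IsIndependenceNumber : ∀ {n} → Hypergraph n → ℕ → Set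
IsIndependenceNumber H = IsGreatest λ a → ∃[ S ] Independent H S × ∣ S ∣ ≡ a

NoSingletonIntersection : ∀ {n} → Hypergraph n → Set
NoSingletonIntersection H =
  ∀ e f → e ∈E H → f ∈E H → e ≢ f → ∣ e ∩ f ∣ ≢ 1

-- τ(j, α).  For j ≥ 2 and α ≥ 1 the maximum exists and is at most
-- (j + 1)(α ∸ 1): choosing one vertex from each edge of a maximal matching
-- gives an independent set, so the matching has fewer than α edges, and the
-- vertices it misses also form an independent set.
IsTau : (j α : ℕ) → ℕ → Set
IsTau j α = IsGreatest λ N → Σ[ F ∈ Hypergraph N ]
  Uniform j F ×
  (∃[ a ] IsIndependenceNumber F a × a < α) ×
  NoSingletonIntersection F

-- The edges are {v_{i(k-1)}, …, v_{(i+1)(k-1)}} for i = 0, …, q-1, with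
-- indices taken modulo the number q(k-1) of vertices.
looseCycleEdge : ∀ k q → Fin q → Subset (q * (k ∸ 1))
looseCycleEdge k q i = tabulate λ v →
  let instance _ = nonZeroIndex v in
  does (any? λ (j : Fin k) →
    (toℕ i * (k ∸ 1) + toℕ j) % (q * (k ∸ 1)) ℕ.≟ toℕ v)

looseCycle : ∀ k q → Hypergraph (q * (k ∸ 1))
looseCycle k q e = does (any? λ i → ≡-dec Bool._≟_ e (looseCycleEdge k q i))

data Colour : Set where
  red blue : Colour

EdgeColouring : (k N : ℕ) → Set
EdgeColouring k N = (e : Subset N) → ∣ e ∣ ≡ k → Colour

image : ∀ {m n} → (Fin m → Fin n) → Subset m → Subset n
image f e = tabulate λ y → does (any? λ x → (x ∈? e) ×-dec (f x ≟ y))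

HasCopy : ∀ {k N n} → EdgeColouring k N → Colour → Hypergraph n → Set
HasCopy {k} {N} {n} c x G = Σ[ f ∈ (Fin n → Fin N) ]
  Injective _≡_ _≡_ f ×
  (∀ e → e ∈E G → Σ[ p ∈ ∣ image f e ∣ ≡ k ] c (image f e) p ≡ x)

IsRamseyNumber : ∀ {m n} → ℕ → Hypergraph m → Hypergraph n → ℕ → Set
IsRamseyNumber k G H =
  IsLeast λ N → (c : EdgeColouring k N) → HasCopy c red G ⊎ HasCopy c blue H

{-# OPTIONS --safe #-}

-- Write χ = t + 1 and consider a colouring of K_N without a blue H.  Any v(H)
-- vertices span a red edge, and by Ramsey's theorem large sets contain large red
-- cliques.  We maintain disjoint red loose cycles, each with many marked segments
-- ("cores") whose vertices form red cliques.  If there are t + 1 cycles, take a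
-- core of each: either many disjoint red edges meet exactly the same cores, and
-- they merge these cycles into one, or after few deletions all edges between the
-- cores are blue, which gives a blue H.  If there are at most t cycles and many
-- vertices are left over, a red clique among these is a new cycle.  A cycle with
-- at least n vertices yields one with exactly n: a red edge among v(H) successive
-- starting points of edges jumps over a piece of bounded length, and the path
-- inside a core can have any smaller number of edges.  So we end up with t cycles
-- of n - O(1) and at most n - (k - 1) vertices.
--
-- Hence the set L of leftover vertices has at least
-- t (k - 2) + 4k C(t,2) + τ + 1 elements.  Red paths of at most two edges from a
-- core to itself through L ("absorbers") that use k - 1 vertices of L lengthen
-- the cycle; otherwise deleting k - 2 vertices of L per cycle destroys them.  Two
-- disjoint such paths between different cores ("links") merge two cycles into one
-- longer than n; otherwise deleting fewer than 4k vertices per pair destroys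
-- them.  Among τ + 1 remaining vertices of L consider the (k - 1)-sets forming a
-- red edge with at least two core vertices.  No two of them meet in exactly one
-- vertex, as this would be an absorber or a link, so by the definition of τ some
-- σ vertices contain none of them.  These form the smallest class of a blue H
-- whose other classes lie in the cores.
module Submission where

open import Data.Empty using (⊥; ⊥-elim)
open import Data.Bool using (Bool; true; false; T)
import Data.Bool.Properties as Bool
open import Data.Fin using (Fin; zero; suc; punchIn; punchOut; toℕ; fromℕ<; inject≤) renaming (_≟_ to _≟ᶠ_)
open import Data.Fin.Properties using (punchIn-punchOut; toℕ<n; toℕ-fromℕ<; inject≤-injective; nonZeroIndex)
  renaming (any? to anyᶠ?; all? to allᶠ?; suc-injective to suc-injᶠ)
open import Data.Fin.Subset using (Subset; ∣_∣; _∩_) renaming (_∈_ to _∈ₛ_)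
import Data.Fin.Subset as Subset
open import Data.Fin.Subset.Properties using () renaming (_∈?_ to _∈ₛ?_)
import Data.Fin.Subset.Properties as Subset
open import Data.Nat.DivMod using (_%_; n%n≡0; m<n⇒m%n≡m)
import Data.Vec as Vec
open import Data.Vec.Properties using (≡-dec; lookup∘tabulate; lookup⇒[]=; []=⇒lookup)
open import Data.Vec.Functional using (insertAt)
open import Data.Vec.Functional.Properties using (insertAt-lookup; insertAt-punchIn)
open import Data.List using (List; []; _∷_; _++_; [_]; length; concat; concatMap; filter; take; drop; map; lookup; allFin)
open import Data.Nat.ListAction using (sum)
open import Data.Nat.ListAction.Properties using (sum-↭; sum-++)
open import Data.Nat.Divisibility using (_∣_; quotient)
open import Data.List.Membership.Propositional using (_∈_; _∉_)
open import Data.List.Membership.Propositional.Properties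
open import Data.List.Properties using (map-cong; length-tabulate; length-map; filter-some; filter-≐; map-++; ++-assoc; ++-identityʳ; length-++; length-take; take++drop≡id)
open import Data.List.Relation.Binary.Disjoint.Propositional using (Disjoint)
open import Data.List.Relation.Binary.Permutation.Propositional hiding (refl; trans)
open import Data.List.Relation.Binary.Permutation.Propositional.Properties
  using (++⁺; ++⁺ˡ; ++⁺ʳ; ↭-length; shift; ∈-resp-↭; All-resp-↭; ++-commutativeMonoid; ++-comm)
import Data.List.Relation.Binary.Permutation.Propositional as Perm
import Data.List.Relation.Binary.Permutation.Propositional.Properties as Perm
import Data.List.Relation.Binary.Permutation.Setoid.Properties as Permₛ
open import Data.List.Relation.Binary.Sublist.Propositional using ([]; _∷_; _∷ʳ_; minimum) renaming (_⊆_ to _⊆ₛ_; ⊆-trans to ⊆ₛ-trans; ⊆-refl to ⊆ₛ-refl)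
open import Data.List.Relation.Unary.All as All using (All; []; _∷_)
import Data.List.Relation.Unary.All.Properties as All
open import Data.List.Relation.Unary.Any as Any using (any?; Any; here; there; index)
open import Data.List.Relation.Unary.Any.Properties using (lookup-index)
open import Data.List.Relation.Unary.Unique.Propositional using (Unique; []; _∷_)
import Data.List.Relation.Unary.Unique.Propositional.Properties as Unique
open import Data.Nat
open import Data.Nat.Combinatorics using (_C_; nC1≡n; nCk+nC[k+1]≡[n+1]C[k+1])
open import Data.Nat.Properties
open import Data.Nat.Tactic.RingSolver using (solve-∀)
open import Data.Product using (Σ; _×_; _,_; proj₁; proj₂; ∃; ∃₂; ∃-syntax)
open import Data.Sum using (_⊎_; inj₁; inj₂)
open import Data.Unit using (tt)
open import Function using (_∘_; id; case_of_)
open import Relation.Binary.Definitions using (DecidableEquality)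
open import Relation.Binary.PropositionalEquality hiding ([_])
open import Relation.Nullary using (¬_; Dec; yes; no; does; ¬?; _×-dec_; _⊎-dec_; _→-dec_)
open import Relation.Nullary.Decidable using (dec-true; map′)
open import Relation.Unary using (Pred; Decidable)
open import Defs

-- The goal of almost every step is ⊥. Absorbers, links and crossing red edges are not searched for,
-- so whether one exists is not decided; with ⊥ as goal `byCases` may still split on any such
-- statement, and an object that exists only in this sense is handed to a continuation into ⊥. The
-- finite checks `hasCopy?` and `arrows?` finally turn the refutation into copies and a least R. H
-- is used only through two consequences of having no blue copy, `NoBlueClique` and `NoBlueParts`.
-- The number of vertices of a loose cycle is a multiple of k - 1, so a cycle below n misses at
-- least k - 2 of the n - 1 vertices that the bound grants it. An absorption that gets stuck has
-- collected at most k - 2 vertices of L, so these two quantities cancel exactly. A link of two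
-- edges has 2k - 1 vertices, so the 4k per pair leave slack.

byCases : ∀ {a} (P : Set a) → (P → ⊥) → (¬ P → ⊥) → ⊥
byCases P p np = np p

-- Linear arithmetic: a ≤ b follows from p ≤ q once the difference b - a is
-- recognised as (q - p) + s, stated without subtraction.
lin : ∀ {p q a b} s → p ≤ q → a + q + s ≡ b + p → a ≤ b
lin {p} {q} {a} {b} s p≤q eq = +-cancelʳ-≤ p a b (begin
  a + p      ≤⟨ +-monoʳ-≤ a p≤q ⟩
  a + q      ≤⟨ m≤m+n (a + q) s ⟩
  a + q + s  ≡⟨ eq ⟩
  b + p      ∎)
  where open ≤-Reasoning

infixr 2 _⊕_
_⊕_ : ∀ {p q p′ q′} → p ≤ q → p′ ≤ q′ → p + p′ ≤ q + q′
_⊕_ = +-mono-≤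

-- Lists up to permutation, and sublists in this sense

module _ {A : Set} where

  open import Algebra.Solver.CommutativeMonoid (++-commutativeMonoid {A = A}) public
    using () renaming (solve to perm; _⊜_ to _⇌_; _⊕_ to _∙_; id to ε)

  Unique-resp : ∀ {xs ys : List A} → xs ↭ ys → Unique xs → Unique ys
  Unique-resp p = Permₛ.Unique-resp-↭ (setoid A) (↭⇒↭ₛ p)

  Unique-++⁻ : ∀ xs {ys : List A} → Unique (xs ++ ys) → Unique xs × Unique ys × Disjoint xs ys
  Unique-++⁻ [] u = [] , u , λ ()
  Unique-++⁻ (x ∷ xs) (px ∷ u) with Unique-++⁻ xs u | All.++⁻ xs px
  ... | u₁ , u₂ , d | p₁ , p₂ = p₁ ∷ u₁ , u₂ ,
        λ { (here refl , q) → All.lookup p₂ q refl ; (there p , q) → d (p , q) }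

  uncons : ∀ {x} {xs : List A} → Unique (x ∷ xs) → x ∉ xs × Unique xs
  uncons u@(_ ∷ u′) = Unique.Unique[x∷xs]⇒x∉xs u , u′

  cons : ∀ {x} {xs : List A} → x ∉ xs → Unique xs → Unique (x ∷ xs)
  cons n u = All.tabulate (λ y∈ eq → n (subst (_∈ _) (sym eq) y∈)) ∷ u

  infix 4 _⊑_
  -- The complement is part of the data: `absorbLoop` later reads the deleted core vertices off it.
  _⊑_ : List A → List A → Set
  xs ⊑ ys = ∃[ zs ] xs ++ zs ↭ ys

  ↭⇒⊑ : ∀ {xs ys} → xs ↭ ys → xs ⊑ ys
  ↭⇒⊑ {xs} p = [] , ↭-trans (↭-reflexive (++-identityʳ xs)) p

  ⊑-refl : ∀ {xs} → xs ⊑ xs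
  ⊑-refl = ↭⇒⊑ ↭-refl

  ⊑-trans : ∀ {xs ys zs} → xs ⊑ ys → ys ⊑ zs → xs ⊑ zs
  ⊑-trans {xs} (as , p) (bs , q) =
    as ++ bs , ↭-trans (↭-reflexive (sym (++-assoc xs as bs))) (↭-trans (++⁺ʳ bs p) q)

  ⊑-respʳ : ∀ {xs ys zs} → xs ⊑ ys → ys ↭ zs → xs ⊑ zs
  ⊑-respʳ (as , p) q = as , ↭-trans p q

  ⊑-respˡ : ∀ {xs ys zs} → xs ↭ ys → ys ⊑ zs → xs ⊑ zs
  ⊑-respˡ p (as , q) = as , ↭-trans (++⁺ʳ as p) q

  ⊑-++ : ∀ {xs ys xs′ ys′} → xs ⊑ ys → xs′ ⊑ ys′ → xs ++ xs′ ⊑ ys ++ ys′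
  ⊑-++ {xs} {xs′ = xs′} (as , p) (bs , q) = as ++ bs ,
    ↭-trans (perm 4 (λ a b c d → (a ∙ b) ∙ c ∙ d ⇌ (a ∙ c) ∙ (b ∙ d)) ↭-refl xs xs′ as bs) (++⁺ p q)

  ++-⊑ˡ : ∀ xs ys → xs ⊑ xs ++ ys
  ++-⊑ˡ xs ys = ys , ↭-refl

  ++-⊑ʳ : ∀ xs ys → ys ⊑ xs ++ ys
  ++-⊑ʳ xs ys = xs , ++-comm ys xs

  ∷-⊑ : ∀ {x xs ys} → xs ⊑ ys → x ∷ xs ⊑ x ∷ ys
  ∷-⊑ (as , p) = as , prep _ p

  Unique-⊑ : ∀ {xs ys} → xs ⊑ ys → Unique ys → Unique xs
  Unique-⊑ {xs} (as , p) u = proj₁ (Unique-++⁻ xs (Unique-resp (↭-sym p) u))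

  length-⊑ : ∀ {xs ys} → xs ⊑ ys → length xs ≤ length ys
  length-⊑ {xs} (as , p) = ≤-trans (≤-trans (m≤m+n _ _) (≤-reflexive (sym (length-++ xs)))) (≤-reflexive (↭-length p))

  ∈-⊑ : ∀ {xs ys} → xs ⊑ ys → ∀ {x} → x ∈ xs → x ∈ ys
  ∈-⊑ (as , p) x∈ = ∈-resp-↭ p (∈-++⁺ˡ x∈)

  All-⊑ : ∀ {xs ys} {P : A → Set} → xs ⊑ ys → All P ys → All P xs
  All-⊑ xs⊑ys ps = All.tabulate λ x∈ → All.lookup ps (∈-⊑ xs⊑ys x∈)

  sublist⇒⊑ : ∀ {xs ys : List A} → xs ⊆ₛ ys → xs ⊑ ys
  sublist⇒⊑ [] = ⊑-refl
  sublist⇒⊑ {xs} (y ∷ʳ p) with sublist⇒⊑ p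
  ... | as , q = y ∷ as , ↭-trans (shift y xs as) (prep y q)
  sublist⇒⊑ (refl ∷ p) = ∷-⊑ (sublist⇒⊑ p)

  extract : ∀ {x} {xs : List A} → x ∈ xs → ∃[ ys ] xs ↭ x ∷ ys
  extract x∈ with ∈-∃++ x∈
  ... | ys , zs , refl = ys ++ zs , shift _ ys zs

  unique-⊆⇒⊑ : ∀ {xs ys : List A} → Unique xs → All (_∈ ys) xs → xs ⊑ ys
  unique-⊆⇒⊑ {ys = ys} [] [] = ys , ↭-refl
  unique-⊆⇒⊑ {x ∷ xs} {ys} u (x∈ ∷ xs⊆) with extract x∈ | uncons u
  ... | ys′ , p | x∉ , u′ = ⊑-respʳ (∷-⊑ (unique-⊆⇒⊑ u′ (All.tabulate in-ys′))) (↭-sym p)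
    where
    in-ys′ : ∀ {z} → z ∈ xs → z ∈ ys′
    in-ys′ z∈ with ∈-resp-↭ p (All.lookup xs⊆ z∈)
    ... | here refl = ⊥-elim (x∉ z∈)
    ... | there q = q

  unique-⊆⇒length : ∀ {xs ys : List A} → Unique xs → All (_∈ ys) xs → length xs ≤ length ys
  unique-⊆⇒length u s = length-⊑ (unique-⊆⇒⊑ u s)

  split : ∀ n (xs : List A) → n ≤ length xs → ∃₂ λ ys zs → xs ≡ ys ++ zs × length ys ≡ n
  split n xs n≤ = take n xs , drop n xs , sym (take++drop≡id n xs) ,
    trans (length-take n xs) (m≤n⇒m⊓n≡m n≤)

  filter-++-∁ : ∀ {p} {P : Pred A p} (P? : Decidable P) xs → filter P? xs ++ filter (¬? ∘ P?) xs ↭ xs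
  filter-++-∁ P? [] = ↭-refl
  filter-++-∁ P? (x ∷ xs) with P? x
  ... | yes _ = prep x (filter-++-∁ P? xs)
  ... | no _ = ↭-trans (shift x (filter P? xs) _) (prep x (filter-++-∁ P? xs))

  filter-⊑ : ∀ {p} {P : Pred A p} (P? : Decidable P) xs → filter P? xs ⊑ xs
  filter-⊑ P? xs = _ , filter-++-∁ P? xs

  filter-sublist : ∀ {p} {P : Pred A p} (P? : Decidable P) xs → filter P? xs ⊆ₛ xs
  filter-sublist P? [] = []
  filter-sublist P? (x ∷ xs) with P? x
  ... | yes _ = refl ∷ filter-sublist P? xs
  ... | no _ = x ∷ʳ filter-sublist P? xs

  length-filter-∁ : ∀ {p} {P : Pred A p} (P? : Decidable P) xs →
    length (filter P? xs) + length (filter (¬? ∘ P?) xs) ≡ length xs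
  length-filter-∁ P? xs = trans (sym (length-++ (filter P? xs))) (↭-length (filter-++-∁ P? xs))

module _ {A : Set} (_≟_ : DecidableEquality A) where

  open import Data.List.Membership.DecPropositional _≟_ using (_∈?_)

  infixl 6 _∖_
  _∖_ : List A → List A → List A
  xs ∖ ds = filter (¬? ∘ (_∈? ds)) xs

  ∖-⊑ : ∀ xs ds → xs ∖ ds ⊑ xs
  ∖-⊑ xs ds = filter-⊑ (¬? ∘ (_∈? ds)) xs

  ∈-∖⁻ : ∀ {x} xs ds → x ∈ xs ∖ ds → x ∈ xs × x ∉ ds
  ∈-∖⁻ xs ds = ∈-filter⁻ (¬? ∘ (_∈? ds))

  ∈-∖⁺ : ∀ {x} xs ds → x ∈ xs → x ∉ ds → x ∈ xs ∖ ds
  ∈-∖⁺ xs ds = ∈-filter⁺ (¬? ∘ (_∈? ds))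

  length-∖ : ∀ {xs} ds → Unique xs → length xs ≤ length ds + length (xs ∖ ds)
  length-∖ {xs} ds u = begin
    length xs                                              ≡⟨ length-filter-∁ (_∈? ds) xs ⟨
    length (filter (_∈? ds) xs) + length (xs ∖ ds)         ≤⟨ +-monoˡ-≤ _ (unique-⊆⇒length
                                                                (Unique.filter⁺ (_∈? ds) u)
                                                                (All.all-filter (_∈? ds) xs)) ⟩
    length ds + length (xs ∖ ds)                           ∎
    where open ≤-Reasoning

  -- Edges are lists in any order, whereas `shortcut`, Ramsey's theorem and `sublists` speak of
  -- sublists, in which every set occurs in one order only. This passes from the former to the
  -- latter.
  asSublist : ∀ {xs ys : List A} → Unique xs → Unique ys → All (_∈ ys) xs →
    ∃[ zs ] zs ⊆ₛ ys × length zs ≡ length xs × All (_∈ xs) zs × All (_∈ zs) xs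
  asSublist {xs} {ys} ux uy xs⊆ = zs , filter-sublist (_∈? xs) ys ,
      ≤-antisym (unique-⊆⇒length (Unique.filter⁺ (_∈? xs) uy) zs⊆) (unique-⊆⇒length ux xs⊆zs) , zs⊆ , xs⊆zs
    where
    zs = filter (_∈? xs) ys
    zs⊆ : All (_∈ xs) zs
    zs⊆ = All.all-filter (_∈? xs) ys
    xs⊆zs : All (_∈ zs) xs
    xs⊆zs = All.tabulate λ x∈ → ∈-filter⁺ (_∈? xs) (All.lookup xs⊆ x∈) x∈

-- Loose paths and cycles with marked clique segments

-- Edges are lists treated as sets: by `Red-resp` neither order nor repetition matters. `κ` is k -
-- 2, the number of vertices of an edge of a loose path besides its two joints.
record RedGraph : Set₁ where
  infix 4 _≟ᵛ_
  field
    V : Set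
    _≟ᵛ_ : DecidableEquality V
    κ : ℕ
    Red : List V → Set
    Red? : ∀ xs → Dec (Red xs)
    Red-resp : ∀ {xs ys} → All (_∈ ys) xs → All (_∈ xs) ys → Red xs → Red ys

  K₁ k : ℕ
  K₁ = suc κ
  k = suc K₁

  open import Data.List.Membership.DecPropositional _≟ᵛ_ public using (_∈?_)

  Red-↭ : ∀ {xs ys} → xs ↭ ys → Red xs → Red ys
  Red-↭ p = Red-resp (All.tabulate (∈-resp-↭ p)) (All.tabulate (∈-resp-↭ (↭-sym p)))

  Clique : List V → Set
  Clique X = ∀ {e} → Unique e → length e ≡ k → All (_∈ X) e → Red e

  Clique-⊆ : ∀ {X Y} → All (_∈ Y) X → Clique Y → Clique X
  Clique-⊆ s cl u l e⊆ = cl u l (All.map (All.lookup s) e⊆)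

NoBlueClique : RedGraph → ℕ → Set
NoBlueClique G v = ∀ J → Unique J → length J ≡ v → ¬ (∀ e → Unique e → length e ≡ k → All (_∈ J) e → ¬ Red e)
  where open RedGraph G

module Necks (G : RedGraph) (m₀ : ℕ) where

  open RedGraph G

  m : ℕ
  m = suc m₀

  private variable
    a b d p q : V
    c c′ : ℕ
    us vs ws : List V

  -- Neck c a b vs: a red loose path from a to b, where vs lists its vertices
  -- including a but not b, so that Neck c a a vs is a loose cycle on vs.  It
  -- has c marked segments of m edges on red cliques.
  data Neck : ℕ → V → V → List V → Set where
    []   : Neck 0 a a []
    edge : Red (b ∷ a ∷ ws) → length ws ≡ κ → Neck c b d vs → Neck c a d (a ∷ ws ++ vs)
    core : Clique (p ∷ q ∷ ws) → suc (length ws) ≡ m * K₁ → Neck c q d vs →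
           Neck (suc c) p d (p ∷ ws ++ vs)

  Path : V → V → List V → Set
  Path = Neck 0

  _▻_ : Neck c a b us → Neck c′ b d vs → Neck (c + c′) a d (us ++ vs)
  [] ▻ q = q
  _▻_ {vs = vs} (edge {a = a} {ws = ws} {vs = us} r l p) q =
    subst (Neck _ _ _) (cong (a ∷_) (sym (++-assoc ws us vs))) (edge r l (p ▻ q))
  _▻_ {vs = vs} (core {p = x} {ws = ks} {vs = us} cl l p) q =
    subst (Neck _ _ _) (cong (x ∷_) (sym (++-assoc ks us vs))) (core cl l (p ▻ q))

  recount : c ≡ c′ → Neck c a b vs → Neck c′ a b vs
  recount refl p = p

  oneEdge : Red (b ∷ a ∷ ws) → length ws ≡ κ → Path a b (a ∷ ws)
  oneEdge {b} {a} {ws} r l = subst (Path a b) (cong (a ∷_) (++-identityʳ ws)) (edge r l [])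

  head-Neck : Neck c a b vs → ∃[ ws ] vs ++ [ b ] ≡ a ∷ ws
  head-Neck [] = [] , refl
  head-Neck (edge _ _ _) = _ , refl
  head-Neck (core _ _ _) = _ , refl

  start∈ : Neck c a b vs → a ∈ vs ++ [ b ]
  start∈ p = subst (_ ∈_) (sym (proj₂ (head-Neck p))) (here refl)

  length-Neck : Neck c a b vs → ∃[ p ] length vs ≡ p * K₁
  length-Neck [] = 0 , refl
  length-Neck (edge {ws = ws} r l p) with length-Neck p
  ... | n , eq = suc n , cong suc (trans (length-++ ws) (cong₂ _+_ l eq))
  length-Neck (core {ws = ks} {vs = vs} cl l p) with length-Neck p
  ... | n , eq = m + n , trans (cong suc (length-++ ks))
                          (trans (cong₂ _+_ l eq) (sym (*-distribʳ-+ K₁ m n)))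

  cores≤length : Neck c a b vs → c ≤ length vs
  cores≤length [] = z≤n
  cores≤length (edge {ws = ws} {vs = vs} _ _ p) =
    ≤-trans (cores≤length p) (≤-trans (length-⊑ (++-⊑ʳ ws vs)) (n≤1+n _))
  cores≤length (core {ws = ks} {vs = vs} _ _ p) =
    s≤s (≤-trans (cores≤length p) (length-⊑ (++-⊑ʳ ks vs)))

  cliquePath : ∀ j a b fill → suc (length fill) ≡ suc j * K₁ →
    Clique (a ∷ b ∷ fill) → Unique (a ∷ b ∷ fill) → Path a b (a ∷ fill)
  cliquePath zero a b fill l cl u = oneEdge
      (cl (Unique-resp (swap a b ↭-refl) u) (cong suc (cong suc l′))
        (there (here refl) ∷ here refl ∷ All.tabulate (λ p → there (there p))))
      l′
    where
    l′ : length fill ≡ κ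
    l′ = suc-injective (trans l (+-identityʳ K₁))
  cliquePath (suc j) a b fill l cl u
    with split κ fill (s≤s⁻¹ (≤-trans (m≤m+n K₁ (suc j * K₁)) (≤-reflexive (sym l))))
  ... | ws , [] , refl , lws = ⊥-elim (m+1+n≢m (length ws) (trans lem (cong length (++-identityʳ ws))))
    where
    lem : length ws + suc (κ + j * K₁) ≡ length (ws ++ [])
    lem = trans (cong (_+ suc (κ + j * K₁)) lws) (sym (suc-injective l))
  ... | ws , a′ ∷ fill′ , refl , lws = edge
      (cl (Unique-⊑ (⊑-respˡ (perm 3 (λ p q r → p ∙ q ∙ r ⇌ q ∙ r ∙ p) ↭-refl [ a′ ] [ a ] ws)
            (⊑-trans (++-⊑ˡ (a ∷ ws ++ [ a′ ]) (b ∷ fill′))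
              (↭⇒⊑ (perm 5 (λ p q r s t → (p ∙ q ∙ r) ∙ s ∙ t ⇌ p ∙ s ∙ q ∙ r ∙ t) ↭-refl [ a ] ws [ a′ ] [ b ] fill′)))) u)
          (cong suc (cong suc lws))
          (there (there (∈-++⁺ʳ ws (here refl))) ∷ here refl ∷ All.tabulate (λ p → there (there (∈-++⁺ˡ p)))))
      lws
      (cliquePath j a′ b fill′ l′
        (Clique-⊆ (there (there (∈-++⁺ʳ ws (here refl))) ∷ there (here refl) ∷
                   All.tabulate (λ p → there (there (∈-++⁺ʳ ws (there p))))) cl)
        (Unique-⊑ (⊑-trans (++-⊑ˡ (a′ ∷ b ∷ fill′) (a ∷ ws))
              (↭⇒⊑ (perm 5 (λ p q r s t → (r ∙ s ∙ t) ∙ p ∙ q ⇌ p ∙ s ∙ q ∙ r ∙ t) ↭-refl [ a ] ws [ a′ ] [ b ] fill′))) u))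
    where
    l′ : suc (length fill′) ≡ suc j * K₁
    l′ = +-cancelˡ-≡ κ _ _ (trans (cong (_+ suc (length fill′)) (sym lws))
           (trans (sym (length-++ ws)) (suc-injective l)))

  -- Uniqueness includes the end point `b`: the end of a core is the head of what follows, possibly
  -- `b` itself, and the clique yields an edge only if that vertex differs from the others.
  forget : Neck c a b vs → Unique (vs ++ [ b ]) → Path a b vs
  forget [] u = []
  forget {b = b} (edge {a = a} {ws = ws} {vs = vs} r l p) u =
    edge r l (forget p (Unique-⊑ (⊑-respʳ (++-⊑ʳ (a ∷ ws) (vs ++ [ b ])) (↭-reflexive (sym (++-assoc (a ∷ ws) vs [ b ])))) u))
  forget {b = b} (core {p = x} {q = y} {ws = ks} {vs = vs} cl l p) u =
    cliquePath m₀ x y ks l cl (Unique-⊑ xyks u) ▻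
    forget p (Unique-⊑ (⊑-respʳ (++-⊑ʳ (x ∷ ks) (vs ++ [ b ])) (↭-reflexive (sym (++-assoc (x ∷ ks) vs [ b ])))) u)
    where
    xyks : x ∷ y ∷ ks ⊑ (x ∷ ks ++ vs) ++ [ b ]
    xyks with head-Neck p
    ... | ws , eq = ws , ↭-trans (perm 4 (λ p q r s → (p ∙ q ∙ r) ∙ s ⇌ (p ∙ r) ∙ (q ∙ s)) ↭-refl [ x ] [ y ] ks ws)
          (↭-trans (↭-reflexive (cong ((x ∷ ks) ++_) (sym eq))) (↭-reflexive (sym (++-assoc (x ∷ ks) vs [ b ]))))

  record FirstCore (c : ℕ) (a d : V) (vs : List V) : Set where
    constructor firstCore
    field
      {pre ks post} : List V
      {x y} : V
      before : Path a x pre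
      clique : Clique (x ∷ y ∷ ks)
      len : suc (length ks) ≡ m * K₁
      after : Neck c y d post
      eq : vs ≡ pre ++ x ∷ ks ++ post

  findCore : Neck (suc c) a d vs → FirstCore c a d vs
  findCore (edge {a = a} {ws = ws} r l p) with findCore p
  ... | firstCore {us} bf cl len af refl =
        firstCore (edge r l bf) cl len af (cong (a ∷_) (sym (++-assoc ws us _)))
  findCore (core cl l p) = firstCore [] cl l p refl

  reverse : Path a b vs → ∃[ vs′ ] Path b a vs′ × vs′ ++ [ a ] ↭ vs ++ [ b ]
  reverse [] = [] , [] , ↭-refl
  reverse {b = b} (edge {b = d} {a = a} {ws = ws} {vs = vs} r l p) with reverse p
  ... | rs , q , e = rs ++ d ∷ ws , q ▻ oneEdge (Red-↭ (swap d a ↭-refl) r) l ,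
    ↭-trans (perm 4 (λ r d w a → (r ∙ d ∙ w) ∙ a ⇌ (a ∙ w) ∙ (r ∙ d)) ↭-refl rs [ d ] ws [ a ])
      (↭-trans (++⁺ˡ (a ∷ ws) e) (↭-reflexive (sym (++-assoc (a ∷ ws) vs [ b ]))))

  -- A loose cycle on rs ++ x ∷ ks, cut open at a marked segment x ∷ ks.
  record Open : Set where
    constructor mkOpen
    field
      {cores} : ℕ
      {x y} : V
      {rs ks} : List V
      rest : Neck cores y x rs
      clique : Clique (x ∷ y ∷ ks)
      len : suc (length ks) ≡ m * K₁

    verts : List V
    verts = rs ++ x ∷ ks

    body : List V
    body = rs ++ [ x ]

  open Open public using (cores; verts; body) renaming (ks to coreOf)

  verts-↭ : ∀ o → verts o ↭ body o ++ coreOf o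
  verts-↭ o = ↭-reflexive (sym (++-assoc (Open.rs o) [ Open.x o ] (coreOf o)))

  length-verts : ∀ o → length (verts o) ≡ length (Open.rs o) + m * K₁
  length-verts o = trans (length-++ (Open.rs o)) (cong (length (Open.rs o) +_) (Open.len o))

  -- The cycle is rotated so that its first core comes last; this core is no longer counted by
  -- `cores`.
  toOpen : Neck (suc c) a a vs → ∃[ o ] cores o ≡ c × verts o ↭ vs
  toOpen p with findCore p
  ... | firstCore {us} {ks} {rs} {x} bf cl len af refl =
        mkOpen (af ▻ bf) cl len , +-identityʳ _ ,
        perm 4 (λ r u x k → (r ∙ u) ∙ (x ∙ k) ⇌ u ∙ x ∙ k ∙ r) ↭-refl rs us [ x ] ks

-- Shortening cycles

module Shortening (G : RedGraph) (m₀ : ℕ) (0<κ : 0 < RedGraph.κ G) (v : ℕ) (noBlueClique : NoBlueClique G v) where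

  open RedGraph G
  open Necks G m₀

  joints : ∀ {a b vs} → Path a b vs → List V
  joints [] = []
  joints (edge {a = a} _ _ p) = a ∷ joints p

  joints-sublist : ∀ {a b vs} (p : Path a b vs) → joints p ⊆ₛ vs
  joints-sublist [] = []
  joints-sublist (edge {ws = ws} _ _ p) = refl ∷ skip ws
    where
    skip : ∀ ws → joints p ⊆ₛ ws ++ _
    skip [] = joints-sublist p
    skip (w ∷ ws) = w ∷ʳ skip ws

  jump : ∀ {a d us x e} (p : Path a d us) → x ∷ e ⊆ₛ joints p →
    ∃[ g ] ∃[ u ] ∃[ vs ] x ∷ e ≡ g ++ [ u ] × Path u d vs × g ++ vs ⊑ us
  jump (edge {a = a} {ws = ws} {vs = us} r l p) (.a ∷ʳ s) with jump p s
  ... | g , u , vs , eq , q , sub = g , u , vs , eq , q , ⊑-trans sub (++-⊑ʳ (a ∷ ws) us)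
  jump {e = []} (edge {a = a} r l p) (refl ∷ s) = [] , a , _ , refl , edge r l p , ⊑-refl
  jump {e = y ∷ e} (edge {a = a} {ws = ws} {vs = us} r l p) (refl ∷ s) with jump p s
  ... | g , u , vs , eq , q , sub =
        a ∷ g , u , vs , cong (a ∷_) eq , q , ∷-⊑ (⊑-trans sub (++-⊑ʳ ws us))

  -- A red edge on starting points of edges of the path jumps over everything
  -- between its first and last vertex.
  shortcut : ∀ {a d us e} (p : Path a d us) → e ⊆ₛ joints p → length e ≡ k → Red e →
    ∃[ vs ] Path a d vs × vs ⊑ us × length vs < length us
  shortcut [] [] ()
  shortcut (edge {a = a} {ws = ws} {vs = us} r l p) (.a ∷ʳ s) le re with shortcut p s le re
  ... | vs , q , sub , lt = a ∷ ws ++ vs , edge r l q , ∷-⊑ (⊑-++ (⊑-refl {xs = ws}) sub) ,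
        s≤s (≤-trans (≤-reflexive (trans (cong suc (length-++ ws)) (sym (+-suc (length ws) _))))
            (≤-trans (+-monoʳ-≤ (length ws) lt) (≤-reflexive (sym (length-++ ws)))))
  shortcut {e = _ ∷ y ∷ e} (edge {a = a} {ws = ws} {vs = us} r l p) (refl ∷ s) le re with jump p s
  ... | g , u , vs , eq , q , sub =
        a ∷ g ++ vs , edge re′ lg q , ∷-⊑ (⊑-trans sub (++-⊑ʳ ws us)) ,
        s≤s (≤-trans (s≤s (length-⊑ sub)) (≤-trans (+-monoˡ-≤ (length us) (≤-trans 0<κ (≤-reflexive (sym l))))
          (≤-reflexive (sym (length-++ ws)))))
    where
    lg : length g ≡ κ
    lg = suc-injective (trans (trans (sym (+-comm (length g) 1)) (trans (sym (length-++ g)) (cong length (sym eq))))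
           (suc-injective le))
    re′ : Red (u ∷ a ∷ g)
    re′ = Red-↭ (↭-trans (↭-reflexive (cong (a ∷_) eq))
            (perm 3 (λ a g u → a ∙ g ∙ u ⇌ u ∙ a ∙ g) ↭-refl [ a ] g [ u ])) re

  splitPath : ∀ j {a b vs} → Path a b vs → j * K₁ ≤ length vs →
    ∃[ us ] ∃[ ws ] ∃[ d ] vs ≡ us ++ ws × length us ≡ j * K₁ × (Σ (Path a d us) λ p → length (joints p) ≡ j) × Path d b ws
  splitPath zero p _ = [] , _ , _ , refl , refl , ([] , refl) , p
  splitPath (suc j) (edge {a = a} {ws = ws} {vs = vs} r l p) le
    with splitPath j p (+-cancelˡ-≤ K₁ _ _ (≤-trans le (≤-reflexive (cong suc (trans (length-++ ws) (cong (_+ _) l))))))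
  ... | us , ws′ , d , refl , lus , (p₁ , lj) , p₂ =
        a ∷ ws ++ us , ws′ , d , cong (a ∷_) (sym (++-assoc ws us ws′)) ,
        cong suc (trans (length-++ ws) (cong₂ _+_ l lus)) , (edge r l p₁ , cong suc lj) , p₂

  -- The starting points of the first v edges span a red edge. The jump along it stays within these
  -- v edges, which bounds the loss by `v * K₁`.
  shorten : ∀ {a b vs} → Path a b vs → Unique vs → v * K₁ ≤ length vs →
    (∀ vs′ → Path a b vs′ → vs′ ⊑ vs → length vs′ < length vs → length vs ≤ v * K₁ + length vs′ → ⊥) → ⊥
  shorten p u le cont with splitPath v p le
  ... | us , ws , d , refl , lus , (p₁ , lj) , p₂ =
    noBlueClique (joints p₁) uJ lj λ e ue le e⊆ re →
      let e′ , s , le′ , e′⊆e , e⊆e′ = asSublist _≟ᵛ_ ue uJ e⊆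
          us′ , q , sub , lt = shortcut p₁ s (trans le′ le) (Red-resp e⊆e′ e′⊆e re)
      in cont (us′ ++ ws) (q ▻ p₂) (⊑-++ sub ⊑-refl)
           (subst₂ _<_ (sym (length-++ us′)) (sym (length-++ us)) (+-monoˡ-< (length ws) lt))
           (≤-trans (≤-reflexive (trans (length-++ us) (cong (_+ length ws) lus)))
             (+-monoʳ-≤ (v * K₁) (length-⊑ (++-⊑ʳ us′ ws))))
    where
    uJ : Unique (joints p₁)
    uJ = Unique-⊑ (sublist⇒⊑ (joints-sublist p₁)) (proj₁ (Unique-++⁻ us u))

  module _ (v≤m : v ≤ m) (q : ℕ) (m<q : m < q)
    (noCycle : ∀ {a vs} → Path a a vs → Unique vs → length vs ≢ q * K₁) where

    -- The target is a window of lengths of width `m * K₁` just below `q * K₁`. One shortening loses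
    -- at most `v * K₁` vertices, so it cannot jump over the window.
    shrink : ∀ fuel {a b vs} → length vs < fuel → Path a b vs → Unique vs → q * K₁ ≤ length vs + m * K₁ →
      (∀ {vs′} → Path a b vs′ → vs′ ⊑ vs → length vs′ < q * K₁ → q * K₁ ≤ length vs′ + m * K₁ → ⊥) → ⊥
    shrink (suc fuel) {vs = vs} lt p u le cont with length vs <? q * K₁
    ... | yes short = cont p ⊑-refl short le
    ... | no long = shorten p u (≤-trans (*-monoˡ-≤ K₁ (<⇒≤ (≤-<-trans v≤m m<q))) (≮⇒≥ long))
      λ vs′ p′ sub lt′ ge → shrink fuel (<-≤-trans lt′ (s≤s⁻¹ lt)) p′ (Unique-⊑ sub u)
        (≤-trans (≮⇒≥ long) (≤-trans ge (≤-trans (≤-reflexive (+-comm _ (length vs′)))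
          (+-monoʳ-≤ (length vs′) (*-monoˡ-≤ K₁ v≤m)))))
        λ p″ sub′ → cont p″ (⊑-trans sub′ sub)

    win : (o : Open) → Unique (verts o) → length (verts o) < q * K₁
    win o@(mkOpen {x = x} {y} {rs} {ks} rest cl len) u with length (verts o) <? q * K₁
    ... | yes lt = lt
    ... | no ge = ⊥-elim (shrink (suc (length rs)) ≤-refl
            (forget rest (Unique-⊑ (⊑-respʳ (++-⊑ˡ (rs ++ [ x ]) ks) (↭-reflexive (++-assoc rs [ x ] ks))) u))
            (Unique-⊑ (++-⊑ˡ rs (x ∷ ks)) u)
            (≤-trans (≮⇒≥ ge) (≤-reflexive (length-verts o)))
            close)
      where
      close : ∀ {vs} → Path y x vs → vs ⊑ rs → length vs < q * K₁ → q * K₁ ≤ length vs + m * K₁ → ⊥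
      close {[]} p sub lt ge = <⇒≱ m<q (*-cancelʳ-≤ q m K₁ ge)
      close {z ∷ vs} p sub lt ge with length-Neck p | head-Neck p
      -- The shortened rest has r < q edges; the path through the core takes the missing `suc j`,
      -- which are at most m.
      ... | r , eq | _ , refl with m≤n⇒∃[o]m+o≡n {suc r} {q} (*-cancelʳ-< K₁ r q (subst (_< q * K₁) eq lt))
      ... | j , refl with split (κ + j * K₁) ks fits
        where
        fits : κ + j * K₁ ≤ length ks
        fits = s≤s⁻¹ (≤-trans (+-cancelˡ-≤ (r * K₁) _ _ (begin
          r * K₁ + (suc j) * K₁  ≡⟨ *-distribʳ-+ K₁ r (suc j) ⟨
          (r + suc j) * K₁       ≡⟨ cong (_* K₁) (+-suc r j) ⟩
          (suc r + j) * K₁       ≤⟨ ge ⟩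
          length (z ∷ vs) + m * K₁   ≡⟨ cong (_+ m * K₁) eq ⟩
          r * K₁ + m * K₁        ∎)) (≤-reflexive (sym len)))
          where open ≤-Reasoning
      ... | fill , ks′ , refl , lf =
        noCycle (p ▻ cliquePath j x z fill (cong suc lf)
            (Clique-⊆ (here refl ∷ there (here refl) ∷ All.tabulate λ i → there (there (∈-++⁺ˡ i))) cl)
            (Unique-⊑ (⊑-respʳ (++-⊑ˡ (x ∷ z ∷ fill) vs)
               (perm 4 (λ x z f v → (x ∙ z ∙ f) ∙ v ⇌ (z ∙ v) ∙ x ∙ f) ↭-refl [ x ] [ z ] fill vs)) u′)) u′
          (begin
            length ((z ∷ vs) ++ x ∷ fill)          ≡⟨ length-++ (z ∷ vs) ⟩
            length (z ∷ vs) + suc (length fill)    ≡⟨ cong₂ _+_ eq (cong suc lf) ⟩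
            r * K₁ + suc j * K₁                ≡⟨ *-distribʳ-+ K₁ r (suc j) ⟨
            (r + suc j) * K₁                   ≡⟨ cong (_* K₁) (+-suc r j) ⟩
            (suc r + j) * K₁                   ∎)
        where
        open ≡-Reasoning
        u′ : Unique ((z ∷ vs) ++ x ∷ fill)
        u′ = Unique-⊑ (⊑-++ sub (++-⊑ˡ (x ∷ fill) ks′)) u

-- Ramsey's theorem

-- The usual recursion: a vertex x is split off and the j-subsets e of the other vertices are
-- coloured by the colour of x ∷ e. For j = 0 only the empty set is coloured, so every set is
-- homogeneous and a + b is more than enough.
ramseyNumber : ℕ → ℕ → ℕ → ℕ
ramseyNumber zero a b = a + b
ramseyNumber (suc j) zero b = 0
ramseyNumber (suc j) (suc a) zero = 0
ramseyNumber (suc j) (suc a) (suc b) =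
  suc (ramseyNumber j (ramseyNumber (suc j) a (suc b)) (ramseyNumber (suc j) (suc a) b))

module _ {V : Set} where

  Homogeneous : ℕ → (List V → Set) → List V → Set
  Homogeneous j P X = ∀ {e} → e ⊆ₛ X → length e ≡ j → P e

  Hom-∷ : ∀ {j P x A B} → Homogeneous j (P ∘ (x ∷_)) A → B ⊆ₛ A →
    Homogeneous (suc j) P B → Homogeneous (suc j) P (x ∷ B)
  Hom-∷ hA s hB (_ ∷ʳ t) l = hB t l
  Hom-∷ hA s hB (refl ∷ t) l = hA (⊆ₛ-trans t s) (suc-injective l)

  Hom-[] : ∀ {j P} → Homogeneous (suc j) P []
  Hom-[] [] ()

  Ramsey : ℕ → ℕ → ℕ → ℕ → Set₁
  Ramsey j a b R = ∀ {P : List V → Set} → Decidable P → ∀ X → R ≤ length X →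
    (∃[ A ] A ⊆ₛ X × a ≤ length A × Homogeneous j P A) ⊎
    (∃[ B ] B ⊆ₛ X × b ≤ length B × Homogeneous j (¬_ ∘ P) B)

  ramseyStep : ∀ {j a b R₁ R₂ R} → Ramsey j R₁ R₂ R → Ramsey (suc j) a (suc b) R₁ → Ramsey (suc j) (suc a) b R₂ →
    Ramsey (suc j) (suc a) (suc b) (suc R)
  ramseyStep ramsey₀ ramsey₁ ramsey₂ {P} P? (x ∷ X) (s≤s le) with ramsey₀ (P? ∘ (x ∷_)) X le
  ... | inj₁ (A , A⊆X , lA , hA) with ramsey₁ P? A lA
  ...   | inj₁ (B , B⊆A , lB , hB) = inj₁ (x ∷ B , refl ∷ ⊆ₛ-trans B⊆A A⊆X , s≤s lB , Hom-∷ {P = P} hA B⊆A hB)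
  ...   | inj₂ (B , B⊆A , lB , hB) = inj₂ (B , x ∷ʳ ⊆ₛ-trans B⊆A A⊆X , lB , hB)
  ramseyStep ramsey₀ ramsey₁ ramsey₂ {P} P? (x ∷ X) (s≤s le) | inj₂ (A , A⊆X , lA , hA) with ramsey₂ P? A lA
  ...   | inj₁ (B , B⊆A , lB , hB) = inj₁ (B , x ∷ʳ ⊆ₛ-trans B⊆A A⊆X , lB , hB)
  ...   | inj₂ (B , B⊆A , lB , hB) = inj₂ (x ∷ B , refl ∷ ⊆ₛ-trans B⊆A A⊆X , s≤s lB , Hom-∷ {P = ¬_ ∘ P} hA B⊆A hB)

  ramsey : ∀ j a b → Ramsey j a b (ramseyNumber j a b)
  ramsey zero a b P? X le with P? []
  ... | yes p = inj₁ (X , ⊆ₛ-refl , ≤-trans (m≤m+n a b) le , λ { {[]} _ _ → p })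
  ... | no ¬p = inj₂ (X , ⊆ₛ-refl , ≤-trans (m≤n+m b a) le , λ { {[]} _ _ → ¬p })
  ramsey (suc j) zero b {P} P? X _ = inj₁ ([] , minimum X , z≤n , Hom-[] {P = P})
  ramsey (suc j) (suc a) zero {P} P? X _ = inj₂ ([] , minimum X , z≤n , Hom-[] {P = ¬_ ∘ P})
  ramsey (suc j) (suc a) (suc b) = ramseyStep
    (ramsey j (ramseyNumber (suc j) a (suc b)) (ramseyNumber (suc j) (suc a) b))
    (ramsey (suc j) a (suc b)) (ramsey (suc j) (suc a) b)

module Cliques (G : RedGraph) (v : ℕ) (noBlueClique : NoBlueClique G v) where

  open RedGraph G

  cliqueNumber : ℕ → ℕ
  cliqueNumber a = ramseyNumber k a v

  findClique : ∀ a X → Unique X → cliqueNumber a ≤ length X →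
    ∃[ A ] A ⊑ X × length A ≡ a × Clique A
  findClique a X u le with ramsey k a v Red? X le
  ... | inj₁ (A , A⊆X , lA , hA) with split a A lA
  ...   | B , B′ , refl , lB = B , ⊑-trans (++-⊑ˡ B B′) (sublist⇒⊑ A⊆X) , lB ,
          λ ue le e⊆ → let e′ , s , le′ , p , q = asSublist _≟ᵛ_ ue (Unique-⊑ (sublist⇒⊑ A⊆X) u) (All.map ∈-++⁺ˡ e⊆)
                       in Red-resp p q (hA s (trans le′ le))
  findClique a X u le | inj₂ (A , A⊆X , lA , hA) with split v A lA
  ...   | B , B′ , refl , lB = ⊥-elim (noBlueClique B (Unique-⊑ (⊑-trans (++-⊑ˡ B B′) (sublist⇒⊑ A⊆X)) u) lB
          λ e ue le e⊆ r → let e′ , s , le′ , p , q = asSublist _≟ᵛ_ ue (Unique-⊑ (sublist⇒⊑ A⊆X) u) (All.map ∈-++⁺ˡ e⊆)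
                           in hA s (trans le′ le) (Red-resp q p r))

-- Merging cycles

module Merging (G : RedGraph) (m₀ : ℕ) where

  open RedGraph G
  open Necks G m₀

  allVerts allBodies allCores : List Open → List V
  allVerts = concatMap verts
  allBodies = concatMap body
  allCores = concatMap coreOf

  allVerts-↭ : ∀ os → allVerts os ↭ allBodies os ++ allCores os
  allVerts-↭ [] = ↭-refl
  allVerts-↭ (o ∷ os) = ↭-trans (++⁺ (verts-↭ o) (allVerts-↭ os))
    (perm 4 (λ a b c d → (a ∙ b) ∙ c ∙ d ⇌ (a ∙ c) ∙ b ∙ d) ↭-refl (body o) (coreOf o) (allBodies os) (allCores os))

  verts-⊑ : ∀ {o os} → o ∈ os → verts o ⊑ allVerts os
  verts-⊑ (here refl) = ++-⊑ˡ _ _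
  verts-⊑ {os = o′ ∷ os} (there p) = ⊑-trans (verts-⊑ p) (++-⊑ʳ (verts o′) _)

  core-⊑ : ∀ o → coreOf o ⊑ verts o
  core-⊑ o = ⊑-respʳ (++-⊑ʳ (body o) (coreOf o)) (↭-sym (verts-↭ o))

  -- Links w₀ o os E: red paths joining consecutive cores of o ∷ os cyclically,
  -- the last of which ends in w₀; their other vertices are listed in E.
  data Links (w₀ : V) : Open → List Open → List V → Set where
    last : ∀ {o u ls} → u ∈ coreOf o → Path u w₀ ls → Links w₀ o [] ls
    step : ∀ {o o′ os u w ls E} → u ∈ coreOf o → Path u w ls → w ∈ coreOf o′ →
           Links w₀ o′ os E → Links w₀ o (o′ ∷ os) (ls ++ w ∷ E)

  -- From the entry `w` in the core one clique edge leads to y, then the whole rest is run through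
  -- to x, and another clique edge leads to the exit `u`. The body is kept; of the core only the
  -- entry, the exit and the fillers are used.
  segment : ∀ o {w u F₁ F₂} → Unique (verts o) → w ∈ coreOf o → u ∈ coreOf o →
    Unique (w ∷ F₁) → Unique (u ∷ F₂) → All (_∈ coreOf o) F₁ → All (_∈ coreOf o) F₂ →
    length F₁ ≡ κ → length F₂ ≡ κ →
    Neck (cores o) w u ((w ∷ F₁) ++ Open.rs o ++ (Open.x o ∷ F₂))
  segment o@(mkOpen {c} {x} {y} {rs} {ks} rest cl len) {w} {u} {F₁} {F₂} uo w∈ u∈ uF₁ uF₂ F₁∈ F₂∈ l₁ l₂ =
    oneEdge red₁ l₁ ▻ recount (+-identityʳ c) (rest ▻ oneEdge red₂ l₂)
    where
    body∩core : Disjoint (body o) ks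
    body∩core = proj₂ (proj₂ (Unique-++⁻ (body o) (Unique-resp (verts-↭ o) uo)))
    red₁ : Red (y ∷ w ∷ F₁)
    red₁ = cl (cons (λ y∈ → body∩core (start∈ rest , All.lookup (w∈ ∷ F₁∈) y∈)) uF₁) (cong suc (cong suc l₁))
             (there (here refl) ∷ there (there w∈) ∷ All.map (there ∘ there) F₁∈)
    x∉ : x ∉ ks
    x∉ x∈ = body∩core (∈-++⁺ʳ rs (here refl) , x∈)
    red₂ : Red (u ∷ x ∷ F₂)
    red₂ = cl (Unique-resp (swap x u ↭-refl) (cons (λ x∈ → x∉ (All.lookup (u∈ ∷ F₂∈) x∈)) uF₂)) (cong suc (cong suc l₂))
             (there (there u∈) ∷ here refl ∷ All.map (there ∘ there) F₂∈)

  -- `D` is the set of vertices reserved for all the links. The fillers avoid it, so that no piece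
  -- of the merged cycle collides with a link that comes later.
  record Chain (w w₀ : V) (os : List Open) (E D : List V) : Set where
    field
      {vs} F : List V
      neck : Neck (sum (map cores os)) w w₀ vs
      vs-↭ : vs ↭ allBodies os ++ (w ∷ E) ++ F
      F⊑ : F ⊑ allCores os
      F∉ : All (_∉ D) F
      lenF : length F ≡ length os * (κ + κ)

  Roomy : List V → Open → Set
  Roomy D o = Unique (verts o) × length D + (κ + κ) ≤ length (coreOf o)

  record Fillers (o : Open) (D : List V) : Set where
    field
      {F₁ F₂} : List V
      F⊑ : F₁ ++ F₂ ⊑ coreOf o
      F∉ : All (_∉ D) (F₁ ++ F₂)
      len₁ : length F₁ ≡ κ
      len₂ : length F₂ ≡ κ

  fillers : ∀ {D o} → Roomy D o → Fillers o D
  fillers {D} {o} (u , room) with split (κ + κ) (coreOf o ∖ᵛ D) (+-cancelˡ-≤ (length D) _ _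
      (≤-trans room (length-∖ _≟ᵛ_ D (Unique-⊑ (core-⊑ o) u))))
    where _∖ᵛ_ = _∖_ _≟ᵛ_
  ... | F , rest , eq , lF with split κ F (≤-trans (m≤m+n κ κ) (≤-reflexive (sym lF)))
  ... | F₁ , F₂ , refl , l₁ = record
    { F₁ = F₁ ; F₂ = F₂
    ; F⊑ = ⊑-trans F⊑′ (∖-⊑ _≟ᵛ_ (coreOf o) D)
    ; F∉ = All.tabulate λ z∈ → proj₂ (∈-∖⁻ _≟ᵛ_ (coreOf o) D (∈-⊑ F⊑′ z∈))
    ; len₁ = l₁
    ; len₂ = +-cancelˡ-≡ κ _ _ (trans (cong (_+ length F₂) (sym l₁)) (trans (sym (length-++ F₁)) lF)) }
    where
    F⊑′ : F₁ ++ F₂ ⊑ _∖_ _≟ᵛ_ (coreOf o) D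
    F⊑′ = subst (F₁ ++ F₂ ⊑_) (sym eq) (++-⊑ˡ (F₁ ++ F₂) rest)

  passThrough : ∀ o {w u} D → w ∈ coreOf o → u ∈ coreOf o → w ∈ D → u ∈ D → Roomy D o → Chain w u [ o ] [] D
  passThrough o {w} {u} D w∈ u∈ w∈D u∈D room = record
    { F = F₁ ++ F₂
    ; neck = recount (sym (+-identityʳ (cores o)))
        (segment o {F₁ = F₁} {F₂} (proj₁ room) w∈ u∈ (avoid₁ w∈D) (avoid₂ u∈D) (All.tabulate λ z∈ → ∈-⊑ F⊑ (∈-++⁺ˡ z∈))
          (All.tabulate λ z∈ → ∈-⊑ F⊑ (∈-++⁺ʳ F₁ z∈)) len₁ len₂)
    ; vs-↭ = perm 5 (λ w f r x g → (w ∙ f) ∙ r ∙ (x ∙ g) ⇌ ((r ∙ x) ∙ ε) ∙ w ∙ (f ∙ g)) ↭-refl [ w ] F₁ (Open.rs o) [ Open.x o ] F₂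
    ; F⊑ = ⊑-respʳ F⊑ (↭-reflexive (sym (++-identityʳ (coreOf o))))
    ; F∉ = F∉
    ; lenF = trans (length-++ F₁) (trans (cong₂ _+_ len₁ len₂) (sym (+-identityʳ (κ + κ))))
    }
    where
    open Fillers (fillers {D} {o} room)
    uF : Unique (F₁ ++ F₂)
    uF = Unique-⊑ (⊑-trans F⊑ (core-⊑ o)) (proj₁ room)
    avoid₁ : ∀ {z} → z ∈ D → Unique (z ∷ F₁)
    avoid₁ z∈ = cons (λ z∈F → All.lookup F∉ (∈-++⁺ˡ z∈F) z∈) (Unique-⊑ (++-⊑ˡ F₁ F₂) uF)
    avoid₂ : ∀ {z} → z ∈ D → Unique (z ∷ F₂)
    avoid₂ z∈ = cons (λ z∈F → All.lookup F∉ (∈-++⁺ʳ F₁ z∈F) z∈) (Unique-⊑ (++-⊑ʳ F₁ F₂) uF)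

  -- A path starts at its first listed vertex or, if it has no edge, at its end; both are reserved.
  exit : ∀ {u w D} ls → Path u w ls → All (_∈ D) ls → w ∈ D → u ∈ D
  exit ls p ls⊆ w∈ with ∈-++⁻ ls (start∈ p)
  ... | inj₁ i = All.lookup ls⊆ i
  ... | inj₂ (here refl) = w∈

  chain : ∀ {w w₀ o os E} D → Links w₀ o os E → w ∈ coreOf o → w ∈ D → w₀ ∈ D → All (_∈ D) E →
    All (Roomy D) (o ∷ os) → Chain w w₀ (o ∷ os) E D
  chain {w} {w₀} {o} {E = E} D (last {ls = ls} u∈ p) w∈ w∈D w₀∈D E∈ (room ∷ []) = record
    { F = F
    ; neck = recount (+-identityʳ _) (neck ▻ p)
    ; vs-↭ = ↭-trans (++⁺ʳ ls vs-↭)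
        (perm 4 (λ b w f l → (b ∙ w ∙ f) ∙ l ⇌ b ∙ (w ∙ l) ∙ f) ↭-refl (allBodies [ o ]) [ w ] F ls)
    ; F⊑ = F⊑ ; F∉ = F∉ ; lenF = lenF }
    where
    open Chain (passThrough o D w∈ u∈ w∈D (exit ls p E∈ w₀∈D) room)
  chain {w} {w₀} {o} {E = E} D (step {o′ = o′} {os} {u} {w′} {ls} {E′} u∈ p w′∈ links) w∈ w∈D w₀∈D E∈ (room ∷ rooms) = record
    { F = c₁.F ++ c₂.F
    ; neck = recount (cong (_+ sum (map cores (o′ ∷ os))) (trans (+-identityʳ _) (+-identityʳ (cores o)))) ((c₁.neck ▻ p) ▻ c₂.neck)
    ; vs-↭ = ↭-trans (++⁺ (++⁺ʳ ls c₁.vs-↭) c₂.vs-↭)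
        (perm 8 (λ b w f l B w′ e′ g → (((b ∙ ε) ∙ w ∙ f) ∙ l) ∙ B ∙ (w′ ∙ e′) ∙ g ⇌ (b ∙ B) ∙ (w ∙ l ∙ w′ ∙ e′) ∙ f ∙ g)
          ↭-refl (body o) [ w ] c₁.F ls (allBodies (o′ ∷ os)) [ w′ ] E′ c₂.F)
    ; F⊑ = ⊑-respʳ (⊑-++ c₁.F⊑ c₂.F⊑) (↭-reflexive (cong (_++ allCores (o′ ∷ os)) (++-identityʳ (coreOf o))))
    ; F∉ = All.++⁺ c₁.F∉ c₂.F∉
    ; lenF = trans (length-++ c₁.F) (cong₂ _+_ (trans c₁.lenF (+-identityʳ _)) c₂.lenF) }
    where
    w′∈D : w′ ∈ D
    w′∈D = All.lookup E∈ (∈-++⁺ʳ ls (here refl))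
    module c₁ = Chain (passThrough o D w∈ u∈ w∈D (exit ls p (All.++⁻ˡ ls E∈) w′∈D) room)
    module c₂ = Chain (chain D links w′∈ w′∈D w₀∈D (All.tail (All.++⁻ʳ ls E∈)) rooms)

  abstract
    merge : ∀ {w₀ o os E} Z → Links w₀ o os E → w₀ ∈ coreOf o → Unique (allVerts (o ∷ os) ++ Z) →
      Unique (w₀ ∷ E) → All (_∈ allCores (o ∷ os) ++ Z) (w₀ ∷ E) →
      All (λ o → length (w₀ ∷ E) + (κ + κ) ≤ length (coreOf o)) (o ∷ os) →
      ∃[ vs ] Neck (sum (map cores (o ∷ os))) w₀ w₀ vs × vs ⊑ allVerts (o ∷ os) ++ Z ×
        length vs ≡ length (allBodies (o ∷ os)) + (length (w₀ ∷ E) + length (o ∷ os) * (κ + κ))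
    merge {w₀} {o} {os} {E} Z links w₀∈ u uE E∈ rooms = vs , neck ,
        ⊑-respˡ vs-↭ (⊑-respʳ (⊑-++ (⊑-refl {xs = allBodies os′}) EF⊑) regroup) ,
        trans (↭-length vs-↭) (trans (length-++ (allBodies os′)) (cong (length (allBodies os′) +_)
          (trans (length-++ (w₀ ∷ E)) (cong (length (w₀ ∷ E) +_) lenF))))
      where
      os′ : List Open
      os′ = o ∷ os
      regroup : allBodies os′ ++ allCores os′ ++ Z ↭ allVerts os′ ++ Z
      regroup = ↭-trans (↭-reflexive (sym (++-assoc (allBodies os′) (allCores os′) Z))) (++⁺ʳ Z (↭-sym (allVerts-↭ os′)))
      room : All (Roomy (w₀ ∷ E)) os′
      room = All.tabulate λ i → Unique-⊑ (⊑-trans (verts-⊑ i) (++-⊑ˡ (allVerts os′) Z)) u , All.lookup rooms i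
      open Chain (chain (w₀ ∷ E) links w₀∈ (here refl) (here refl) (All.tabulate there) room)
      EF⊑ : (w₀ ∷ E) ++ F ⊑ allCores os′ ++ Z
      EF⊑ = unique-⊆⇒⊑
        (Unique.++⁺ uE (Unique-⊑ (⊑-trans F⊑ (⊑-trans (++-⊑ˡ (allCores os′) Z) (⊑-respʳ (++-⊑ʳ (allBodies os′) _) regroup))) u)
          λ (i , j) → All.lookup F∉ j i)
        (All.++⁺ E∈ (All.tabulate λ i → ∈-++⁺ˡ (∈-⊑ F⊑ i)))

-- Disjoint red edges as links between cores

module MatchingLinks (G : RedGraph) (m₀ : ℕ) where

  open RedGraph G
  open Necks G m₀
  open Merging G m₀

  concat-sublist : ∀ {es fs : List (List V)} → es ⊆ₛ fs → concat es ⊑ concat fs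
  concat-sublist [] = ⊑-refl
  concat-sublist (f ∷ʳ s) = ⊑-trans (concat-sublist s) (++-⊑ʳ f _)
  concat-sublist (_∷_ {x = f} refl s) = ⊑-++ (⊑-refl {xs = f}) (concat-sublist s)

  allVerts-resp : ∀ {os os′} → os ↭ os′ → allVerts os ↭ allVerts os′
  allVerts-resp Perm.refl = ↭-refl
  allVerts-resp (prep o p) = ++⁺ˡ (verts o) (allVerts-resp p)
  allVerts-resp (swap o o′ p) = ↭-trans
    (perm 3 (λ a b c → a ∙ b ∙ c ⇌ b ∙ a ∙ c) ↭-refl (verts o) (verts o′) _)
    (++⁺ˡ (verts o′) (++⁺ˡ (verts o) (allVerts-resp p)))
  allVerts-resp (Perm.trans p q) = ↭-trans (allVerts-resp p) (allVerts-resp q)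

  allVerts-++ : ∀ os {os′} → allVerts (os ++ os′) ≡ allVerts os ++ allVerts os′
  allVerts-++ [] = refl
  allVerts-++ (o ∷ os) = trans (cong (verts o ++_) (allVerts-++ os)) (sym (++-assoc (verts o) (allVerts os) _))

  ∈-allCores⁻ : ∀ os {x} → x ∈ allCores os → ∃[ o ] o ∈ os × x ∈ coreOf o
  ∈-allCores⁻ (o ∷ os) x∈ with ∈-++⁻ (coreOf o) x∈
  ... | inj₁ x∈o = o , here refl , x∈o
  ... | inj₂ x∈os with ∈-allCores⁻ os x∈os
  ...   | o′ , o′∈ , x∈o′ = o′ , there o′∈ , x∈o′

  ∈-allCores⁺ : ∀ os {o x} → o ∈ os → x ∈ coreOf o → x ∈ allCores os
  ∈-allCores⁺ (_ ∷ os) (here refl) x∈ = ∈-++⁺ˡ x∈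
  ∈-allCores⁺ (o′ ∷ os) (there o∈) x∈ = ∈-++⁺ʳ (coreOf o′) (∈-allCores⁺ os o∈ x∈)

  Unique-allCores : ∀ os → Unique (allVerts os) → Unique (allCores os)
  Unique-allCores os u = Unique-⊑ (⊑-respʳ (++-⊑ʳ (allBodies os) (allCores os)) (↭-sym (allVerts-↭ os))) u

  edgeLink : ∀ {e u w} → Red e → length e ≡ k → u ∈ e → w ∈ e → u ≢ w →
    ∃[ g ] Path u w (u ∷ g) × w ∷ u ∷ g ↭ e
  edgeLink {e} {u} {w} r l u∈ w∈ u≢w with extract u∈
  ... | e₁ , p with ∈-resp-↭ p w∈
  ...   | here eq = ⊥-elim (u≢w (sym eq))
  ...   | there w∈₁ with extract w∈₁
  ...     | g , q = g , oneEdge (Red-↭ (↭-sym perm-e) r) (suc-injective (suc-injective (trans (↭-length perm-e) l))) , perm-e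
    where
    perm-e : w ∷ u ∷ g ↭ e
    perm-e = ↭-trans (swap w u ↭-refl) (↭-trans (prep u (↭-sym q)) (↭-sym p))

  Touches : Open → List V → Set
  Touches o = Any (_∈ coreOf o)

  touches? : ∀ o → Decidable (Touches o)
  touches? o = any? (_∈? coreOf o)

  meet : ∀ o {e} → Touches o e → ∃[ x ] x ∈ e × x ∈ coreOf o
  meet o (here p) = _ , here refl , p
  meet o (there t) with meet o t
  ... | x , x∈e , x∈o = x , there x∈e , x∈o

  RedEdge : List V → Set
  RedEdge e = Red e × length e ≡ k

  -- The link of the last core uses the edge f through w₀, the others the edges es.
  edgeLinks : ∀ {w₀ f} o os es → w₀ ∈ f → RedEdge f → All RedEdge es → length os ≤ length es →
    (os ≡ [] → w₀ ∉ coreOf o) → All (λ o → w₀ ∉ coreOf o) os → Unique (allCores (o ∷ os)) →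
    All (λ o → Touches o f × All (Touches o) es) (o ∷ os) →
    ∃[ E ] Links w₀ o os E × w₀ ∷ E ⊑ f ++ concat es × length (w₀ ∷ E) ≡ length (o ∷ os) * k
  edgeLinks {w₀} {f} o [] es w₀∈ (r , l) _ _ w₀∉ _ _ ((t , _) ∷ _) with meet o t
  ... | u , u∈f , u∈o with edgeLink r l u∈f w₀∈ (λ { refl → w₀∉ refl u∈o })
  ...   | g , p , q = u ∷ g , last u∈o p , ⊑-respˡ q (++-⊑ˡ f (concat es)) , trans (↭-length q) (trans l (sym (+-identityʳ k)))
  edgeLinks {w₀} {f} o (o′ ∷ os) (e ∷ es) w₀∈ rf ((r , l) ∷ rs) (s≤s le) _ (w₀∉ ∷ w₀∉s) uc ((_ , t ∷ _) ∷ ts@((_ , t′ ∷ _) ∷ _))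
    with meet o t | meet o′ t′
  ... | u , u∈e , u∈o | w , w∈e , w∈o′ with edgeLink r l u∈e w∈e (λ { refl →
        proj₂ (proj₂ (Unique-++⁻ (coreOf o) uc)) (u∈o , ∈-++⁺ˡ w∈o′) })
  ...   | g , p , q with edgeLinks o′ os es w₀∈ rf rs le (λ _ → w₀∉) w₀∉s (proj₁ (proj₂ (Unique-++⁻ (coreOf o) uc)))
                          (All.map (λ { (a , _ ∷ b) → a , b }) ts)
  ...     | E , links , sub , lE = u ∷ g ++ w ∷ E , step u∈o p w∈o′ links ,
            ⊑-respˡ (↭-trans (perm 5 (λ a u g w e → a ∙ u ∙ g ∙ w ∙ e ⇌ (w ∙ u ∙ g) ∙ a ∙ e) ↭-refl [ w₀ ] [ u ] g [ w ] E) (++⁺ʳ (w₀ ∷ E) q))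
              (⊑-respʳ (⊑-++ (⊑-refl {xs = e}) sub) (perm 3 (λ a b c → a ∙ b ∙ c ⇌ b ∙ a ∙ c) ↭-refl e f (concat es))) ,
            trans (↭-length (perm 5 (λ a u g w e → a ∙ u ∙ g ∙ w ∙ e ⇌ (w ∙ u ∙ g) ∙ a ∙ e) ↭-refl [ w₀ ] [ u ] g [ w ] E))
              (trans (length-++ (w ∷ u ∷ g)) (cong₂ _+_ (trans (↭-length q) l) lE))

  -- Pigeonhole, core by core: half of the edges agree on whether they meet o.
  refine : ∀ os b es → b * 2 ^ length os ≤ length es →
    ∃[ ts ] ∃[ us ] ∃[ fs ] os ↭ ts ++ us × b ≤ length fs × fs ⊆ₛ es ×
      All (λ o → All (Touches o) fs) ts × All (λ o → All (¬_ ∘ Touches o) fs) us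
  refine [] b es le = [] , [] , es , ↭-refl , ≤-trans (≤-reflexive (sym (*-identityʳ b))) le , ⊆ₛ-refl , [] , []
  refine (o ∷ os) b es le with b * 2 ^ length os ≤? length (filter (touches? o) es)
  ... | yes le₁ with refine os b (filter (touches? o) es) le₁
  ...   | ts , us , fs , p , lb , s , at , au = o ∷ ts , us , fs , prep o p , lb , ⊆ₛ-trans s (filter-sublist (touches? o) es) ,
            (All-⊑ (sublist⇒⊑ s) (All.all-filter (touches? o) es)) ∷ at , au
  refine (o ∷ os) b es le | no ≰ with refine os b (filter (¬? ∘ touches? o) es) le₂
    where
    le₂ : b * 2 ^ length os ≤ length (filter (¬? ∘ touches? o) es)
    le₂ = +-cancelˡ-≤ (b * 2 ^ length os) _ _ (begin
      b * 2 ^ length os + b * 2 ^ length os  ≡⟨ double b (2 ^ length os) ⟩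
      b * (2 * 2 ^ length os)                ≤⟨ le ⟩
      length es                              ≡⟨ length-filter-∁ (touches? o) es ⟨
      length (filter (touches? o) es) + length (filter (¬? ∘ touches? o) es)  ≤⟨ +-monoˡ-≤ _ (<⇒≤ (≰⇒> ≰)) ⟩
      b * 2 ^ length os + length (filter (¬? ∘ touches? o) es)                ∎)
      where
      open ≤-Reasoning
      double : ∀ b c → b * c + b * c ≡ b * (2 * c)
      double = solve-∀
  ...   | ts , us , fs , p , lb , s , at , au = ts , o ∷ us , fs , ↭-trans (prep o p) (↭-sym (shift o ts us)) , lb ,
            ⊆ₛ-trans s (filter-sublist (¬? ∘ touches? o) es) , at ,
            (All-⊑ (sublist⇒⊑ s) (All.all-filter (¬? ∘ touches? o) es)) ∷ au

  -- The vertices of a maximal family of disjoint bad edges meet every bad edge. The recursion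
  -- extends a matching by one edge, or uses the vertices of the one that cannot be extended as the
  -- cover.
  greedy : (Bad : List V → Set) → (∀ {e} → Bad e → Unique e × length e ≡ k) → ∀ b →
    (∀ es → length es ≡ b → All Bad es → Unique (concat es) → ⊥) →
    (∀ D → length D ≤ b * k → (∀ {e} → Bad e → ¬ Disjoint e D) → ⊥) → ⊥
  greedy Bad wf zero matching cover = matching [] refl [] []
  greedy Bad wf (suc b) matching cover = greedy Bad wf b
    (λ es l bad u → byCases (∃[ e ] Bad e × Disjoint e (concat es))
      (λ (e , be , d) → matching (e ∷ es) (cong suc l) (be ∷ bad) (Unique.++⁺ (proj₁ (wf be)) u d))
      (λ none → cover (concat es) (≤-trans (≤-reflexive (trans (len es bad) (cong (_* k) l))) (m≤n+m (b * k) k))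
        λ be d → none (_ , be , d)))
    (λ D l → cover D (≤-trans l (m≤n+m (b * k) k)))
    where
    len : ∀ es → All Bad es → length (concat es) ≡ length es * k
    len [] [] = refl
    len (e ∷ es) (be ∷ bs) = trans (length-++ e) (cong₂ _+_ (proj₂ (wf be)) (len es bs))

-- Each colour class of H would be placed into its own part. A proper colouring has no edge inside a
-- class, so only edges contained in no single part would have to be blue.
NoBlueParts : (G : RedGraph) {χ : ℕ} → (Fin χ → ℕ) → Set
NoBlueParts G {χ} size = ∀ (A : Fin χ → List V) → (∀ i → Unique (A i)) →
    (∀ {i j} → i ≢ j → Disjoint (A i) (A j)) → (∀ i → size i ≤ length (A i)) →
    ¬ (∀ e → Unique e → length e ≡ k → (∀ {x} → x ∈ e → ∃[ i ] x ∈ A i) → (∀ i → ¬ All (_∈ A i) e) → ¬ Red e)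
  where open RedGraph G

module CoreFamilies (G : RedGraph) (m₀ : ℕ) where

  open RedGraph G
  open Necks G m₀
  open Merging G m₀
  open MatchingLinks G m₀

  coreLength : ℕ
  coreLength = κ + m₀ * K₁

  length-core : ∀ o → length (coreOf o) ≡ coreLength
  length-core o = suc-injective (Open.len o)

  length-allCores : ∀ os → length (allCores os) ≡ length os * coreLength
  length-allCores [] = refl
  length-allCores (o ∷ os) = trans (length-++ (coreOf o)) (cong₂ _+_ (length-core o) (length-allCores os))

  Unique-core : ∀ os {o} → Unique (allVerts os) → o ∈ os → Unique (coreOf o)
  Unique-core os {o} u o∈ = Unique-⊑ (⊑-trans (core-⊑ o) (verts-⊑ o∈)) u

  disjoint-cores : ∀ os → Unique (allCores os) → ∀ {i j} → i ≢ j →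
    Disjoint (coreOf (lookup os i)) (coreOf (lookup os j))
  disjoint-cores (o ∷ os) u {zero} {zero} i≢j = ⊥-elim (i≢j refl)
  disjoint-cores (o ∷ os) u {zero} {suc j} _ (p , q) =
    proj₂ (proj₂ (Unique-++⁻ (coreOf o) u)) (p , ∈-allCores⁺ os (∈-lookup j) q)
  disjoint-cores (o ∷ os) u {suc i} {zero} _ (p , q) =
    proj₂ (proj₂ (Unique-++⁻ (coreOf o) u)) (q , ∈-allCores⁺ os (∈-lookup i) p)
  disjoint-cores (o ∷ os) u {suc i} {suc j} i≢j =
    disjoint-cores os (proj₁ (proj₂ (Unique-++⁻ (coreOf o) u))) (i≢j ∘ cong suc)

  RedCrossing : List Open → List V → Set
  RedCrossing os e = (Unique e × length e ≡ k) × Red e × All (_∈ allCores os) e ×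
    All (λ o → ¬ All (_∈ coreOf o) e) os

  -- Without `D` the cores are still as large as the colour classes, and no red edge is left across
  -- them.
  cover⇒⊥ : ∀ {χ} {size : Fin χ → ℕ} {v} → NoBlueParts G size → (∀ i → size i ≤ v) →
    ∀ os → length os ≡ χ → Unique (allVerts os) → ∀ D → length D + v ≤ coreLength →
    ¬ (∀ {e} → RedCrossing os e → ¬ Disjoint e D)
  cover⇒⊥ {size = size} {v} noBlue size≤v os refl u D room cover = noBlue A
      (λ i → Unique-⊑ (∖-⊑ _≟ᵛ_ (coreAt i) D) (Unique-core os u (∈-lookup i)))
      (λ i≢j (p , q) → disjoint-cores os (Unique-allCores os u) i≢j (proj₁ (∈A p) , proj₁ (∈A q)))
      (λ i → ≤-trans (size≤v i) (+-cancelˡ-≤ (length D) _ _ (begin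
        length D + v                        ≤⟨ room ⟩
        coreLength                          ≡⟨ length-core (lookup os i) ⟨
        length (coreAt i)                   ≤⟨ length-∖ _≟ᵛ_ D (Unique-core os u (∈-lookup i)) ⟩
        length D + length (A i)             ∎)))
      λ e ue le e⊆ cross r →
        let avoid : Disjoint e D
            avoid = λ (x∈e , x∈D) → proj₂ (∈A (proj₂ (e⊆ x∈e))) x∈D
        in cover ((ue , le) , r ,
             All.tabulate (λ x∈ → ∈-allCores⁺ os (∈-lookup (proj₁ (e⊆ x∈))) (proj₁ (∈A (proj₂ (e⊆ x∈))))) ,
             All.tabulate (λ o∈ e⊆o → cross (index o∈) (All.tabulate λ x∈ → ∈-∖⁺ _≟ᵛ_ _ D
               (subst (λ o → _ ∈ coreOf o) (lookup-index o∈) (All.lookup e⊆o x∈)) λ x∈D → avoid (x∈ , x∈D)))) avoid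
    where
    open ≤-Reasoning
    coreAt A : Fin (length os) → List V
    coreAt i = coreOf (lookup os i)
    A i = _∖_ _≟ᵛ_ (coreAt i) D
    ∈A : ∀ {i x} → x ∈ A i → x ∈ coreAt i × x ∉ D
    ∈A {i} = ∈-∖⁻ _≟ᵛ_ (coreAt i) D

-- Gathering long cycles with many cores

module Gathering (G : RedGraph) (m₀ : ℕ) where

  open RedGraph G
  open Necks G m₀
  open Merging G m₀
  open MatchingLinks G m₀
  open CoreFamilies G m₀

  -- The potential of the construction: its total rises with every merging and every new cycle and
  -- never exceeds the number of vertices.
  surplus : Open → ℕ
  surplus o = cores o ∸ 2

  totalSurplus : List Open → ℕ
  totalSurplus os = sum (map surplus os)

  -- The size of a clique that is cut into four marked segments. Opened at one of them, it keeps
  -- three, hence has surplus 1.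
  W : ℕ
  W = 4 * (m * K₁)

  -- Merging r ≥ 2 rich cycles costs one marked segment of each but saves r - 1
  -- times the 3 segments (one of them the open core) not counted as surplus.
  Rich : Open → Set
  Rich o = 2 ≤ cores o × length (verts o) ≤ W * surplus o

  sum-cores : ∀ {os} → All Rich os → sum (map cores os) ≡ totalSurplus os + length os * 2
  sum-cores [] = refl
  sum-cores {o ∷ os} ((2≤ , _) ∷ rs) = trans (cong₂ _+_ (sym (m∸n+n≡m 2≤)) (sum-cores rs))
    (regroup (surplus o) (totalSurplus os) (length os))
    where
    regroup : ∀ a b c → (a + 2) + (b + c * 2) ≡ (a + b) + suc c * 2
    regroup = solve-∀

  length-Rich : ∀ {os} → All Rich os → length (allVerts os) ≤ W * totalSurplus os
  length-Rich [] = z≤n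
  length-Rich {o ∷ os} ((_ , le) ∷ rs) = begin
    length (verts o ++ allVerts os)          ≡⟨ length-++ (verts o) ⟩
    length (verts o) + length (allVerts os)  ≤⟨ +-mono-≤ le (length-Rich rs) ⟩
    W * surplus o + W * totalSurplus os      ≡⟨ *-distribˡ-+ W (surplus o) _ ⟨
    W * totalSurplus (o ∷ os)                ∎
    where open ≤-Reasoning

  totalSurplus≤ : ∀ os → totalSurplus os ≤ length (allVerts os)
  totalSurplus≤ [] = z≤n
  totalSurplus≤ (o ∷ os) = begin
    surplus o + totalSurplus os              ≤⟨ +-mono-≤ (≤-trans (m∸n≤m (cores o) 2) (≤-trans (cores≤length (Open.rest o))
                                                  (length-⊑ (++-⊑ˡ (Open.rs o) _)))) (totalSurplus≤ os) ⟩
    length (verts o) + length (allVerts os)  ≡⟨ length-++ (verts o) ⟨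
    length (verts o ++ allVerts os)          ∎
    where open ≤-Reasoning

  abstract
    reopen : ∀ o₁ o₂ ts {w vs} → let os = o₁ ∷ o₂ ∷ ts in All Rich os → Neck (sum (map cores os)) w w vs →
      ∃[ o ] 2 ≤ cores o × totalSurplus os < surplus o × verts o ↭ vs
    reopen o₁ o₂ ts {vs = vs} rich neck = proj₁ opened , subst (2 ≤_) (sym eq) (s≤s (s≤s z≤n)) ,
        subst (totalSurplus os <_) (sym (cong (_∸ 2) eq)) (s≤s (m≤m+n _ _)) , proj₂ (proj₂ opened)
      where
      os : List Open
      os = o₁ ∷ o₂ ∷ ts
      regroup : ∀ a b → a + (suc (suc b)) * 2 ≡ suc (2 + (suc (a + 2 * b)))
      regroup = solve-∀
      opened : ∃[ o ] cores o ≡ 2 + suc (totalSurplus os + 2 * length ts) × verts o ↭ vs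
      opened = toOpen (recount (trans (sum-cores rich) (regroup (totalSurplus os) (length ts))) neck)
      eq : cores (proj₁ opened) ≡ 2 + suc (totalSurplus os + 2 * length ts)
      eq = proj₁ (proj₂ opened)

  mergeTouched : ∀ χ → χ * k + (κ + κ) ≤ coreLength → ∀ {o₁ o₂ ts f es} → let os = o₁ ∷ o₂ ∷ ts in
    length os ≤ χ → length os ≤ suc (length es) → Unique (allVerts os) → All Rich os →
    All RedEdge (f ∷ es) → Unique (f ++ concat es) → All (_∈ allCores os) (f ++ concat es) →
    All (λ o → All (Touches o) (f ∷ es)) os →
    ∃[ o ] Rich o × verts o ⊑ allVerts os × totalSurplus os < surplus o
  mergeTouched χ room {o₁} {o₂} {ts} {f} {es} ≤χ ≤es u rich (rf ∷ rs) uf f⊆ touch@((t ∷ _) ∷ _) with meet o₁ t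
  -- The last link ends in `w₀` in the first core. It starts in a different core because there are
  -- at least two cycles, so its two ends differ.
  ... | w₀ , w₀∈f , w₀∈o with edgeLinks o₁ (o₂ ∷ ts) es w₀∈f rf rs (s≤s⁻¹ ≤es) (λ ())
          (All.tabulate λ {o} o∈ w₀∈o′ → proj₂ (proj₂ (Unique-++⁻ (coreOf o₁) (Unique-allCores (o₁ ∷ o₂ ∷ ts) u))) (w₀∈o , ∈-allCores⁺ (o₂ ∷ ts) o∈ w₀∈o′))
          (Unique-allCores (o₁ ∷ o₂ ∷ ts) u) (All.map (λ { (p ∷ q) → p , q }) touch)
  ...   | E , links , E⊑ , lE with merge [] links w₀∈o (Unique-resp (↭-reflexive (sym (++-identityʳ _))) u) (Unique-⊑ E⊑ uf)
            (All.tabulate λ i → ∈-++⁺ˡ (All.lookup f⊆ (∈-⊑ E⊑ i)))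
            (All.tabulate λ {o} _ → begin
              length (w₀ ∷ E) + (κ + κ)          ≡⟨ cong (_+ (κ + κ)) lE ⟩
              length os * k + (κ + κ)            ≤⟨ +-monoˡ-≤ (κ + κ) (*-monoˡ-≤ k ≤χ) ⟩
              χ * k + (κ + κ)                    ≤⟨ room ⟩
              coreLength                         ≡⟨ length-core o ⟨
              length (coreOf o)                  ∎)
          where
          open ≤-Reasoning
          os = o₁ ∷ o₂ ∷ ts
  ...     | vs , neck , vs⊑ , lvs with reopen o₁ o₂ ts rich neck
  ...       | o , 2≤ , more , vo = o , (2≤ , bound) , ⊑-respˡ vo (⊑-respʳ vs⊑ (↭-reflexive (++-identityʳ _))) , more
    where
    os = o₁ ∷ o₂ ∷ ts
    -- Every cycle trades its core for k link vertices and 2κ fillers, so the merged cycle is no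
    -- longer than the given ones together.
    bound : length (verts o) ≤ W * surplus o
    bound = begin
      length (verts o)                                                              ≡⟨ ↭-length vo ⟩
      length vs                                                                     ≡⟨ lvs ⟩
      length (allBodies os) + (length (w₀ ∷ E) + length os * (κ + κ))               ≡⟨ cong (λ l → length (allBodies os) + (l + length os * (κ + κ))) lE ⟩
      length (allBodies os) + (length os * k + length os * (κ + κ))                 ≡⟨ cong (length (allBodies os) +_) (*-distribˡ-+ (length os) k (κ + κ)) ⟨
      length (allBodies os) + length os * (k + (κ + κ))                             ≤⟨ +-monoʳ-≤ (length (allBodies os)) (*-monoʳ-≤ (length os) room₁) ⟩
      length (allBodies os) + length os * coreLength                                ≡⟨ cong (length (allBodies os) +_) (length-allCores os) ⟨
      length (allBodies os) + length (allCores os)                                  ≡⟨ trans (↭-length (allVerts-↭ os)) (length-++ (allBodies os)) ⟨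
      length (allVerts os)                                                          ≤⟨ length-Rich rich ⟩
      W * totalSurplus os                                                           ≤⟨ *-monoʳ-≤ W (<⇒≤ more) ⟩
      W * surplus o                                                                 ∎
      where
      open ≤-Reasoning
      room₁ : k + (κ + κ) ≤ coreLength
      room₁ = ≤-trans (+-monoˡ-≤ (κ + κ) (≤-trans (≤-reflexive (sym (+-identityʳ k))) (*-monoˡ-≤ k (≤-trans (s≤s z≤n) ≤χ)))) room

  cliqueNeck : ∀ c b A → length A ≡ c * (m * K₁) → Clique (b ∷ A) → ∃[ a ] Neck c a b A × a ∈ b ∷ A
  cliqueNeck zero b [] l cl = b , [] , here refl
  cliqueNeck (suc c) b A l cl with split (m * K₁) A (≤-trans (m≤m+n _ _) (≤-reflexive (sym l)))
  ... | [] , A′ , refl , ()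
  ... | x ∷ ks , A′ , refl , lB with cliqueNeck c b A′
          (+-cancelˡ-≡ (m * K₁) _ _ (trans (cong (_+ length A′) (sym lB)) (trans (sym (length-++ (x ∷ ks))) l)))
          (Clique-⊆ (here refl ∷ All.tabulate λ i → there (∈-++⁺ʳ (x ∷ ks) i)) cl)
  ...   | a , neck , a∈ = x , core (Clique-⊆ (there (here refl) ∷ inTail a∈ ∷ All.tabulate λ i → there (there (∈-++⁺ˡ i))) cl) lB neck ,
            there (here refl)
    where
    inTail : ∀ {z} → z ∈ b ∷ A′ → z ∈ b ∷ (x ∷ ks) ++ A′
    inTail (here eq) = here eq
    inTail (there i) = there (∈-++⁺ʳ (x ∷ ks) i)

  newOpen : ∀ A → length A ≡ 4 * (m * K₁) → Clique A → ∃[ o ] Rich o × verts o ↭ A × surplus o ≡ 1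
  -- The end `x` is also the first vertex of the list, so `head-Neck` identifies it with the start
  -- and the neck closes up.
  newOpen (x ∷ A) l cl with cliqueNeck 4 x (x ∷ A) l (Clique-⊆ (here refl ∷ All.tabulate id) cl)
  ... | a , neck , _ with head-Neck neck
  ...   | _ , refl with toOpen neck
  ...     | o , co , vo = o , (subst (2 ≤_) (sym co) (s≤s (s≤s z≤n)) ,
              ≤-reflexive (trans (↭-length vo) (trans l (sym (trans (cong (λ c → W * (c ∸ 2)) co) (*-identityʳ W)))))) ,
              vo , cong (_∸ 2) co

  module _ (v : ℕ)
    (noBlueClique : NoBlueClique G v)
    {t : ℕ} {size : Fin (suc t) → ℕ} (noBlueParts : NoBlueParts G size) (size≤v : ∀ i → size i ≤ v)
    (room₁ : suc t * 2 ^ suc t * k + v ≤ coreLength) (room₂ : suc t * k + (κ + κ) ≤ coreLength)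
    {n₁ : ℕ} (win : ∀ o → Unique (verts o) → length (verts o) ≤ n₁)
    (allV : List V) (uAll : Unique allV) (complete : ∀ x → x ∈ allV)
    where

    open Cliques G v noBlueClique

    R : ℕ
    R = cliqueNumber W

    leftover : List Open → List V
    leftover os = _∖_ _≟ᵛ_ allV (allVerts os)

    length-leftover : ∀ os → length allV ≤ length (allVerts os) + length (leftover os)
    length-leftover os = length-∖ _≟ᵛ_ (allVerts os) uAll

    length-allVerts≤ : ∀ os → Unique (allVerts os) → length (allVerts os) ≤ length allV
    length-allVerts≤ os u = unique-⊆⇒length u (All.tabulate λ {x} _ → complete x)

    allVerts≤ : ∀ os → Unique (allVerts os) → length (allVerts os) ≤ length os * n₁
    allVerts≤ [] u = z≤n
    allVerts≤ (o ∷ os) u with Unique-++⁻ (verts o) u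
    ... | u₁ , u₂ , _ = ≤-trans (≤-reflexive (length-++ (verts o))) (+-mono-≤ (win o u₁) (allVerts≤ os u₂))

    -- Fuel can run out only when the total surplus exceeds the number of vertices.
    gather : ∀ fuel os → length allV < fuel + totalSurplus os → length os ≤ suc t → Unique (allVerts os) → All Rich os →
      R ≤ n₁ → t * n₁ < length allV →
      (∀ os → length os ≡ t → Unique (allVerts os) → All Rich os → length allV ≤ length (allVerts os) + R → ⊥) → ⊥
    gather zero os lt _ u _ _ _ _ = <⇒≱ lt (≤-trans (totalSurplus≤ os) (length-allVerts≤ os u))
    gather (suc fuel) os lt le u rich R≤ N> cont with length os ≟ suc t
    -- There are 2^(t+1) possible sets of met cores, so this many disjoint edges contain t + 1 with
    -- the same set: one for each link needed.
    ... | yes full = greedy (RedCrossing os) proj₁ (suc t * 2 ^ suc t) linked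
            (λ D lD → cover⇒⊥ noBlueParts size≤v os full u D (≤-trans (+-monoˡ-≤ v lD) room₁))
      where
      linked : ∀ es → length es ≡ suc t * 2 ^ suc t → All (RedCrossing os) es → Unique (concat es) → ⊥
      linked es les bad ues with refine os (suc t) es
          (≤-reflexive (trans (cong (λ l → suc t * 2 ^ l) full) (sym les)))
      ... | ts , us , f ∷ fs , os↭ , lfs , fs⊆ , at , au = finish ts os↭ at
        where
        badfs : All (RedCrossing os) (f ∷ fs)
        badfs = All-⊑ (sublist⇒⊑ fs⊆) bad
        inTouched : ∀ {ts e x} → os ↭ ts ++ us → e ∈ f ∷ fs → x ∈ e → ∃[ o ] o ∈ ts × x ∈ coreOf o
        inTouched {ts} os↭ e∈ x∈ with All.lookup badfs e∈
        ... | _ , _ , e⊆ , _ with ∈-allCores⁻ os (All.lookup e⊆ x∈)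
        ...   | o , o∈ , x∈o with ∈-++⁻ ts (∈-resp-↭ os↭ o∈)
        ...     | inj₁ o∈ts = o , o∈ts , x∈o
        ...     | inj₂ o∈us = ⊥-elim (All.lookup (All.lookup au o∈us) e∈ (Any.map (λ { refl → x∈o }) x∈))
        splitUnique : ∀ ts → os ↭ ts ++ us → Unique (allVerts ts ++ allVerts us)
        splitUnique ts os↭ = Unique-resp (↭-trans (allVerts-resp os↭) (↭-reflexive (allVerts-++ ts))) u
        -- The edges lie in the cores, so they meet at least one; they lie in no single core, so
        -- they meet at least two.
        finish : ∀ ts → os ↭ ts ++ us → All (λ o → All (Touches o) (f ∷ fs)) ts → ⊥
        finish [] os↭ _ with All.lookup badfs (here refl)
        ... | (_ , lf) , _ = nonempty f lf (inTouched os↭ (here refl))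
          where
          nonempty : ∀ e → length e ≡ k → ¬ (∀ {x} → x ∈ e → ∃[ o ] o ∈ [] × x ∈ coreOf o)
          nonempty (x ∷ _) _ h with h (here refl)
          ... | _ , () , _
        finish (o ∷ []) os↭ _ with All.lookup badfs (here refl)
        ... | _ , _ , _ , cross = All.lookup cross (∈-resp-↭ (↭-sym os↭) (here refl))
                (All.tabulate λ x∈ → case inTouched os↭ (here refl) x∈ of λ { (_ , here refl , x∈o) → x∈o })
        finish ts@(_ ∷ _ ∷ _) os↭ touch with mergeTouched (suc t) room₂ ts≤ (≤-trans ts≤ lfs) uts richts
              (All.map (λ ((_ , l) , r , _) → r , l) badfs)
              (Unique-⊑ (concat-sublist fs⊆) ues)
              (All.tabulate λ x∈ → let e , x∈e , e∈ = ∈-concat⁻′ (f ∷ fs) x∈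
                                       o , o∈ , x∈o = inTouched os↭ e∈ x∈e
                                   in ∈-allCores⁺ ts o∈ x∈o) touch
          where
          ts≤ : length ts ≤ suc t
          ts≤ = ≤-trans (length-⊑ (++-⊑ˡ ts us)) (≤-trans (≤-reflexive (sym (↭-length os↭))) le)
          richts : All Rich ts
          richts = All.++⁻ˡ ts (All-resp-↭ os↭ rich)
          uts : Unique (allVerts ts)
          uts = proj₁ (Unique-++⁻ (allVerts ts) (splitUnique ts os↭))
        ... | o , ro , vo , more = gather fuel (o ∷ us) lt′ le′
                (Unique-⊑ (⊑-++ vo ⊑-refl) (splitUnique ts os↭)) (ro ∷ All.++⁻ʳ ts (All-resp-↭ os↭ rich)) R≤ N> cont
          where
          le′ : length (o ∷ us) ≤ suc t
          le′ = ≤-trans (+-monoˡ-≤ (length us) (s≤s z≤n)) (≤-trans (≤-reflexive (trans (sym (length-++ ts)) (sym (↭-length os↭)))) le)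
          lt′ : length allV < fuel + totalSurplus (o ∷ us)
          lt′ = ≤-trans (≤-trans lt (≤-reflexive (sym (+-suc fuel _)))) (+-monoʳ-≤ fuel (≤-trans
                  (s≤s (≤-reflexive (trans (sum-↭ (Perm.map⁺ surplus os↭)) (trans (cong sum (map-++ surplus ts us)) (sum-++ (map surplus ts) _)))))
                  (+-monoˡ-≤ (totalSurplus us) more)))
    ... | no ¬full with R ≤? length (leftover os)
    ...   | yes R≤L with findClique W (leftover os) (Unique-⊑ (∖-⊑ _≟ᵛ_ allV (allVerts os)) uAll) R≤L
    ...     | A , A⊑ , lA , cl with newOpen A lA cl
    ...       | o , ro , vo , so = gather fuel (o ∷ os)
                  (≤-trans lt (≤-reflexive (trans (sym (+-suc fuel _)) (cong (λ s → fuel + (s + totalSurplus os)) (sym so)))))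
                  (s≤s (s≤s⁻¹ (≤∧≢⇒< le ¬full)))
                  (Unique.++⁺ (Unique-resp (↭-sym vo) (Unique-⊑ A⊑ (Unique-⊑ (∖-⊑ _≟ᵛ_ allV (allVerts os)) uAll))) u
                    λ (p , q) → proj₂ (∈-∖⁻ _≟ᵛ_ allV (allVerts os) (∈-⊑ A⊑ (∈-resp-↭ vo p))) q)
                  (ro ∷ rich) R≤ N> cont
    gather (suc fuel) os lt le u rich R≤ N> cont | no ¬full | no R≰L = cont os len u rich
        (≤-trans (length-leftover os) (+-monoʳ-≤ _ (<⇒≤ (≰⇒> R≰L))))
      where
      len : length os ≡ t
      len = ≤-antisym (s≤s⁻¹ (≤∧≢⇒< le ¬full)) (≮⇒≥ λ short → <⇒≱ N> (begin
        length allV                                    ≤⟨ length-leftover os ⟩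
        length (allVerts os) + length (leftover os)    ≤⟨ +-mono-≤ (allVerts≤ os u) (≤-trans (<⇒≤ (≰⇒> R≰L)) R≤) ⟩
        length os * n₁ + n₁                            ≡⟨ +-comm _ n₁ ⟩
        suc (length os) * n₁                           ≤⟨ *-monoˡ-≤ n₁ short ⟩
        t * n₁                                         ∎))
        where open ≤-Reasoning

-- Absorbing leftover vertices

module Absorbing (G : RedGraph) (m₀ : ℕ) where

  open RedGraph G
  open Necks G m₀
  open Merging G m₀
  open CoreFamilies G m₀

  -- One vertex of `L` is enough: absorbers are chained until together they bring in K₁ of them.
  record Absorber (K L : List V) : Set where
    field
      {u w} : V
      {vs} : List V
      path : Path u w vs
      u∈ : u ∈ K
      w∈ : w ∈ K
      unique : Unique (vs ++ [ w ])
      within : All (_∈ K ++ L) (vs ++ [ w ])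
      meets : Any (_∈ L) (vs ++ [ w ])
      short : length vs ≤ 2 * K₁

  Absorber-⊆ : ∀ {K K′ L L′} → (∀ {x} → x ∈ K → x ∈ K′) → (∀ {x} → x ∈ L → x ∈ L′) → Absorber K L → Absorber K′ L′
  Absorber-⊆ {K} {K′} K⊆ L⊆ a = record
    { path = path ; u∈ = K⊆ u∈ ; w∈ = K⊆ w∈ ; unique = unique ; short = short ; meets = Any.map L⊆ meets
    ; within = All.map (λ i → case ∈-++⁻ K i of λ { (inj₁ j) → ∈-++⁺ˡ (K⊆ j) ; (inj₂ j) → ∈-++⁺ʳ K′ (L⊆ j) }) within }
    where open Absorber a

  partition : ∀ {K L} va → Unique va → All (_∈ K ++ L) va → Any (_∈ L) va →
    ∃[ aK ] ∃[ aL ] va ↭ aK ++ aL × aK ⊑ K × aL ⊑ L × 1 ≤ length aL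
  partition {K} {L} va u va⊆ some = filter (¬? ∘ (_∈? L)) va , filter (_∈? L) va ,
      ↭-trans (↭-sym (filter-++-∁ (_∈? L) va)) (++-comm (filter (_∈? L) va) _) ,
      unique-⊆⇒⊑ (Unique.filter⁺ (¬? ∘ (_∈? L)) u) (All.tabulate λ i →
        let i′ , x∉L = ∈-filter⁻ (¬? ∘ (_∈? L)) {xs = va} i in
        case ∈-++⁻ K (All.lookup va⊆ i′) of λ { (inj₁ j) → j ; (inj₂ j) → ⊥-elim (x∉L j) }) ,
      unique-⊆⇒⊑ (Unique.filter⁺ (_∈? L) u) (All.all-filter (_∈? L) va) ,
      filter-some (_∈? L) some

  -- The marked segment of o is being rebuilt from its start x: the red path
  -- vs reached w, used the vertices ls of L, and left the vertices ks and L′.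
  record Partial (o : Open) (L : List V) (steps : ℕ) : Set where
    constructor partial
    field
      {vs ks ls L′} : List V
      {w} : V
      path : Path (Open.x o) w vs
      vertices : vs ++ w ∷ ks ↭ Open.x o ∷ coreOf o ++ ls
      rest⊑ : ks ⊑ coreOf o
      w∈ : w ∈ Open.x o ∷ coreOf o
      L-split : ls ++ L′ ↭ L
      gained : steps ≤ length ls
      used : length vs ≤ steps * (3 * K₁)

  module _ (o : Open) (y∉ : Open.y o ∉ Open.x o ∷ coreOf o) (L : List V)
    (uo : Unique (verts o ++ L)) (room : K₁ * (3 * K₁) ≤ coreLength) where

    private
      x y : V
      x = Open.x o
      y = Open.y o
      rs : List V
      rs = Open.rs o
      inClique : ∀ {z} → z ∈ x ∷ coreOf o → z ∈ x ∷ y ∷ coreOf o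
      inClique (here eq) = here eq
      inClique (there i) = there (there i)

    abstract
      unique-xksL : Unique (x ∷ coreOf o ++ L)
      unique-xksL = Unique-⊑ (⊑-respʳ (++-⊑ʳ rs (x ∷ coreOf o ++ L)) (↭-reflexive (sym (++-assoc rs (x ∷ coreOf o) L)))) uo

      remaining : ∀ {j} (P : Partial o L j) → length (Partial.vs P) + length (Partial.ks P) ≡ coreLength + length (Partial.ls P)
      remaining P = suc-injective (trans (sym (+-suc (length vs) _)) (trans (sym (length-++ vs))
          (trans (↭-length vertices) (cong suc (trans (length-++ (coreOf o)) (cong (_+ length ls) (length-core o)))))))
        where open Partial P

      -- A clique edge with fillers `F` leads from `w` to the start of the absorber. It takes K₁
      -- vertices and the absorber at most 2 * K₁, whence the 3 * K₁ per step.
      extend : ∀ {j} (P : Partial o L j) → j ≤ κ → Absorber (Partial.ks P) (Partial.L′ P) → Partial o L (suc j)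
      extend {j} P j≤κ a with partition (Absorber.vs a ++ [ Absorber.w a ]) (Absorber.unique a) (Absorber.within a) (Absorber.meets a)
      ... | aK , aL , va↭ , (ks₁ , ks↭) , (L₁ , L↭) , 1≤ with split κ ks₁ enough
        where
        open Partial P
        open ≤-Reasoning
        arith : ∀ κ → 2 * suc κ + 1 + κ ≡ 3 * suc κ
        arith = solve-∀
        small : length aK ≤ 2 * K₁ + 1
        small = begin
          length aK                                         ≤⟨ length-⊑ (⊑-respʳ (++-⊑ˡ aK aL) (↭-sym va↭)) ⟩
          length (Absorber.vs a ++ [ Absorber.w a ])        ≡⟨ length-++ (Absorber.vs a) ⟩
          length (Absorber.vs a) + 1                        ≤⟨ +-monoˡ-≤ 1 (Absorber.short a) ⟩
          2 * K₁ + 1                                        ∎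
        enough : κ ≤ length ks₁
        enough = +-cancelˡ-≤ (length vs + length aK) _ _ (begin
          length vs + length aK + κ                        ≤⟨ +-monoˡ-≤ κ (+-mono-≤ used small) ⟩
          j * (3 * K₁) + (2 * K₁ + 1) + κ                  ≡⟨ trans (+-assoc (j * (3 * K₁)) _ κ) (cong (j * (3 * K₁) +_) (arith κ)) ⟩
          j * (3 * K₁) + 3 * K₁                            ≡⟨ +-comm (j * (3 * K₁)) (3 * K₁) ⟩
          suc j * (3 * K₁)                                 ≤⟨ *-monoˡ-≤ (3 * K₁) (s≤s j≤κ) ⟩
          K₁ * (3 * K₁)                                    ≤⟨ room ⟩
          coreLength                                       ≤⟨ m≤m+n coreLength (length ls) ⟩
          coreLength + length ls                           ≡⟨ remaining P ⟨
          length vs + length ks                            ≡⟨ cong (length vs +_) (trans (sym (↭-length ks↭)) (length-++ aK)) ⟩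
          length vs + (length aK + length ks₁)             ≡⟨ +-assoc (length vs) (length aK) (length ks₁) ⟨
          length vs + length aK + length ks₁               ∎)
      ... | F , ks₂ , refl , lF = record
        { vs = vs ++ (w ∷ F) ++ Absorber.vs a ; ks = ks₂ ; ls = ls ++ aL ; L′ = L₁ ; w = Absorber.w a
        ; path = path ▻ (oneEdge redEdge lF ▻ Absorber.path a)
        ; vertices = ↭-trans
            (perm 6 (λ v w f p q r → (v ∙ (w ∙ f) ∙ p) ∙ q ∙ r ⇌ (v ∙ w ∙ f ∙ r) ∙ (p ∙ q)) ↭-refl vs [ w ] F (Absorber.vs a) [ Absorber.w a ] ks₂)
            (↭-trans (++⁺ˡ (vs ++ w ∷ F ++ ks₂) va↭)
            (↭-trans (perm 6 (λ v w f r p q → (v ∙ w ∙ f ∙ r) ∙ (p ∙ q) ⇌ (v ∙ w ∙ (p ∙ (f ∙ r))) ∙ q) ↭-refl vs [ w ] F ks₂ aK aL)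
            (↭-trans (++⁺ʳ aL (++⁺ˡ (vs) (prep w ks↭)))
            (↭-trans (++⁺ʳ aL vertices)
            (↭-reflexive (cong (x ∷_) (++-assoc (coreOf o) ls aL)))))))
        ; rest⊑ = ⊑-trans (++-⊑ʳ F ks₂) (⊑-trans (⊑-respʳ (++-⊑ʳ aK (F ++ ks₂)) ks↭) rest⊑)
        ; w∈ = there (∈-⊑ rest⊑ (Absorber.w∈ a))
        ; L-split = ↭-trans (↭-reflexive (++-assoc ls aL L₁)) (↭-trans (++⁺ˡ ls L↭) L-split)
        ; gained = ≤-trans (≤-reflexive (+-comm 1 j)) (≤-trans (+-mono-≤ gained 1≤) (≤-reflexive (sym (length-++ ls))))
        ; used = begin
            length (vs ++ (w ∷ F) ++ Absorber.vs a)                ≡⟨ trans (length-++ vs) (cong (length vs +_) (length-++ (w ∷ F))) ⟩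
            length vs + (suc (length F) + length (Absorber.vs a))  ≤⟨ +-mono-≤ used (+-mono-≤ (≤-reflexive (cong suc lF)) (Absorber.short a)) ⟩
            j * (3 * K₁) + (K₁ + 2 * K₁)                           ≡⟨ +-comm (j * (3 * K₁)) _ ⟩
            suc j * (3 * K₁)                                       ∎
        }
        where
        open Partial P
        open ≤-Reasoning
        va : List V
        va = Absorber.vs a ++ [ Absorber.w a ]
        u : V
        u = Absorber.u a
        u∈va : u ∈ va
        u∈va = start∈ (Absorber.path a)
        unique-all : Unique ((w ∷ ks) ++ L′)
        unique-all = Unique-⊑ (vs , ↭-trans (perm 4 (λ w k l v → ((w ∙ k) ∙ l) ∙ v ⇌ (v ∙ w ∙ k) ∙ l) ↭-refl [ w ] ks L′ vs)
                        (↭-trans (++⁺ʳ L′ vertices) (↭-trans (↭-reflexive (cong (x ∷_) (++-assoc (coreOf o) ls L′)))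
                          (++⁺ˡ (x ∷ coreOf o) L-split)))) unique-xksL
        unique-edge : Unique ((w ∷ F) ++ va)
        unique-edge = Unique-⊑ (⊑-respˡ (↭-trans (++⁺ˡ (w ∷ F) va↭) (perm 4 (λ w f p q → (w ∙ f) ∙ p ∙ q ⇌ (w ∙ p ∙ f) ∙ q) ↭-refl [ w ] F aK aL))
                        (⊑-++ (∷-⊑ (⊑-respʳ (⊑-++ (⊑-refl {xs = aK}) (++-⊑ˡ F ks₂)) ks↭)) (⊑-respʳ (++-⊑ˡ aL L₁) L↭))) unique-all
        redEdge : Red (u ∷ w ∷ F)
        redEdge = Open.clique o (cons (λ u∈ → proj₂ (proj₂ (Unique-++⁻ (w ∷ F) unique-edge)) (u∈ , u∈va)) (proj₁ (Unique-++⁻ (w ∷ F) unique-edge)))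
          (cong suc (cong suc lF))
          (inClique (there (∈-⊑ rest⊑ (Absorber.u∈ a))) ∷ inClique w∈ ∷
            All.tabulate λ i → inClique (there (∈-⊑ rest⊑ (∈-⊑ (⊑-respʳ (⊑-trans (++-⊑ˡ F ks₂) (++-⊑ʳ aK (F ++ ks₂))) ks↭) i))))

      -- The vertices visited and those still free number `coreLength` plus at least K₁, enough for
      -- one edge more than the m edges of the core. The path has p edges so far and the clique
      -- supplies the rest; free vertices beyond that are dropped.
      complete : ∀ {j} (P : Partial o L j) → j ≤ K₁ → K₁ ≤ length (Partial.ls P) →
        ∃[ vs ] Path x y vs × vs ⊑ x ∷ coreOf o ++ L × length vs ≡ suc m * K₁
      complete {j} P j≤ ≤ls with length-Neck (Partial.path P)
      ... | p , lp with m≤n⇒∃[o]m+o≡n p≤m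
        where
        open ≤-Reasoning
        p≤m : p ≤ m
        p≤m = *-cancelʳ-≤ p m K₁ (begin
          p * K₁                    ≡⟨ lp ⟨
          length (Partial.vs P)     ≤⟨ Partial.used P ⟩
          j * (3 * K₁)              ≤⟨ *-monoˡ-≤ (3 * K₁) j≤ ⟩
          K₁ * (3 * K₁)             ≤⟨ room ⟩
          coreLength                ≤⟨ n≤1+n coreLength ⟩
          m * K₁                    ∎)
      ... | j₀ , p+j₀ with split (κ + j₀ * K₁) (Partial.ks P) enough
        where
        open Partial P
        open ≤-Reasoning
        enough : κ + j₀ * K₁ ≤ length ks
        enough = +-cancelˡ-≤ (suc (length vs)) _ _ (begin
          suc (length vs) + (κ + j₀ * K₁)   ≡⟨ cong (λ l → suc l + (κ + j₀ * K₁)) lp ⟩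
          suc (p * K₁) + (κ + j₀ * K₁)      ≡⟨ arith p j₀ κ ⟩
          (p + j₀) * K₁ + K₁                ≡⟨ cong (λ l → l * K₁ + K₁) p+j₀ ⟩
          suc coreLength + K₁               ≤⟨ +-monoʳ-≤ (suc coreLength) ≤ls ⟩
          suc (coreLength + length ls)      ≡⟨ cong suc (remaining P) ⟨
          suc (length vs) + length ks       ∎)
          where
          arith : ∀ p j κ → suc (p * suc κ) + (κ + j * suc κ) ≡ (p + j) * suc κ + suc κ
          arith = solve-∀
      ... | fill , ks₁ , refl , lf = vs ++ w ∷ fill ,
          path ▻ cliquePath j₀ w y fill (cong suc lf)
            (Clique-⊆ (inClique w∈ ∷ there (here refl) ∷ All.tabulate λ i → inClique (there (∈-⊑ rest⊑ (∈-++⁺ˡ i)))) (Open.clique o))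
            (Unique-resp (swap y w ↭-refl) (cons y∉′ (Unique-⊑ (⊑-trans (++-⊑ʳ vs (w ∷ fill)) vs⊑) unique-xksL))) ,
          vs⊑ ,
          (begin
            length (vs ++ w ∷ fill)                 ≡⟨ length-++ vs ⟩
            length vs + suc (length fill)           ≡⟨ cong₂ (λ a b → a + suc b) lp lf ⟩
            p * K₁ + suc j₀ * K₁                    ≡⟨ *-distribʳ-+ K₁ p (suc j₀) ⟨
            (p + suc j₀) * K₁                       ≡⟨ cong (_* K₁) (trans (+-suc p j₀) (cong suc p+j₀)) ⟩
            suc m * K₁                              ∎)
        where
        open Partial P
        open ≡-Reasoning
        vs⊑ : vs ++ w ∷ fill ⊑ x ∷ coreOf o ++ L
        vs⊑ = ⊑-trans (ks₁ , ↭-trans (↭-reflexive (++-assoc vs (w ∷ fill) ks₁)) vertices) (⊑-++ (⊑-refl {xs = x ∷ coreOf o}) (⊑-respʳ (++-⊑ˡ ls L′) L-split))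
        y∉′ : y ∉ w ∷ fill
        y∉′ (here refl) = y∉ w∈
        y∉′ (there i) = y∉ (there (∈-⊑ rest⊑ (∈-++⁺ˡ i)))

    -- A step gains at least one vertex of `L`, so K₁ steps suffice. A loop stuck before has used at
    -- most κ vertices of `L` and K₁ * (3 * K₁) of the core, and among the others there is no
    -- absorber.
    absorbLoop : ∀ fuel {j} → K₁ < fuel + j → (P : Partial o L j) → j ≤ K₁ →
      (∀ vs → Path x y vs → vs ⊑ x ∷ coreOf o ++ L → length vs ≡ suc m * K₁ → ⊥) →
      (∀ ks Z ls L′ → ks ++ Z ↭ coreOf o → length Z ≤ K₁ * (3 * K₁) → ls ++ L′ ↭ L → length ls ≤ κ →
        ¬ Absorber ks L′ → ⊥) → ⊥
    absorbLoop fuel {j} lt P j≤ absorbed stuck with K₁ ≤? length (Partial.ls P)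
    ... | yes enough = let vs , p , vs⊑ , l = complete P j≤ enough in absorbed vs p vs⊑ l
    absorbLoop zero lt P j≤ absorbed stuck | no few = <⇒≱ lt j≤
    absorbLoop (suc fuel) {j} lt P j≤ absorbed stuck | no few = byCases (Absorber ks L′)
        (λ a → absorbLoop fuel (≤-trans lt (≤-reflexive (sym (+-suc fuel j)))) (extend P (s≤s⁻¹ j<K₁) a) j<K₁ absorbed stuck)
        (stuck ks Z ls L′ ks↭ lZ L-split (s≤s⁻¹ (≰⇒> few)))
      where
      open Partial P
      j<K₁ : j < K₁
      j<K₁ = ≤-<-trans gained (≰⇒> few)
      Z = proj₁ rest⊑
      ks↭ = proj₂ rest⊑
      lZ : length Z ≤ K₁ * (3 * K₁)
      lZ = +-cancelˡ-≤ (length ks) _ _ (begin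
        length ks + length Z          ≡⟨ trans (sym (length-++ ks)) (↭-length ks↭) ⟩
        length (coreOf o)             ≡⟨ length-core o ⟩
        coreLength                    ≤⟨ m≤m+n coreLength (length ls) ⟩
        coreLength + length ls        ≡⟨ remaining P ⟨
        length vs + length ks         ≡⟨ +-comm (length vs) (length ks) ⟩
        length ks + length vs         ≤⟨ +-monoʳ-≤ (length ks) (≤-trans used (*-monoˡ-≤ (3 * K₁) j≤)) ⟩
        length ks + K₁ * (3 * K₁)     ∎)
        where open ≤-Reasoning

  -- Absorption lengthens the cycle by one edge at the cost of one marked segment.
  absorb : ∀ o → 1 ≤ cores o → ∀ L → Unique (verts o ++ L) → K₁ * (3 * K₁) ≤ coreLength →
    (∀ o′ → cores o ≡ suc (cores o′) → length (verts o′) ≡ length (verts o) + K₁ → verts o′ ⊑ verts o ++ L → ⊥) →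
    (∀ ks Z ls L′ → ks ++ Z ↭ coreOf o → length Z ≤ K₁ * (3 * K₁) → ls ++ L′ ↭ L → length ls ≤ κ →
      ¬ Absorber ks L′ → ⊥) → ⊥
  absorb o@(mkOpen {suc c} {x} {y} {rs} {ks} rest cl len) 1≤ L u room absorbed =
    absorbLoop o y∉ L u room (suc K₁) (≤-reflexive (sym (+-identityʳ (suc K₁)))) start z≤n done
    where
    -- `rest` still contains a core, so it is not empty and `y` is its first vertex; an empty rest
    -- would make y equal to x.
    y∉ : y ∉ x ∷ ks
    y∉ y∈ = proj₂ (proj₂ (Unique-++⁻ rs (proj₁ (Unique-++⁻ (verts o) u)))) (inside rest , y∈)
      where
      inside : ∀ {c a b vs} → Neck (suc c) a b vs → a ∈ vs
      inside (edge _ _ _) = here refl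
      inside (core _ _ _) = here refl
    start : Partial o L 0
    start = partial {vs = []} {ks} {[]} {L} [] (↭-reflexive (cong (x ∷_) (sym (++-identityʳ ks)))) ⊑-refl (here refl) ↭-refl z≤n z≤n
    done : ∀ vs → Path x y vs → vs ⊑ x ∷ ks ++ L → length vs ≡ suc m * K₁ → ⊥
    done vs p vs⊑ l with toOpen (rest ▻ p)
    ... | o′ , co , vo = absorbed o′ (cong suc (trans (sym (+-identityʳ c)) (sym co)))
        (begin
          length (verts o′)               ≡⟨ ↭-length vo ⟩
          length (rs ++ vs)               ≡⟨ length-++ rs ⟩
          length rs + length vs           ≡⟨ cong (length rs +_) l ⟩
          length rs + (K₁ + m * K₁)       ≡⟨ cong (length rs +_) (+-comm K₁ (m * K₁)) ⟩
          length rs + (m * K₁ + K₁)       ≡⟨ +-assoc (length rs) (m * K₁) K₁ ⟨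
          length rs + m * K₁ + K₁         ≡⟨ cong (_+ K₁) (length-verts o) ⟨
          length (verts o) + K₁           ∎)
        (⊑-respˡ vo (⊑-respʳ (⊑-++ (⊑-refl {xs = rs}) vs⊑) (↭-reflexive (sym (++-assoc rs (x ∷ ks) L)))))
      where open ≡-Reasoning

-- Destroying absorbers and links by deletions

module _ {A : Set} where

  pairs : List A → List (A × A)
  pairs [] = []
  pairs (x ∷ xs) = map (x ,_) xs ++ pairs xs

  length-pairs : ∀ xs → length (pairs xs) ≡ length xs C 2
  length-pairs [] = refl
  length-pairs (x ∷ xs) = begin
    length (map (x ,_) xs ++ pairs xs)        ≡⟨ length-++ (map (x ,_) xs) ⟩
    length (map (x ,_) xs) + length (pairs xs) ≡⟨ cong₂ _+_ (trans (length-map (x ,_) xs) (sym (nC1≡n (length xs)))) (length-pairs xs) ⟩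
    length xs C 1 + length xs C 2             ≡⟨ nCk+nC[k+1]≡[n+1]C[k+1] (length xs) 1 ⟩
    length (x ∷ xs) C 2                       ∎
    where open ≡-Reasoning

  ∈-pairs⁻ : ∀ xs {x y} → (x , y) ∈ pairs xs → ∃[ zs ] x ∷ y ∷ zs ↭ xs
  ∈-pairs⁻ (x ∷ xs) xy∈ with ∈-++⁻ (map (x ,_) xs) xy∈
  ... | inj₁ i with ∈-map⁻ (x ,_) i
  ...   | y , y∈ , refl with extract y∈
  ...     | zs , p = zs , prep x (↭-sym p)
  ∈-pairs⁻ (x ∷ xs) {a} {b} xy∈ | inj₂ i with ∈-pairs⁻ xs i
  ...   | zs , p = x ∷ zs , ↭-trans (perm 4 (λ a b x z → a ∙ b ∙ x ∙ z ⇌ x ∙ a ∙ b ∙ z) ↭-refl [ a ] [ b ] [ x ] zs) (prep x p)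

  ∈-pairs⁺ : ∀ xs {i j} → i ≢ j → let a = lookup xs i ; b = lookup xs j in (a , b) ∈ pairs xs ⊎ (b , a) ∈ pairs xs
  ∈-pairs⁺ (x ∷ xs) {zero} {zero} i≢j = ⊥-elim (i≢j refl)
  ∈-pairs⁺ (x ∷ xs) {zero} {suc j} _ = inj₁ (∈-++⁺ˡ (∈-map⁺ (x ,_) (∈-lookup {xs = xs} j)))
  ∈-pairs⁺ (x ∷ xs) {suc i} {zero} _ = inj₂ (∈-++⁺ˡ (∈-map⁺ (x ,_) (∈-lookup {xs = xs} i)))
  ∈-pairs⁺ (x ∷ xs) {suc i} {suc j} i≢j with ∈-pairs⁺ xs (i≢j ∘ cong suc)
  ... | inj₁ p = inj₁ (∈-++⁺ʳ (map (x ,_) xs) p)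
  ... | inj₂ p = inj₂ (∈-++⁺ʳ (map (x ,_) xs) p)

-- Safety survives further deletions, so the elements can be treated one after another, and the
-- costs add up.
deletions : {A V : Set} (Safe : A → List V → List V → Set) →
  (∀ {a} B D B′ D′ → Safe a B D → Safe a (B′ ++ B) (D′ ++ D)) → ∀ b d as →
  (∀ {a} → a ∈ as → ∀ B D → (∀ B′ D′ → length B′ ≤ b → length D′ ≤ d → Safe a (B′ ++ B) (D′ ++ D) → ⊥) → ⊥) →
  ∀ B D → (∀ B′ D′ → length B′ ≤ length as * b → length D′ ≤ length as * d →
    All (λ a → Safe a (B′ ++ B) (D′ ++ D)) as → ⊥) → ⊥
deletions Safe mono b d [] step B D cont = cont [] [] z≤n z≤n []
deletions Safe mono b d (a ∷ as) step B D cont =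
  step (here refl) B D λ B₁ D₁ lB₁ lD₁ safe →
  deletions Safe mono b d as (λ i → step (there i)) (B₁ ++ B) (D₁ ++ D) λ B₂ D₂ lB₂ lD₂ safes →
  cont (B₂ ++ B₁) (D₂ ++ D₁) (bound b (length as) B₁ B₂ lB₁ lB₂) (bound d (length as) D₁ D₂ lD₁ lD₂)
    (All.map (λ {a} → subst₂ (Safe a) (sym (++-assoc B₂ B₁ B)) (sym (++-assoc D₂ D₁ D)))
      (mono (B₁ ++ B) (D₁ ++ D) B₂ D₂ safe ∷ safes))
  where
  bound : ∀ c n {V : Set} (xs ys : List V) → length xs ≤ c → length ys ≤ n * c → length (ys ++ xs) ≤ c + n * c
  bound c n xs ys p q = ≤-trans (≤-reflexive (trans (length-++ ys) (+-comm (length ys) _))) (+-mono-≤ p q)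

module Separating (G : RedGraph) (m₀ : ℕ) where

  open RedGraph G
  open Necks G m₀
  open Merging G m₀
  open MatchingLinks G m₀
  open CoreFamilies G m₀
  open Absorbing G m₀

  infixl 6 _∸ᵛ_
  _∸ᵛ_ : List V → List V → List V
  _∸ᵛ_ = _∖_ _≟ᵛ_

  ∸ᵛ-++ : ∀ X D′ D {x} → x ∈ X ∸ᵛ (D′ ++ D) → x ∈ X ∸ᵛ D
  ∸ᵛ-++ X D′ D x∈ with ∈-∖⁻ _≟ᵛ_ X (D′ ++ D) x∈
  ... | x∈X , x∉ = ∈-∖⁺ _≟ᵛ_ X D x∈X (x∉ ∘ ∈-++⁺ʳ D′)

  -- `P` will contain the other cores too: a red edge across three or more cores has to count as a
  -- link between any two of them.
  record Link (K K′ P : List V) : Set where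
    field
      {u w} : V
      {vs} : List V
      path : Path u w vs
      u∈ : u ∈ K
      w∈ : w ∈ K′
      unique : Unique (vs ++ [ w ])
      within : All (_∈ P) (vs ++ [ w ])
      short : length vs ≤ 2 * K₁

    all : List V
    all = vs ++ [ w ]

  Link-⊆ : ∀ {K K′ P L L′ Q} → (∀ {x} → x ∈ K → x ∈ L) → (∀ {x} → x ∈ K′ → x ∈ L′) → (∀ {x} → x ∈ P → x ∈ Q) →
    Link K K′ P → Link L L′ Q
  Link-⊆ K⊆ K′⊆ P⊆ ℓ = record { path = path ; u∈ = K⊆ u∈ ; w∈ = K′⊆ w∈ ; unique = unique ; within = All.map P⊆ within ; short = short }
    where open Link ℓ

  Link-sym : ∀ {K K′ P} → Link K K′ P → Link K′ K P
  Link-sym ℓ with reverse (Link.path ℓ)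
  ... | vs′ , p , e = record
    { path = p ; u∈ = w∈ ; w∈ = u∈ ; unique = Unique-resp (↭-sym e) unique ; within = All-resp-↭ (↭-sym e) within
    ; short = ≤-trans (≤-reflexive (+-cancelʳ-≡ 1 _ _ (trans (sym (length-++ vs′)) (trans (↭-length e) (length-++ vs))))) short }
    where open Link ℓ

  length-link : ∀ {K K′ P} (ℓ : Link K K′ P) → length (Link.all ℓ) ≤ 2 * K₁ + 1
  length-link ℓ = ≤-trans (≤-reflexive (length-++ (Link.vs ℓ))) (+-monoˡ-≤ 1 (Link.short ℓ))

  abstract
    -- One link leads to the other cycle, the second one, reversed, leads back, and both bodies
    -- survive. `1 ≤ cores o` leaves a core at which the result is opened.
    mergeTwo : ∀ o o′ Z {P} (ℓ₁ ℓ₂ : Link (coreOf o) (coreOf o′) P) → Disjoint (Link.all ℓ₁) (Link.all ℓ₂) →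
      (∀ {x} → x ∈ P → x ∈ allCores (o ∷ o′ ∷ []) ++ Z) → Unique (allVerts (o ∷ o′ ∷ []) ++ Z) → 1 ≤ cores o →
      2 * (2 * K₁ + 1) + (κ + κ) ≤ coreLength →
      ∃[ q ] verts q ⊑ allVerts (o ∷ o′ ∷ []) ++ Z × length (body o) + length (body o′) ≤ length (verts q)
    mergeTwo o o′ Z ℓ₁ ℓ₂ disj P⊆ u 1≤ room with reverse (Link.path ℓ₂)
    ... | vs₂ , p₂ , e₂ with merge {o = o} {os = o′ ∷ []} Z (step (Link.u∈ ℓ₁) (Link.path ℓ₁) (Link.w∈ ℓ₁) (last (Link.w∈ ℓ₂) p₂)) (Link.u∈ ℓ₂) u
            (Unique-resp (↭-sym E↭) (Unique.++⁺ (Link.unique ℓ₁) (Link.unique ℓ₂) disj))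
            (All.map P⊆ (All-resp-↭ (↭-sym E↭) (All.++⁺ (Link.within ℓ₁) (Link.within ℓ₂))))
            (All.tabulate λ {o} _ → ≤-trans (+-monoˡ-≤ (κ + κ) lE) (≤-trans room (≤-reflexive (sym (length-core o)))))
      where
      E↭ : Link.u ℓ₂ ∷ Link.vs ℓ₁ ++ Link.w ℓ₁ ∷ vs₂ ↭ Link.all ℓ₁ ++ Link.all ℓ₂
      E↭ = ↭-trans (perm 4 (λ u v w s → u ∙ v ∙ w ∙ s ⇌ (v ∙ w) ∙ (s ∙ u)) ↭-refl [ Link.u ℓ₂ ] (Link.vs ℓ₁) [ Link.w ℓ₁ ] vs₂)
             (++⁺ˡ (Link.all ℓ₁) e₂)
      lE : length (Link.u ℓ₂ ∷ Link.vs ℓ₁ ++ Link.w ℓ₁ ∷ vs₂) ≤ 2 * (2 * K₁ + 1)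
      lE = ≤-trans (≤-reflexive (trans (↭-length E↭) (length-++ (Link.all ℓ₁))))
             (≤-trans (+-mono-≤ (length-link ℓ₁) (length-link ℓ₂)) (≤-reflexive (cong (2 * K₁ + 1 +_) (sym (+-identityʳ _)))))
    ...   | vs , neck , vs⊑ , lvs with toOpen (recount (cong (_+ (cores o′ + 0)) (sym (suc-pred (cores o) {{>-nonZero 1≤}}))) neck)
    ...     | q , _ , vq = q , ⊑-respˡ vq vs⊑ , ≤-trans (≤-trans (≤-reflexive (sym lenBodies)) (m≤m+n (length (allBodies (o ∷ o′ ∷ []))) _)) (≤-reflexive (sym (trans (↭-length vq) lvs)))
      where
      lenBodies : length (allBodies (o ∷ o′ ∷ [])) ≡ length (body o) + length (body o′)
      lenBodies = trans (length-++ (body o)) (cong (length (body o) +_) (cong length (++-identityʳ (body o′))))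

  module _ (os : List Open) (L : List V) (u : Unique (allVerts os ++ L)) (cores≥1 : ∀ o → o ∈ os → 1 ≤ cores o)
    (room₃ : K₁ * (3 * K₁) ≤ coreLength) (room₄ : 2 * (2 * K₁ + 1) + (κ + κ) ≤ coreLength)
    {n₁ : ℕ} (win : ∀ o → Unique (verts o) → length (verts o) ≤ n₁)
    (long : ∀ o → o ∈ os → n₁ < 2 * length (body o))
    where

    Absorbs : Open → List V → List V → Set
    Absorbs o B D = Absorber (coreOf o ∸ᵛ B) (L ∸ᵛ D)

    pool : List V → List V → List V
    pool B D = (allCores os ∸ᵛ B) ++ (L ∸ᵛ D)

    Links-up : Open × Open → List V → List V → Set
    Links-up (o , o′) B D = Link (coreOf o ∸ᵛ B) (coreOf o′ ∸ᵛ B) (pool B D)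

    pool-++ : ∀ B D B′ D′ {x} → x ∈ pool (B′ ++ B) (D′ ++ D) → x ∈ pool B D
    pool-++ B D B′ D′ x∈ with ∈-++⁻ (allCores os ∸ᵛ (B′ ++ B)) x∈
    ... | inj₁ i = ∈-++⁺ˡ (∸ᵛ-++ (allCores os) B′ B i)
    ... | inj₂ i = ∈-++⁺ʳ (allCores os ∸ᵛ B) (∸ᵛ-++ L D′ D i)

    absorberStep : (∀ {o} → o ∈ os → ∀ o′ → cores o ≡ suc (cores o′) → length (verts o′) ≡ length (verts o) + K₁ →
        verts o′ ⊑ verts o ++ L → ⊥) →
      ∀ {o} → o ∈ os → ∀ B D → (∀ B′ D′ → length B′ ≤ K₁ * (3 * K₁) → length D′ ≤ κ → ¬ Absorbs o (B′ ++ B) (D′ ++ D) → ⊥) → ⊥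
    absorberStep absorbed {o} o∈ B D cont = absorb o (cores≥1 o o∈) (L ∸ᵛ D)
      (Unique-⊑ (⊑-++ (verts-⊑ o∈) (∖-⊑ _≟ᵛ_ L D)) u) room₃
      (λ o′ c l v⊑ → absorbed o∈ o′ c l (⊑-trans v⊑ (⊑-++ (⊑-refl {xs = verts o}) (∖-⊑ _≟ᵛ_ L D))))
      λ ks Z ls L′ ks↭ lZ ls↭ l none → cont Z ls lZ l λ a → none (Absorber-⊆
        (λ {x} x∈ → let x∈o , x∉ = ∈-∖⁻ _≟ᵛ_ (coreOf o) (Z ++ B) x∈ in
          case ∈-++⁻ ks (∈-resp-↭ (↭-sym ks↭) x∈o) of λ { (inj₁ i) → i ; (inj₂ i) → ⊥-elim (x∉ (∈-++⁺ˡ i)) })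
        (λ {x} x∈ → case ∈-++⁻ ls (∈-resp-↭ (↭-sym ls↭) (∸ᵛ-++ L ls D x∈)) of λ
          { (inj₁ i) → ⊥-elim (proj₂ (∈-∖⁻ _≟ᵛ_ L (ls ++ D) x∈) (∈-++⁺ˡ i)) ; (inj₂ i) → i })
        a)

    rest-unique : ∀ {o o′ zs} → o ∷ o′ ∷ zs ↭ os → Unique (allVerts (o ∷ o′ ∷ []) ++ allCores zs ++ L)
    rest-unique {o} {o′} {zs} os↭ = Unique-⊑ (⊑-trans
      (⊑-++ (⊑-refl {xs = allVerts (o ∷ o′ ∷ [])}) (⊑-++ (⊑-respʳ (++-⊑ʳ (allBodies zs) (allCores zs)) (↭-sym (allVerts-↭ zs))) (⊑-refl {xs = L})))
      (↭⇒⊑ (↭-trans (↭-reflexive (trans (sym (++-assoc (allVerts (o ∷ o′ ∷ [])) (allVerts zs) L))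
        (cong (_++ L) (sym (allVerts-++ (o ∷ o′ ∷ []) {zs}))))) (++⁺ʳ L (allVerts-resp {o ∷ o′ ∷ zs} os↭))))) u

    -- A link that avoids the vertices of the first would merge the two cycles. Each body has more
    -- than half of n₁ vertices, so the result would contradict `win`. Hence deleting a single link
    -- destroys all of them.
    noTwoLinks : ∀ {o o′} → (o , o′) ∈ pairs os → ∀ B D (ℓ₁ : Links-up (o , o′) B D) →
      ¬ Links-up (o , o′) (Link.all ℓ₁ ++ B) (Link.all ℓ₁ ++ D)
    noTwoLinks {o} {o′} oo∈ B D ℓ₁ ℓ₂ with ∈-pairs⁻ os oo∈
    ... | zs , os↭ with mergeTwo o o′ (allCores zs ++ L)
            (Link-⊆ (∈-⊑ (∖-⊑ _≟ᵛ_ (coreOf o) B)) (∈-⊑ (∖-⊑ _≟ᵛ_ (coreOf o′) B)) id ℓ₁)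
            (Link-⊆ (λ i → ∈-⊑ (∖-⊑ _≟ᵛ_ (coreOf o) B) (∸ᵛ-++ (coreOf o) (Link.all ℓ₁) B i))
                    (λ i → ∈-⊑ (∖-⊑ _≟ᵛ_ (coreOf o′) B) (∸ᵛ-++ (coreOf o′) (Link.all ℓ₁) B i))
                    (pool-++ B D (Link.all ℓ₁) (Link.all ℓ₁)) ℓ₂)
            (λ (i , j) → avoids i (All.lookup (Link.within ℓ₂) j))
            in-total (rest-unique os↭) (cores≥1 o (∈-resp-↭ os↭ (here refl))) room₄
      where
      avoids : ∀ {x} → x ∈ Link.all ℓ₁ → x ∉ pool (Link.all ℓ₁ ++ B) (Link.all ℓ₁ ++ D)
      avoids i j with ∈-++⁻ (allCores os ∸ᵛ (Link.all ℓ₁ ++ B)) j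
      ... | inj₁ j′ = proj₂ (∈-∖⁻ _≟ᵛ_ (allCores os) (Link.all ℓ₁ ++ B) j′) (∈-++⁺ˡ i)
      ... | inj₂ j′ = proj₂ (∈-∖⁻ _≟ᵛ_ L (Link.all ℓ₁ ++ D) j′) (∈-++⁺ˡ i)
      in-total : ∀ {x} → x ∈ pool B D → x ∈ allCores (o ∷ o′ ∷ []) ++ allCores zs ++ L
      in-total {x} i with ∈-++⁻ (allCores os ∸ᵛ B) i
      ... | inj₂ j = ∈-++⁺ʳ (allCores (o ∷ o′ ∷ [])) (∈-++⁺ʳ (allCores zs) (proj₁ (∈-∖⁻ _≟ᵛ_ L D j)))
      ... | inj₁ j with ∈-allCores⁻ os (proj₁ (∈-∖⁻ _≟ᵛ_ (allCores os) B j))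
      ...   | p , p∈ , x∈p with ∈-resp-↭ (↭-sym os↭) p∈
      ...     | here refl = ∈-++⁺ˡ (∈-allCores⁺ (o ∷ o′ ∷ []) (here refl) x∈p)
      ...     | there (here refl) = ∈-++⁺ˡ (∈-allCores⁺ (o ∷ o′ ∷ []) (there (here refl)) x∈p)
      ...     | there (there p∈zs) = ∈-++⁺ʳ (allCores (o ∷ o′ ∷ [])) (∈-++⁺ˡ (∈-allCores⁺ zs p∈zs x∈p))
    ...   | q , q⊑ , lq = <⇒≱ (begin-strict
              2 * n₁                                                  <⟨ ≤-reflexive (cong suc (double n₁)) ⟩
              suc (n₁ + n₁)                                           ≤⟨ n≤1+n _ ⟩
              suc (suc (n₁ + n₁))                                     ≡⟨ cong suc (+-suc n₁ n₁) ⟨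
              suc n₁ + suc n₁                                         ≤⟨ +-mono-≤ (long o (∈-resp-↭ os↭ (here refl))) (long o′ (∈-resp-↭ os↭ (there (here refl)))) ⟩
              2 * length (body o) + 2 * length (body o′)              ≡⟨ *-distribˡ-+ 2 (length (body o)) _ ⟨
              2 * (length (body o) + length (body o′))                ≤⟨ *-monoʳ-≤ 2 lq ⟩
              2 * length (verts q)                                    ∎) (*-monoʳ-≤ 2 (win q (Unique-⊑ q⊑ (rest-unique os↭))))
      where
      open ≤-Reasoning
      double : ∀ n → 2 * n ≡ n + n
      double n = cong (n +_) (+-identityʳ n)

    linkStep : ∀ {oo} → oo ∈ pairs os → ∀ B D →
      (∀ B′ D′ → length B′ ≤ 2 * K₁ + 1 → length D′ ≤ 2 * K₁ + 1 → ¬ Links-up oo (B′ ++ B) (D′ ++ D) → ⊥) → ⊥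
    linkStep {o , o′} oo∈ B D cont = byCases (Links-up (o , o′) B D)
      (λ ℓ → cont (Link.all ℓ) (Link.all ℓ) (length-link ℓ) (length-link ℓ) (noTwoLinks {o} {o′} oo∈ B D ℓ))
      (cont [] [] z≤n z≤n)

    separate : (∀ {o} → o ∈ os → ∀ o′ → cores o ≡ suc (cores o′) → length (verts o′) ≡ length (verts o) + K₁ →
        verts o′ ⊑ verts o ++ L → ⊥) →
      (∀ B D → length B ≤ (length os C 2) * (2 * K₁ + 1) + length os * (K₁ * (3 * K₁)) →
        length D ≤ (length os C 2) * (2 * K₁ + 1) + length os * κ →
        All (λ o → ¬ Absorbs o B D) os → All (λ oo → ¬ Links-up oo B D) (pairs os) → ⊥) → ⊥
    separate absorbed cont =
      deletions (λ o B D → ¬ Absorbs o B D) (λ {o} → keep₁ o) (K₁ * (3 * K₁)) κ os (absorberStep absorbed) [] [] λ B₁ D₁ lB₁ lD₁ safe₁ →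
      deletions (λ oo B D → ¬ Links-up oo B D) (λ {oo} → keep₂ oo) (2 * K₁ + 1) (2 * K₁ + 1) (pairs os) linkStep (B₁ ++ []) (D₁ ++ []) λ B₂ D₂ lB₂ lD₂ safe₂ →
      cont (B₂ ++ B₁ ++ []) (D₂ ++ D₁ ++ []) (bound (length os * (K₁ * (3 * K₁))) (2 * K₁ + 1) B₁ B₂ lB₁ lB₂) (bound (length os * κ) (2 * K₁ + 1) D₁ D₂ lD₁ lD₂)
        (All.map (λ {o} → keep₁ o (B₁ ++ []) (D₁ ++ []) B₂ D₂) safe₁) safe₂
      where
      keep₁ : ∀ o B D B′ D′ → ¬ Absorbs o B D → ¬ Absorbs o (B′ ++ B) (D′ ++ D)
      keep₁ o B D B′ D′ none a = none (Absorber-⊆ (∸ᵛ-++ (coreOf o) B′ B) (∸ᵛ-++ L D′ D) a)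
      keep₂ : ∀ oo B D B′ D′ → ¬ Links-up oo B D → ¬ Links-up oo (B′ ++ B) (D′ ++ D)
      keep₂ (o , o′) B D B′ D′ none ℓ = none (Link-⊆ (∸ᵛ-++ (coreOf o) B′ B) (∸ᵛ-++ (coreOf o′) B′ B) (pool-++ B D B′ D′) ℓ)
      bound : ∀ p q (X Y : List V) → length X ≤ p → length Y ≤ length (pairs os) * q → length (Y ++ X ++ []) ≤ (length os C 2) * q + p
      bound p q X Y lX lY = ≤-trans (≤-reflexive (trans (length-++ Y) (cong (λ Z → length Y + length Z) (++-identityʳ X))))
        (+-mono-≤ (≤-trans lY (≤-reflexive (cong (_* q) (length-pairs os)))) lX)

-- The blue copy among the remaining vertices

module _ {A : Set} where

  sublists : List A → List (List A)
  sublists [] = [ [] ]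
  sublists (x ∷ xs) = map (x ∷_) (sublists xs) ++ sublists xs

  length-sublists : ∀ xs → length (sublists xs) ≡ 2 ^ length xs
  length-sublists [] = refl
  length-sublists (x ∷ xs) = trans (length-++ (map (x ∷_) (sublists xs)))
    (cong₂ _+_ (trans (length-map (x ∷_) (sublists xs)) (length-sublists xs))
               (trans (length-sublists xs) (sym (+-identityʳ _))))

  ∈-sublists⁺ : ∀ {ys xs : List A} → ys ⊆ₛ xs → ys ∈ sublists xs
  ∈-sublists⁺ [] = here refl
  ∈-sublists⁺ {xs = x ∷ xs} (.x ∷ʳ s) = ∈-++⁺ʳ (map (x ∷_) (sublists xs)) (∈-sublists⁺ s)
  ∈-sublists⁺ {xs = x ∷ xs} (refl ∷ s) = ∈-++⁺ˡ (∈-map⁺ (x ∷_) (∈-sublists⁺ s))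

  ∈-sublists⁻ : ∀ {ys} (xs : List A) → ys ∈ sublists xs → ys ⊆ₛ xs
  ∈-sublists⁻ [] (here refl) = []
  ∈-sublists⁻ (x ∷ xs) ys∈ with ∈-++⁻ (map (x ∷_) (sublists xs)) ys∈
  ... | inj₂ i = x ∷ʳ ∈-sublists⁻ xs i
  ... | inj₁ i with ∈-map⁻ (x ∷_) i
  ...   | _ , j , refl = refl ∷ ∈-sublists⁻ xs j

  length-concatMap≤ : ∀ {B : Set} (g : B → List A) {fs} → All (λ f → length (g f) ≤ 1) fs →
    length (concatMap g fs) ≤ length fs
  length-concatMap≤ g [] = z≤n
  length-concatMap≤ g (_∷_ {x = f} p ps) = ≤-trans (≤-reflexive (length-++ (g f))) (+-mono-≤ p (length-concatMap≤ g ps))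

  another : ∀ (_≟_ : DecidableEquality A) {xs : List A} → Unique xs → 2 ≤ length xs → ∀ a → ∃[ b ] b ∈ xs × a ≢ b
  another _≟_ {_ ∷ []} _ (s≤s ()) _
  another _≟_ {x ∷ y ∷ xs} ((x≢y ∷ _) ∷ _) _ a with a ≟ x
  ... | yes refl = y , there (here refl) , x≢y
  ... | no a≢x = x , here refl , a≢x

-- The defining property of τ(k - 1, σ) in terms of lists of vertices: more than
-- τ of them contain either two (k - 1)-sets with property Q that share exactly
-- one vertex, or σ vertices spanning no such set.
IsTauBound : (G : RedGraph) → ℕ → ℕ → Set₁
IsTauBound G τ σ = ∀ L → Unique L → τ < length L → (Q : List V → Set) → Decidable Q →
    (∀ {f g} → All (_∈ g) f → All (_∈ f) g → Q f → Q g) →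
    (∀ {f g w} → Unique f → Unique g → length f ≡ K₁ → length g ≡ K₁ → All (_∈ L) f → All (_∈ L) g → Q f → Q g →
      w ∈ f → w ∈ g → ¬ (∀ {x} → x ∈ f → x ∈ g → x ≡ w)) →
    (∀ T → T ⊑ L → length T ≡ σ → (∀ {f} → Unique f → length f ≡ K₁ → All (_∈ T) f → ¬ Q f) → ⊥) → ⊥
  where open RedGraph G

module Embedding (G : RedGraph) (m₀ : ℕ) where

  open RedGraph G
  open Necks G m₀
  open Merging G m₀
  open MatchingLinks G m₀
  open CoreFamilies G m₀
  open Absorbing G m₀
  open Separating G m₀

  module _ (os : List Open) (L B D : List V) (u : Unique (allVerts os ++ L))
    (noAbsorber : ∀ i → ¬ Absorber (coreOf (lookup os i) ∸ᵛ B) (L ∸ᵛ D))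
    (noLink : ∀ {i j} → i ≢ j → ¬ Link (coreOf (lookup os i) ∸ᵛ B) (coreOf (lookup os j) ∸ᵛ B) ((allCores os ∸ᵛ B) ++ (L ∸ᵛ D)))
    where

    private
      t : ℕ
      t = length os
      K : Fin t → List V
      K i = coreOf (lookup os i) ∸ᵛ B
      Kall L′ : List V
      Kall = allCores os ∸ᵛ B
      L′ = L ∸ᵛ D

    K⊆Kall : ∀ i {x} → x ∈ K i → x ∈ Kall
    K⊆Kall i x∈ with ∈-∖⁻ _≟ᵛ_ (coreOf (lookup os i)) B x∈
    ... | x∈i , x∉ = ∈-∖⁺ _≟ᵛ_ (allCores os) B (∈-allCores⁺ os (∈-lookup i) x∈i) x∉

    Kall⊆K : ∀ {x} → x ∈ Kall → ∃[ i ] x ∈ K i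
    Kall⊆K x∈ with ∈-∖⁻ _≟ᵛ_ (allCores os) B x∈
    ... | x∈os , x∉ with ∈-allCores⁻ os x∈os
    ...   | o , o∈ , x∈o = index o∈ , ∈-∖⁺ _≟ᵛ_ _ B (subst (λ o → _ ∈ coreOf o) (lookup-index o∈) x∈o) x∉

    cores-unique : Unique (allCores os)
    cores-unique = Unique-allCores os (proj₁ (Unique-++⁻ (allVerts os) u))

    L-unique : Unique L
    L-unique = proj₁ (proj₂ (Unique-++⁻ (allVerts os) u))

    K∩K : ∀ {i j} → i ≢ j → Disjoint (K i) (K j)
    K∩K {i} {j} i≢j (p , q) = disjoint-cores os cores-unique i≢j
      (proj₁ (∈-∖⁻ _≟ᵛ_ (coreOf (lookup os i)) B p) , proj₁ (∈-∖⁻ _≟ᵛ_ (coreOf (lookup os j)) B q))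

    Kall∩L′ : Disjoint Kall L′
    Kall∩L′ (p , q) = proj₂ (proj₂ (Unique-++⁻ (allVerts os) u))
      ( ∈-resp-↭ (↭-sym (allVerts-↭ os)) (∈-++⁺ʳ (allBodies os) (proj₁ (∈-∖⁻ _≟ᵛ_ (allCores os) B p)))
      , proj₁ (∈-∖⁻ _≟ᵛ_ L D q))

    absorberEdge : ∀ i {e a b s} → Red e → length e ≡ k → Unique e → a ∈ e → b ∈ e → a ≢ b → a ∈ K i → b ∈ K i →
      All (_∈ K i ++ L′) e → s ∈ e → s ∈ L′ → ⊥
    absorberEdge i {b = b} r l ue a∈ b∈ a≢b a∈K b∈K e⊆ s∈ s∈L with edgeLink r l a∈ b∈ a≢b
    ... | g , p , perm-e = noAbsorber i record
      { path = p ; u∈ = a∈K ; w∈ = b∈K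
      ; unique = Unique-resp (↭-sym perm-e′) ue
      ; within = All-resp-↭ (↭-sym perm-e′) e⊆
      ; meets = Any.map (λ { refl → s∈L }) (∈-resp-↭ (↭-sym perm-e′) s∈)
      ; short = ≤-trans (≤-reflexive (suc-injective (trans (↭-length perm-e) l))) (m≤n*m K₁ 2) }
      where
      perm-e′ = ↭-trans (++-comm (_ ∷ g) [ b ]) perm-e

    linkEdge : ∀ {i j e a b} → i ≢ j → Red e → length e ≡ k → Unique e → a ∈ e → b ∈ e → a ∈ K i → b ∈ K j →
      All (_∈ Kall ++ L′) e → ⊥
    linkEdge {b = b} i≢j r l ue a∈ b∈ a∈K b∈K e⊆ with edgeLink r l a∈ b∈ (λ { refl → K∩K i≢j (a∈K , b∈K) })
    ... | g , p , perm-e = noLink i≢j record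
      { path = p ; u∈ = a∈K ; w∈ = b∈K
      ; unique = Unique-resp (↭-sym perm-e′) ue
      ; within = All-resp-↭ (↭-sym perm-e′) e⊆
      ; short = ≤-trans (≤-reflexive (suc-injective (trans (↭-length perm-e) l))) (m≤n*m K₁ 2) }
      where
      perm-e′ = ↭-trans (++-comm (_ ∷ g) [ b ]) perm-e

    -- Two red edges a ∷ f and b ∷ g with f and g meeting only in w form a path from a to b.
    crossing : ∀ {f g w a b} → Unique f → Unique g → length f ≡ K₁ → length g ≡ K₁ → All (_∈ L′) f → All (_∈ L′) g →
      a ∈ Kall → b ∈ Kall → a ≢ b → Red (a ∷ f) → Red (b ∷ g) → w ∈ f → w ∈ g →
      ¬ (∀ {x} → x ∈ f → x ∈ g → x ≡ w)
    crossing {f} {g} {w} {a} {b} uf ug lf lg f⊆ g⊆ a∈ b∈ a≢b ra rb w∈f w∈g only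
      with edgeLink {u = a} {w} ra (cong suc lf) (here refl) (there w∈f) (λ { refl → Kall∩L′ (a∈ , All.lookup f⊆ w∈f) })
         | edgeLink {u = w} {b} rb (cong suc lg) (there w∈g) (here refl) (λ { refl → Kall∩L′ (b∈ , All.lookup g⊆ w∈g) })
         | Kall⊆K a∈ | Kall⊆K b∈
    ... | g₁ , p₁ , perm₁ | g₂ , p₂ , perm₂ | i , a∈i | j , b∈j = conclude (i ≟ᶠ j)
      where
      vs : List V
      vs = (a ∷ g₁) ++ (w ∷ g₂)
      f↭ : w ∷ g₁ ↭ f
      f↭ = Perm.drop-∷ (↭-trans (swap a w ↭-refl) perm₁)
      g↭ : w ∷ g₂ ↭ g
      g↭ = Perm.drop-∷ perm₂
      g₂⊆ : ∀ {x} → x ∈ g₂ → x ∈ g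
      g₂⊆ x∈ = ∈-resp-↭ g↭ (there x∈)
      fg₂⊆ : All (_∈ L′) (f ++ g₂)
      fg₂⊆ = All.++⁺ f⊆ (All.tabulate λ x∈ → All.lookup g⊆ (g₂⊆ x∈))
      ug₂ : w ∉ g₂ × Unique g₂
      ug₂ = uncons (Unique-resp (↭-sym g↭) ug)
      ufg₂ : Unique (f ++ g₂)
      ufg₂ = Unique.++⁺ uf (proj₂ ug₂) λ (x∈f , x∈g₂) → proj₁ ug₂ (subst (_∈ g₂) (only x∈f (g₂⊆ x∈g₂)) x∈g₂)
      vs↭ : vs ++ [ b ] ↭ a ∷ b ∷ f ++ g₂
      vs↭ = ↭-trans (perm 5 (λ a p w q b → ((a ∙ p) ∙ w ∙ q) ∙ b ⇌ a ∙ b ∙ (w ∙ p) ∙ q) ↭-refl [ a ] g₁ [ w ] g₂ [ b ])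
              (prep a (prep b (++⁺ʳ g₂ f↭)))
      avoid : ∀ {x} → x ∈ Kall → x ∉ f ++ g₂
      avoid x∈ x∈′ = Kall∩L′ (x∈ , All.lookup fg₂⊆ x∈′)
      uvs : Unique (vs ++ [ b ])
      uvs = Unique-resp (↭-sym vs↭) (cons (λ { (here eq) → a≢b eq ; (there q) → avoid a∈ q }) (cons (avoid b∈) ufg₂))
      short : length vs ≤ 2 * K₁
      short = ≤-reflexive (trans (length-++ (a ∷ g₁)) (cong₂ _+_ (suc-injective (trans (↭-length perm₁) (cong suc lf)))
                (trans (trans (↭-length g↭) lg) (sym (+-identityʳ K₁)))))
      conclude : Dec (i ≡ j) → ⊥
      conclude (yes refl) = noAbsorber i record
        { path = p₁ ▻ p₂ ; u∈ = a∈i ; w∈ = b∈j ; unique = uvs ; short = short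
        ; within = All-resp-↭ (↭-sym vs↭) (∈-++⁺ˡ a∈i ∷ ∈-++⁺ˡ b∈j ∷ All.map (∈-++⁺ʳ (K i)) fg₂⊆)
        ; meets = Any.map (λ { refl → All.lookup f⊆ w∈f }) (∈-resp-↭ (↭-sym vs↭) (there (there (∈-++⁺ˡ w∈f)))) }
      conclude (no i≢j) = noLink i≢j record
        { path = p₁ ▻ p₂ ; u∈ = a∈i ; w∈ = b∈j ; unique = uvs ; short = short
        ; within = All-resp-↭ (↭-sym vs↭) (∈-++⁺ˡ a∈ ∷ ∈-++⁺ˡ b∈ ∷ All.map (∈-++⁺ʳ Kall) fg₂⊆) }

    extensions : List V → List V
    extensions f = filter (λ a → Red? (a ∷ f)) Kall

    -- An edge of the (k - 1)-graph on L′ extends to at least two red edges,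
    -- so that two edges always extend by different vertices.
    Q : List V → Set
    Q f = 2 ≤ length (extensions f)

    Kall-unique : Unique Kall
    Kall-unique = Unique-⊑ (∖-⊑ _≟ᵛ_ (allCores os) B) cores-unique

    Q-crossing : ∀ {f g w} → Unique f → Unique g → length f ≡ K₁ → length g ≡ K₁ → All (_∈ L′) f → All (_∈ L′) g → Q f → Q g →
      w ∈ f → w ∈ g → ¬ (∀ {x} → x ∈ f → x ∈ g → x ≡ w)
    Q-crossing {f} {g} uf ug lf lg f⊆ g⊆ qf qg w∈f w∈g only with extensions f in eq
    ... | a ∷ _ with another _≟ᵛ_ (Unique.filter⁺ (λ a → Red? (a ∷ g)) Kall-unique) qg a
                   | ∈-filter⁻ (λ a → Red? (a ∷ f)) {xs = Kall} (subst (a ∈_) (sym eq) (here refl))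
    ...   | b , b∈ , a≢b | a∈Kall , ra with ∈-filter⁻ (λ a → Red? (a ∷ g)) {xs = Kall} b∈
    ...     | b∈Kall , rb = crossing uf ug lf lg f⊆ g⊆ a∈Kall b∈Kall a≢b ra rb w∈f w∈g only

    Q-resp : ∀ {f g} → All (_∈ g) f → All (_∈ f) g → Q f → Q g
    Q-resp {f} {g} p q = subst (λ l → 2 ≤ length l) (filter-≐ (λ a → Red? (a ∷ f)) (λ a → Red? (a ∷ g))
      ( Red-resp (here refl ∷ All.map there p) (here refl ∷ All.map there q)
      , Red-resp (here refl ∷ All.map there q) (here refl ∷ All.map there p)) Kall)

    module _ {size : Fin (suc t) → ℕ} (noBlue : NoBlueParts G size) {v σ : ℕ} (size≤v : ∀ i → size i ≤ v)
      (i₀ : Fin (suc t)) (size-i₀ : size i₀ ≡ σ) (room : length B + (2 ^ σ + v) ≤ coreLength)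
      (T : List V) (T⊑ : T ⊑ L′) (lT : length T ≡ σ)
      (T-free : ∀ {f} → Unique f → length f ≡ K₁ → All (_∈ T) f → ¬ Q f) where

      private
        candidates : List (List V)
        candidates = filter (λ f → length f ≟ K₁) (sublists T)
        -- By `T-free` a (k - 1)-subset of `T` has at most one extension. Deleting all these core
        -- vertices costs at most 2^σ and leaves no red edge with k - 1 vertices in `T` and one in a
        -- part.
        bad : List V
        bad = concatMap extensions candidates
        A : Fin (suc t) → List V
        A = insertAt (λ i → K i ∸ᵛ bad) i₀ T
        uT : Unique T
        uT = Unique-⊑ T⊑ (Unique-⊑ (∖-⊑ _≟ᵛ_ L D) L-unique)

      view : ∀ j → j ≡ i₀ ⊎ ∃[ i ] j ≡ punchIn i₀ i
      view j with i₀ ≟ᶠ j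
      ... | yes eq = inj₁ (sym eq)
      ... | no i₀≢j = inj₂ (punchOut i₀≢j , sym (punchIn-punchOut i₀≢j))

      A-i₀ : A i₀ ≡ T
      A-i₀ = insertAt-lookup (λ i → K i ∸ᵛ bad) i₀ T

      A-in : ∀ i → A (punchIn i₀ i) ≡ K i ∸ᵛ bad
      A-in i = insertAt-punchIn (λ i → K i ∸ᵛ bad) i₀ T i

      length-bad : length bad ≤ 2 ^ σ
      length-bad = ≤-trans (length-concatMap≤ extensions (All.tabulate few)) (≤-trans (length-⊑ (filter-⊑ (λ f → length f ≟ K₁) (sublists T)))
        (≤-reflexive (trans (length-sublists T) (cong (2 ^_) lT))))
        where
        few : ∀ {f} → f ∈ candidates → length (extensions f) ≤ 1
        few f∈ with ∈-filter⁻ (λ f → length f ≟ K₁) {xs = sublists T} f∈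
        ... | f∈′ , lf = s≤s⁻¹ (≰⇒> (T-free (Unique-⊑ f⊑ uT) lf (All.tabulate (∈-⊑ f⊑))))
          where f⊑ = sublist⇒⊑ (∈-sublists⁻ T f∈′)

      K-unique : ∀ i → Unique (coreOf (lookup os i))
      K-unique i = Unique-core os (proj₁ (Unique-++⁻ (allVerts os) u)) (∈-lookup {xs = os} i)

      A-unique : ∀ j → Unique (A j)
      A-unique j with view j
      ... | inj₁ refl = subst Unique (sym A-i₀) uT
      ... | inj₂ (i , refl) = subst Unique (sym (A-in i)) (Unique-⊑ (∖-⊑ _≟ᵛ_ (K i) bad)
              (Unique-⊑ (∖-⊑ _≟ᵛ_ (coreOf (lookup os i)) B) (K-unique i)))

      A-size : ∀ j → size j ≤ length (A j)
      A-size j with view j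
      ... | inj₁ refl = ≤-reflexive (trans size-i₀ (trans (sym lT) (cong length (sym A-i₀))))
      ... | inj₂ (i , refl) = ≤-trans (size≤v (punchIn i₀ i)) (≤-trans (+-cancelˡ-≤ (length B + 2 ^ σ) _ _ (begin
          length B + 2 ^ σ + v                                ≡⟨ +-assoc (length B) (2 ^ σ) v ⟩
          length B + (2 ^ σ + v)                              ≤⟨ room ⟩
          coreLength                                          ≡⟨ length-core (lookup os i) ⟨
          length (coreOf (lookup os i))                       ≤⟨ length-∖ _≟ᵛ_ B (K-unique i) ⟩
          length B + length (K i)                             ≤⟨ +-monoʳ-≤ (length B) (length-∖ _≟ᵛ_ bad (Unique-⊑ (∖-⊑ _≟ᵛ_ (coreOf (lookup os i)) B) (K-unique i))) ⟩
          length B + (length bad + length (K i ∸ᵛ bad))       ≤⟨ +-monoʳ-≤ (length B) (+-monoˡ-≤ _ length-bad) ⟩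
          length B + (2 ^ σ + length (K i ∸ᵛ bad))            ≡⟨ +-assoc (length B) (2 ^ σ) _ ⟨
          length B + 2 ^ σ + length (K i ∸ᵛ bad)              ∎)) (≤-reflexive (cong length (sym (A-in i)))))
        where open ≤-Reasoning

      ∈A-i₀ : ∀ {x} → x ∈ A i₀ → x ∈ L′
      ∈A-i₀ x∈ = ∈-⊑ T⊑ (subst (_ ∈_) A-i₀ x∈)

      ∈A-in : ∀ i {x} → x ∈ A (punchIn i₀ i) → x ∈ K i × x ∉ bad
      ∈A-in i x∈ = ∈-∖⁻ _≟ᵛ_ (K i) bad (subst (_ ∈_) (A-in i) x∈)

      A-disjoint : ∀ {i j} → i ≢ j → Disjoint (A i) (A j)
      A-disjoint {i} {j} i≢j (p , q) with view i | view j
      ... | inj₁ refl | inj₁ refl = i≢j refl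
      ... | inj₁ refl | inj₂ (j′ , refl) = Kall∩L′ (K⊆Kall j′ (proj₁ (∈A-in j′ q)) , ∈A-i₀ p)
      ... | inj₂ (i′ , refl) | inj₁ refl = Kall∩L′ (K⊆Kall i′ (proj₁ (∈A-in i′ p)) , ∈A-i₀ q)
      ... | inj₂ (i′ , refl) | inj₂ (j′ , refl) = K∩K (λ { refl → i≢j refl }) (proj₁ (∈A-in i′ p) , proj₁ (∈A-in j′ q))

      ∈A⁻ : ∀ j {x} → x ∈ A j → x ∈ T ⊎ ∃[ i ] x ∈ A (punchIn i₀ i)
      ∈A⁻ j x∈ with view j
      ... | inj₁ refl = inj₁ (subst (_ ∈_) A-i₀ x∈)
      ... | inj₂ (i , refl) = inj₂ (i , x∈)

      -- A red edge across the parts with vertices in two cores is a link. One with two vertices in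
      -- a single core and another in `T` is an absorber. One with a single core vertex is an
      -- extension of its other vertices, and that vertex was deleted. There is no further case.
      embed : ⊥
      embed = noBlue A A-unique A-disjoint A-size λ e ue le e⊆ cross r →
        let place : ∀ {x} → x ∈ e → x ∈ T ⊎ ∃[ i ] x ∈ A (punchIn i₀ i)
            place x∈ = ∈A⁻ (proj₁ (e⊆ x∈)) (proj₂ (e⊆ x∈))
            within : All (_∈ Kall ++ L′) e
            within = All.tabulate λ x∈ → case place x∈ of λ
              { (inj₁ x∈T) → ∈-++⁺ʳ Kall (∈-⊑ T⊑ x∈T) ; (inj₂ (i , x∈i)) → ∈-++⁺ˡ (K⊆Kall i (proj₁ (∈A-in i x∈i))) }
        in byCases (∃[ a ] ∃[ i ] a ∈ e × a ∈ A (punchIn i₀ i))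
          (λ (a , i , a∈e , a∈i) → byCases (∃[ b ] ∃[ j ] b ∈ e × b ∈ A (punchIn i₀ j) × i ≢ j)
            (λ (b , j , b∈e , b∈j , i≢j) →
              linkEdge i≢j r le ue a∈e b∈e (proj₁ (∈A-in i a∈i)) (proj₁ (∈A-in j b∈j)) within)
            (λ one → withinOne e ue le r i a a∈e a∈i cross λ x∈ → case place x∈ of λ
              { (inj₁ x∈T) → inj₁ x∈T
              ; (inj₂ (j , x∈j)) → case i ≟ᶠ j of λ { (yes refl) → inj₂ x∈j ; (no i≢j) → ⊥-elim (one (_ , j , x∈ , x∈j , i≢j)) } }))
          (λ none → cross i₀ (All.tabulate λ x∈ → case place x∈ of λ
            { (inj₁ x∈T) → subst (_ ∈_) (sym A-i₀) x∈T ; (inj₂ (i , x∈i)) → ⊥-elim (none (_ , i , x∈ , x∈i)) }))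
        where
        withinOne : ∀ e → Unique e → length e ≡ k → Red e → ∀ i a → a ∈ e → a ∈ A (punchIn i₀ i) →
          (∀ j → ¬ All (_∈ A j) e) → (∀ {x} → x ∈ e → x ∈ T ⊎ x ∈ A (punchIn i₀ i)) → ⊥
        withinOne e ue le r i a a∈e a∈i cross place = byCases (∃[ b ] b ∈ e × b ∈ A (punchIn i₀ i) × a ≢ b)
          (λ (b , b∈e , b∈i , a≢b) → byCases (∃[ s ] s ∈ e × s ∈ T)
            (λ (s , s∈e , s∈T) → absorberEdge i r le ue a∈e b∈e a≢b (proj₁ (∈A-in i a∈i)) (proj₁ (∈A-in i b∈i))
              (All.tabulate λ x∈ → case place x∈ of λ
                { (inj₁ x∈T) → ∈-++⁺ʳ (K i) (∈-⊑ T⊑ x∈T) ; (inj₂ x∈i) → ∈-++⁺ˡ (proj₁ (∈A-in i x∈i)) })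
              s∈e (∈-⊑ T⊑ s∈T))
            (λ none → cross (punchIn i₀ i) (All.tabulate λ x∈ → case place x∈ of λ
              { (inj₁ x∈T) → ⊥-elim (none (_ , x∈ , x∈T)) ; (inj₂ x∈i) → x∈i })))
          λ single → star single
          where
          star : ¬ (∃[ b ] b ∈ e × b ∈ A (punchIn i₀ i) × a ≢ b) → ⊥
          star single with extract a∈e
          ... | f , e↭ with uncons (Unique-resp e↭ ue)
          ...   | a∉f , uf with asSublist _≟ᵛ_ uf uT (All.tabulate λ {x} x∈ → case place (∈-resp-↭ (↭-sym e↭) (there x∈)) of λ
                    { (inj₁ x∈T) → x∈T
                    ; (inj₂ x∈i) → ⊥-elim (single (x , ∈-resp-↭ (↭-sym e↭) (there x∈) , x∈i , λ { refl → a∉f x∈ })) })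
          ...     | f′ , f′⊆T , lf′ , f′⊆f , f⊆f′ = proj₂ (∈A-in i a∈i) (∈-concat⁺′
                      (∈-filter⁺ (λ a → Red? (a ∷ f′)) (K⊆Kall i (proj₁ (∈A-in i a∈i)))
                        (Red-resp (here refl ∷ All.map there f⊆f′) (here refl ∷ All.map there f′⊆f) (Red-↭ e↭ r)))
                      (∈-map⁺ extensions (∈-filter⁺ (λ f → length f ≟ K₁) (∈-sublists⁺ f′⊆T)
                        (trans lf′ (suc-injective (trans (sym (↭-length e↭)) le))))))

    -- The parts of `embed` are indexed by means of `length os`; this moves them to a number only
    -- known to be equal to it.
    embedAs : ∀ {t′} → length os ≡ t′ → {size : Fin (suc t′) → ℕ} → NoBlueParts G size → ∀ {v σ} → (∀ i → size i ≤ v) →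
      ∀ i₀ → size i₀ ≡ σ → length B + (2 ^ σ + v) ≤ coreLength → ∀ T → T ⊑ L′ → length T ≡ σ →
      ¬ (∀ {f} → Unique f → length f ≡ K₁ → All (_∈ T) f → ¬ Q f)
    embedAs refl noBlue size≤v i₀ size-i₀ room T T⊑ lT free = embed noBlue size≤v i₀ size-i₀ room T T⊑ lT free

-- The constants

module Constants (κ v t σ : ℕ) where

  K₁ k : ℕ
  K₁ = suc κ
  k = suc K₁

  -- What a core must accommodate: in `room₁` a cover of crossing edges and a colour class, in
  -- `room₂` the links and fillers for merging t + 1 cycles, in `room₃` one absorption, in `room₄`
  -- two links with fillers, in `room₅` all deletions, the extensions of subsets of `T` and a class.
  -- `m₀` is the sum only in order to exceed each of them.
  room₁ room₂ room₃ room₄ room₅ m₀ W R coreLength : ℕ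
  room₁ = suc t * 2 ^ suc t * k + v
  room₂ = suc t * k + (κ + κ)
  room₃ = K₁ * (3 * K₁)
  room₄ = 2 * (2 * K₁ + 1) + (κ + κ)
  room₅ = (t C 2) * (2 * K₁ + 1) + t * room₃ + (2 ^ σ + v)
  m₀ = room₁ + (room₂ + (room₃ + (room₄ + room₅)))
  coreLength = κ + m₀ * K₁
  W = 4 * (suc m₀ * K₁)
  R = ramseyNumber k W v

  -- The first summand gives m < q, W * R + R makes every cycle of nearly n vertices have surplus at
  -- least R, and the last makes its body longer than half of n₁.
  threshold : ℕ
  threshold = suc (suc m₀) * K₁ + (suc (W * R + R) + 2 * (coreLength + R))

  m₀≤ : m₀ ≤ coreLength
  m₀≤ = ≤-trans (m≤m*n m₀ K₁) (m≤n+m _ κ)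

  room₁≤ : room₁ ≤ coreLength
  room₁≤ = ≤-trans (m≤m+n _ _) m₀≤
  room₂≤ : room₂ ≤ coreLength
  room₂≤ = ≤-trans (≤-trans (m≤m+n _ _) (m≤n+m _ room₁)) m₀≤
  room₃≤ : room₃ ≤ coreLength
  room₃≤ = ≤-trans (≤-trans (m≤m+n _ _) (≤-trans (m≤n+m _ room₂) (m≤n+m _ room₁))) m₀≤
  room₄≤ : room₄ ≤ coreLength
  room₄≤ = ≤-trans (≤-trans (m≤m+n _ _) (≤-trans (m≤n+m _ room₃) (≤-trans (m≤n+m _ room₂) (m≤n+m _ room₁)))) m₀≤
  room₅≤ : room₅ ≤ coreLength
  room₅≤ = ≤-trans (≤-trans (m≤n+m _ room₄) (≤-trans (m≤n+m _ room₃) (≤-trans (m≤n+m _ room₂) (m≤n+m _ room₁)))) m₀≤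

  v≤m : v ≤ suc m₀
  v≤m = ≤-trans (≤-trans (m≤n+m v _) (m≤m+n room₁ _)) (n≤1+n m₀)

-- The contradiction in a colouring without either copy

module Conclusion (G : RedGraph) (0<κ : 0 < RedGraph.κ G) (v t σ τ : ℕ) (noBlueClique : NoBlueClique G v)
  {size : Fin (suc t) → ℕ} (noBlueParts : NoBlueParts G size) (size≤v : ∀ i → size i ≤ v)
  (i₀ : Fin (suc t)) (size-i₀ : size i₀ ≡ σ) (tauBound : IsTauBound G τ σ)
  (allV : List (RedGraph.V G)) (uAll : Unique allV) (complete : ∀ x → x ∈ allV)
  (q n₁ : ℕ) (n≡ : q * RedGraph.K₁ G ≡ suc n₁) (large : Constants.threshold (RedGraph.κ G) v t σ ≤ suc n₁)
  (lenV : length allV ≡ t * n₁ + 4 * RedGraph.k G * (t C 2) + τ + 1)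
  where

  open RedGraph G
  private module C = Constants κ v t σ
  open C hiding (K₁; k; coreLength; W; R; threshold)

  open Necks G m₀
  open Merging G m₀
  open CoreFamilies G m₀
  open MatchingLinks G m₀
  open Gathering G m₀ hiding (leftover; R)
  open Separating G m₀
  open Embedding G m₀

  module _ (noCycle : ∀ {a vs} → Path a a vs → Unique vs → length vs ≢ q * K₁) where

    m<q : m < q
    m<q = *-cancelʳ-≤ (suc m) q K₁ (≤-trans (m≤m+n _ _) (≤-trans large (≤-reflexive (sym n≡))))

    win< : ∀ o → Unique (verts o) → length (verts o) < q * K₁
    win< = Shortening.win G m₀ 0<κ v noBlueClique v≤m q m<q noCycle

    win : ∀ o → Unique (verts o) → length (verts o) ≤ n₁
    win o u = s≤s⁻¹ (≤-trans (win< o u) (≤-reflexive n≡))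

    large₁ : W * C.R + C.R + 2 * (coreLength + C.R) ≤ n₁
    large₁ = s≤s⁻¹ (≤-trans (m≤n+m _ (suc (suc m₀) * K₁)) large)

    R≤ : C.R ≤ n₁
    R≤ = ≤-trans (≤-trans (m≤n+m C.R (W * C.R)) (m≤m+n _ _)) large₁

    -- A multiple of K₁ below n = q * K₁ is at most n - K₁ = n₁ - κ.
    gap : ∀ o → Unique (verts o) → length (verts o) + κ ≤ n₁
    gap o u with length-Neck (Open.rest o)
    ... | p , lp = s≤s⁻¹ (begin
        suc (length (verts o) + κ)     ≡⟨ +-suc _ κ ⟨
        length (verts o) + K₁          ≡⟨ cong (_+ K₁) lv ⟩
        (p + m) * K₁ + K₁              ≡⟨ +-comm _ K₁ ⟩
        suc (p + m) * K₁               ≤⟨ *-monoˡ-≤ K₁ (*-cancelʳ-< K₁ (p + m) q (subst (_< q * K₁) lv (win< o u))) ⟩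
        q * K₁                         ≡⟨ n≡ ⟩
        suc n₁                         ∎)
      where
      open ≤-Reasoning
      lv : length (verts o) ≡ (p + m) * K₁
      lv = trans (length-verts o) (trans (cong (_+ m * K₁) lp) (sym (*-distribʳ-+ K₁ p m)))

    gaps : ∀ os → Unique (allVerts os) → length (allVerts os) + length os * κ ≤ length os * n₁
    gaps [] u = z≤n
    gaps (o ∷ os) u with Unique-++⁻ (verts o) u
    ... | u₁ , u₂ , _ = begin
        length (verts o ++ allVerts os) + (κ + length os * κ)           ≡⟨ cong (_+ (κ + length os * κ)) (length-++ (verts o)) ⟩
        length (verts o) + length (allVerts os) + (κ + length os * κ)   ≡⟨ swapMiddle (length (verts o)) _ κ _ ⟩
        length (verts o) + κ + (length (allVerts os) + length os * κ)   ≤⟨ +-mono-≤ (gap o u₁) (gaps os u₂) ⟩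
        n₁ + length os * n₁                                             ∎
      where
      open ≤-Reasoning
      swapMiddle : ∀ a b c d → a + b + (c + d) ≡ a + c + (b + d)
      swapMiddle = solve-∀

    -- The second bound pays for absorptions, each of which gains K₁ vertices and
    -- costs a marked segment; by the first, merging two cycles exceeds n₁ vertices.
    Ready : Open → Set
    Ready o = n₁ < length (verts o) + C.R × n₁ < length (verts o) + K₁ * cores o

    leftover : List Open → List V
    leftover os = allV ∸ᵛ allVerts os

    long : ∀ o → n₁ < length (verts o) + C.R → n₁ < 2 * length (body o)
    long o lt = lin (suc (W * C.R + C.R)) (large₁ ⊕ lt ⊕ lt) (trans (cong (λ l → suc n₁ + (n₁ + ((l + C.R) + (l + C.R))) + suc (W * C.R + C.R)) lv)
        (arith n₁ (length (body o)) coreLength C.R (W * C.R)))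
      where
      lv : length (verts o) ≡ length (body o) + coreLength
      lv = trans (↭-length (verts-↭ o)) (trans (length-++ (body o)) (cong (length (body o) +_) (length-core o)))
      arith : ∀ n b c r w → suc n + (n + ((b + c + r) + (b + c + r))) + suc (w + r) ≡ 2 * b + ((w + r + 2 * (c + r)) + (suc n + suc n))
      arith = solve-∀

    -- The κ per cycle from `gaps` pay for the absorbers, and 4k per pair pay for links of 2 * K₁ +
    -- 1 vertices with 2 * K₁ + 3 to spare; τ + 1 vertices remain.
    leftover-large : ∀ os → length os ≡ t → Unique (allVerts os) → ∀ D →
      length D ≤ (length os C 2) * (2 * K₁ + 1) + length os * κ → τ < length (leftover os ∸ᵛ D)
    leftover-large os l u D lD = lin ((length os C 2) * (2 * K₁ + 3)) ((gaps os u ⊕ lD) ⊕ (length-∖ _≟ᵛ_ D (Unique-⊑ (∖-⊑ _≟ᵛ_ allV (allVerts os)) uAll) ⊕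
        ≤-trans (≤-reflexive (trans (cong (λ t → t * n₁ + 4 * k * (t C 2) + τ + 1) l) (sym lenV))) (length-∖ _≟ᵛ_ (allVerts os) uAll)))
      (arith (length (allVerts os)) (length os * κ) (length os * n₁) (length D) (length os C 2) K₁ (length (leftover os)) (length (leftover os ∸ᵛ D)) τ)
      where
      arith : ∀ a b c d e h l l′ τ →
        suc τ + ((c + (e * (2 * h + 1) + b)) + ((d + l′) + (a + l))) + e * (2 * h + 3) ≡
        l′ + (((a + b) + d) + (l + (c + 4 * suc h * e + τ + 1)))
      arith = solve-∀

    -- Every absorption adds K₁ vertices to the cycles, so their number of vertices serves as the
    -- measure.
    finish : ∀ fuel os → length allV < fuel + length (allVerts os) → length os ≡ t → Unique (allVerts os) → All Ready os → ⊥
    finish zero os lt _ u _ = <⇒≱ lt (unique-⊆⇒length u (All.tabulate λ {x} _ → complete x))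
    finish (suc fuel) os lt l u ready = separate os L uL cores≥1 room₃≤ room₄≤ win (λ o o∈ → long o (proj₁ (All.lookup ready o∈)))
      absorbed separated
      where
      L : List V
      L = leftover os
      uL : Unique (allVerts os ++ L)
      uL = Unique.++⁺ u (Unique-⊑ (∖-⊑ _≟ᵛ_ allV (allVerts os)) uAll) λ (p , q) → proj₂ (∈-∖⁻ _≟ᵛ_ allV (allVerts os) q) p
      cores≥1 : ∀ o → o ∈ os → 1 ≤ cores o
      cores≥1 o o∈ with cores o in eq
      ... | suc _ = s≤s z≤n
      ... | zero = ⊥-elim (<⇒≱ (proj₂ (All.lookup ready o∈)) (≤-trans (≤-reflexive (trans (cong (λ c → length (verts o) + K₁ * c) eq)
                     (trans (cong (length (verts o) +_) (*-zeroʳ K₁)) (+-identityʳ _)))) (win o (Unique-⊑ (verts-⊑ o∈) u))))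
      absorbed : ∀ {o} → o ∈ os → ∀ o′ → cores o ≡ suc (cores o′) → length (verts o′) ≡ length (verts o) + K₁ →
        verts o′ ⊑ verts o ++ L → ⊥
      absorbed {o} o∈ o′ co lo v⊑ with extract o∈
      ... | zs , os↭ = finish fuel (o′ ∷ zs) lt′ (trans (sym (↭-length os↭)) l) u′ ((first , second) ∷ All.tail (All-resp-↭ os↭ ready))
        where
        open ≤-Reasoning
        lenOs : length (allVerts os) ≡ length (verts o) + length (allVerts zs)
        lenOs = trans (↭-length (allVerts-resp os↭)) (length-++ (verts o))
        lt′ : length allV < fuel + length (allVerts (o′ ∷ zs))
        lt′ = begin
          suc (length allV)                                             ≤⟨ lt ⟩
          suc fuel + length (allVerts os)                               ≡⟨ cong (suc fuel +_) lenOs ⟩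
          suc fuel + (length (verts o) + length (allVerts zs))          ≤⟨ m≤m+n _ κ ⟩
          suc fuel + (length (verts o) + length (allVerts zs)) + κ      ≡⟨ arith fuel (length (verts o)) (length (allVerts zs)) κ ⟩
          fuel + (length (verts o) + K₁ + length (allVerts zs))         ≡⟨ cong (λ l → fuel + (l + length (allVerts zs))) lo ⟨
          fuel + (length (verts o′) + length (allVerts zs))             ≡⟨ cong (fuel +_) (length-++ (verts o′)) ⟨
          fuel + length (allVerts (o′ ∷ zs))                            ∎
          where
          arith : ∀ f a b κ → suc f + (a + b) + κ ≡ f + (a + suc κ + b)
          arith = solve-∀
        u′ : Unique (allVerts (o′ ∷ zs))
        u′ = Unique-⊑ (⊑-trans (⊑-++ v⊑ (⊑-refl {xs = allVerts zs}))
               (↭⇒⊑ (↭-trans (perm 3 (λ a l z → (a ∙ l) ∙ z ⇌ (a ∙ z) ∙ l) ↭-refl (verts o) L (allVerts zs))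
                 (++⁺ʳ L (↭-sym (allVerts-resp os↭)))))) uL
        first : n₁ < length (verts o′) + C.R
        first = ≤-trans (proj₁ (All.lookup ready o∈)) (+-monoˡ-≤ C.R (≤-trans (m≤m+n _ K₁) (≤-reflexive (sym lo))))
        second : n₁ < length (verts o′) + K₁ * cores o′
        second = ≤-trans (proj₂ (All.lookup ready o∈)) (≤-reflexive (trans (cong (λ c → length (verts o) + K₁ * c) co)
          (trans (cong (length (verts o) +_) (*-suc K₁ (cores o′))) (trans (sym (+-assoc (length (verts o)) K₁ _)) (cong (_+ K₁ * cores o′) (sym lo))))))
      separated : ∀ B D → length B ≤ (length os C 2) * (2 * K₁ + 1) + length os * (K₁ * (3 * K₁)) →
        length D ≤ (length os C 2) * (2 * K₁ + 1) + length os * κ →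
        All (λ o → ¬ Absorbing.Absorber G m₀ (coreOf o ∸ᵛ B) (L ∸ᵛ D)) os →
        All (λ (o , o′) → ¬ Link (coreOf o ∸ᵛ B) (coreOf o′ ∸ᵛ B) ((allCores os ∸ᵛ B) ++ (L ∸ᵛ D))) (pairs os) → ⊥
      separated B D lB lD noAbs noLinks =
        tauBound (L ∸ᵛ D) (Unique-⊑ (∖-⊑ _≟ᵛ_ L D) (proj₁ (proj₂ (Unique-++⁻ (allVerts os) uL)))) (leftover-large os l u D lD)
          (Q os L B D uL noAbs′ noLink′) (λ f → 2 ≤? length (extensions os L B D uL noAbs′ noLink′ f))
          (Q-resp os L B D uL noAbs′ noLink′)
          (Q-crossing os L B D uL noAbs′ noLink′)
          λ T T⊑ lT free → embedAs os L B D uL noAbs′ noLink′ l noBlueParts size≤v i₀ size-i₀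
            (≤-trans (+-monoˡ-≤ (2 ^ σ + v) (≤-trans lB (≤-reflexive (cong (λ t → (t C 2) * (2 * K₁ + 1) + t * (K₁ * (3 * K₁))) l)))) room₅≤) T T⊑ lT free
        where
        noAbs′ : ∀ i → ¬ Absorbing.Absorber G m₀ (coreOf (lookup os i) ∸ᵛ B) (L ∸ᵛ D)
        noAbs′ i = All.lookup noAbs (∈-lookup i)
        noLink′ : ∀ {i j} → i ≢ j → ¬ Link (coreOf (lookup os i) ∸ᵛ B) (coreOf (lookup os j) ∸ᵛ B) ((allCores os ∸ᵛ B) ++ (L ∸ᵛ D))
        noLink′ i≢j ℓ with ∈-pairs⁺ os i≢j
        ... | inj₁ p = All.lookup noLinks p ℓ
        ... | inj₂ p = All.lookup noLinks p (Link-sym ℓ)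

    ready : ∀ os → length os ≡ t → Unique (allVerts os) → All Rich os → length allV ≤ length (allVerts os) + C.R → All Ready os
    ready os l u rich le = All.tabulate λ {o} o∈ → first o o∈ , ≤-trans (first o o∈) (+-monoʳ-≤ (length (verts o)) (many o o∈))
      where
      open ≤-Reasoning
      -- The other t - 1 cycles have at most n₁ vertices each and at most R vertices are left over,
      -- which leaves more than n₁ - R for this cycle.
      first : ∀ o → o ∈ os → n₁ < length (verts o) + C.R
      first o o∈ with extract o∈
      ... | zs , os↭ = lin (4 * k * (t C 2) + τ)
          (allVerts≤ v noBlueClique noBlueParts size≤v room₁≤ room₂≤ win allV uAll complete zs
             (proj₁ (proj₂ (Unique-++⁻ (verts o) (Unique-resp (allVerts-resp os↭) u)))) ⊕
           subst₂ _≤_ (trans lenV (cong (λ t′ → t′ * n₁ + 4 * k * (t C 2) + τ + 1) (trans (sym l) (↭-length os↭))))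
             (cong (_+ C.R) (trans (↭-length (allVerts-resp os↭)) (length-++ (verts o)))) le)
          (arith n₁ (length (verts o)) (length (allVerts zs)) C.R (length zs) (4 * k * (t C 2)) τ)
        where
        arith : ∀ n v a r z c τ → suc n + (z * n + (v + a + r)) + (c + τ) ≡ v + r + (a + (suc z * n + c + τ + 1))
        arith = solve-∀
      many : ∀ o → o ∈ os → C.R ≤ K₁ * cores o
      many o o∈ with C.R ≤? surplus o
      ... | yes le′ = ≤-trans le′ (≤-trans (m∸n≤m (cores o) 2) (m≤n*m (cores o) K₁))
      ... | no ≰ = ⊥-elim (<⇒≱ (first o o∈) (begin
          length (verts o) + C.R        ≤⟨ +-monoˡ-≤ C.R (proj₂ (All.lookup rich o∈)) ⟩
          W * surplus o + C.R           ≤⟨ +-monoˡ-≤ C.R (*-monoʳ-≤ W (<⇒≤ (≰⇒> ≰))) ⟩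
          W * C.R + C.R                 ≤⟨ m≤m+n _ _ ⟩
          W * C.R + C.R + 2 * (coreLength + C.R)   ≤⟨ large₁ ⟩
          n₁                            ∎))

    contradict : ⊥
    contradict = gather v noBlueClique noBlueParts size≤v room₁≤ room₂≤ win allV uAll complete (suc (length allV)) []
      (m≤m+n _ 0) z≤n [] [] R≤
      (subst (t * n₁ <_) (sym lenV) (≤-trans (s≤s (≤-trans (m≤m+n (t * n₁) (4 * k * (t C 2))) (m≤m+n _ τ))) (≤-reflexive (+-comm 1 _))))
      λ os l u rich le → finish (suc (length allV)) os (m≤m+n _ _) l u (ready os l u rich le)

-- Subsets, colourings and copies

module _ {A : Set} where

  fromDoes : (a? : Dec A) → does a? ≡ true → A
  fromDoes (yes a) _ = a

  fromT : (a? : Dec A) → T (does a?) → A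
  fromT (yes a) _ = a

  toT : (a? : Dec A) → A → T (does a?)
  toT (yes _) _ = tt
  toT (no ¬a) a = ¬a a

  lookup-unique : ∀ {xs : List A} → Unique xs → ∀ {i j} → lookup xs i ≡ lookup xs j → i ≡ j
  lookup-unique (_ ∷ _) {zero} {zero} eq = refl
  lookup-unique (p ∷ u) {zero} {suc j} eq = ⊥-elim (All.lookup p (∈-lookup j) eq)
  lookup-unique (p ∷ u) {suc i} {zero} eq = ⊥-elim (All.lookup p (∈-lookup i) (sym eq))
  lookup-unique (p ∷ u) {suc i} {suc j} eq = cong suc (lookup-unique u eq)

module _ {n : ℕ} {P : Fin n → Set} (P? : Decidable P) where

  ∈ₛ-tabulate⁺ : ∀ {y} → P y → y ∈ₛ Vec.tabulate (λ y → does (P? y))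
  ∈ₛ-tabulate⁺ {y} p = lookup⇒[]= y _ (trans (lookup∘tabulate (λ y → does (P? y)) y) (dec-true (P? y) p))

  ∈ₛ-tabulate⁻ : ∀ {y} → y ∈ₛ Vec.tabulate (λ y → does (P? y)) → P y
  ∈ₛ-tabulate⁻ {y} y∈ = fromDoes (P? y) (trans (sym (lookup∘tabulate (λ y → does (P? y)) y)) ([]=⇒lookup y∈))

elements : ∀ {n} → Subset n → List (Fin n)
elements Vec.[] = []
elements (true Vec.∷ p) = zero ∷ map suc (elements p)
elements (false Vec.∷ p) = map suc (elements p)

length-elements : ∀ {n} (p : Subset n) → length (elements p) ≡ ∣ p ∣
length-elements Vec.[] = refl
length-elements (true Vec.∷ p) = cong suc (trans (length-map suc (elements p)) (length-elements p))
length-elements (false Vec.∷ p) = trans (length-map suc (elements p)) (length-elements p)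

∈-elements⁺ : ∀ {n} {p : Subset n} {x} → x ∈ₛ p → x ∈ elements p
∈-elements⁺ Vec.here = here refl
∈-elements⁺ {p = true Vec.∷ p} (Vec.there x∈) = there (∈-map⁺ suc (∈-elements⁺ x∈))
∈-elements⁺ {p = false Vec.∷ p} (Vec.there x∈) = ∈-map⁺ suc (∈-elements⁺ x∈)

∈-elements⁻ : ∀ {n} (p : Subset n) {x} → x ∈ elements p → x ∈ₛ p
∈-elements⁻ (true Vec.∷ p) (here refl) = Vec.here
∈-elements⁻ (true Vec.∷ p) (there x∈) with ∈-map⁻ suc x∈
... | y , y∈ , refl = Vec.there (∈-elements⁻ p y∈)
∈-elements⁻ (false Vec.∷ p) x∈ with ∈-map⁻ suc x∈
... | y , y∈ , refl = Vec.there (∈-elements⁻ p y∈)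

Unique-elements : ∀ {n} (p : Subset n) → Unique (elements p)
Unique-elements Vec.[] = []
Unique-elements (true Vec.∷ p) = cons (λ z∈ → case ∈-map⁻ suc z∈ of λ { (_ , _ , ()) }) (Unique.map⁺ suc-injᶠ (Unique-elements p))
Unique-elements (false Vec.∷ p) = Unique.map⁺ suc-injᶠ (Unique-elements p)

module _ {N : ℕ} where

  open import Data.List.Membership.DecPropositional (_≟ᶠ_ {N}) using () renaming (_∈?_ to _∈ᶠ?_)

  ⟦_⟧ : List (Fin N) → Subset N
  ⟦ xs ⟧ = Vec.tabulate (λ x → does (x ∈ᶠ? xs))

  ∈-⟦⟧⁺ : ∀ {xs x} → x ∈ xs → x ∈ₛ ⟦ xs ⟧
  ∈-⟦⟧⁺ {xs} = ∈ₛ-tabulate⁺ (_∈ᶠ? xs)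

  ∈-⟦⟧⁻ : ∀ xs {x} → x ∈ₛ ⟦ xs ⟧ → x ∈ xs
  ∈-⟦⟧⁻ xs = ∈ₛ-tabulate⁻ (_∈ᶠ? xs)

  ⟦⟧-cong : ∀ {xs ys} → All (_∈ ys) xs → All (_∈ xs) ys → ⟦ xs ⟧ ≡ ⟦ ys ⟧
  ⟦⟧-cong {xs} {ys} p q = Subset.⊆-antisym (λ i → ∈-⟦⟧⁺ (All.lookup p (∈-⟦⟧⁻ xs i))) (λ i → ∈-⟦⟧⁺ (All.lookup q (∈-⟦⟧⁻ ys i)))

  ∣⟦⟧∣ : ∀ {xs} → Unique xs → ∣ ⟦ xs ⟧ ∣ ≡ length xs
  ∣⟦⟧∣ {xs} u = trans (sym (length-elements ⟦ xs ⟧)) (≤-antisym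
    (unique-⊆⇒length (Unique-elements ⟦ xs ⟧) (All.tabulate λ i → ∈-⟦⟧⁻ xs (∈-elements⁻ ⟦ xs ⟧ i)))
    (unique-⊆⇒length u (All.tabulate λ i → ∈-elements⁺ (∈-⟦⟧⁺ i))))

  image≡⟦map⟧ : ∀ {m} (f : Fin m → Fin N) e → image f e ≡ ⟦ map f (elements e) ⟧
  image≡⟦map⟧ f e = Subset.⊆-antisym
      (λ y∈ → let x , x∈ , eq = ∈ₛ-tabulate⁻ in-image? y∈ in ∈-⟦⟧⁺ (subst (_∈ map f (elements e)) eq (∈-map⁺ f (∈-elements⁺ x∈))))
      (λ y∈ → let x , x∈ , eq = ∈-map⁻ f (∈-⟦⟧⁻ (map f (elements e)) y∈) in ∈ₛ-tabulate⁺ in-image? (x , ∈-elements⁻ e x∈ , sym eq))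
    where
    in-image? : ∀ y → Dec (∃[ x ] x ∈ₛ e × f x ≡ y)
    in-image? y = anyᶠ? λ x → (x ∈ₛ? e) ×-dec (f x ≟ᶠ y)

module Coloured {κ′ N : ℕ} (c : EdgeColouring (2 + κ′) N) where

  isRed? : ∀ x → Dec (x ≡ red)
  isRed? red = yes refl
  isRed? blue = no λ ()

  -- A colouring takes a proof of the size of its argument. The proof is bundled here, and equality
  -- proofs in ℕ being unique, it does not affect the colour.
  RedSet : Subset N → Set
  RedSet e = Σ (∣ e ∣ ≡ 2 + κ′) λ p → c e p ≡ red

  RedSet? : ∀ e → Dec (RedSet e)
  RedSet? e with ∣ e ∣ ≟ 2 + κ′
  ... | no ¬p = no (¬p ∘ proj₁)
  ... | yes p with isRed? (c e p)
  ...   | yes r = yes (p , r)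
  ...   | no ¬r = no λ (p′ , r) → ¬r (trans (cong (c e) (≡-irrelevant p p′)) r)

  graph : RedGraph
  graph = record
    { V = Fin N ; _≟ᵛ_ = _≟ᶠ_ ; κ = κ′ ; Red = λ xs → RedSet ⟦ xs ⟧ ; Red? = λ xs → RedSet? ⟦ xs ⟧
    ; Red-resp = λ p q → subst RedSet (⟦⟧-cong p q) }

  open RedGraph graph

  module _ {v : ℕ} (H : Hypergraph v) (uniform : Uniform k H) (noBlue : ¬ HasCopy c blue H) where

    noBlueMap : (f : Fin v → Fin N) → (∀ {x y} → f x ≡ f y → x ≡ y) →
      ¬ (∀ e → e ∈E H → Unique (map f (elements e)) → length (map f (elements e)) ≡ k → ¬ Red (map f (elements e)))
    noBlueMap f inj allBlue = noBlue (f , inj , λ e e∈ →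
      let u = Unique.map⁺ inj (Unique-elements e)
          l = trans (length-map f (elements e)) (trans (length-elements e) (uniform e e∈))
      in subst (λ s → Σ (∣ s ∣ ≡ k) λ p → c s p ≡ blue) (sym (image≡⟦map⟧ f e)) (trans (∣⟦⟧∣ u) l , isBlue (λ r → allBlue e e∈ u l (_ , r))))
      where
      isBlue : ∀ {x} → ¬ (x ≡ red) → x ≡ blue
      isBlue {red} ¬r = ⊥-elim (¬r refl)
      isBlue {blue} _ = refl

    noBlueClique : NoBlueClique graph v
    noBlueClique J u l allBlue = let f , inj , f∈ = vertices l in
        noBlueMap f inj λ e e∈ ue le → allBlue _ ue le (All.tabulate λ y∈ → case ∈-map⁻ f y∈ of λ { (x , _ , refl) → f∈ x })
      where
      vertices : ∀ {n} → length J ≡ n → Σ (Fin n → Fin N) λ f → (∀ {x y} → f x ≡ f y → x ≡ y) × (∀ x → f x ∈ J)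
      vertices refl = lookup J , lookup-unique u , λ x → ∈-lookup x

    classSize : ∀ {χ} → (Fin v → Fin χ) → Fin χ → ℕ
    classSize col i = ∣ colourClass col i ∣

    noBlueParts : ∀ {χ} (col : Fin v → Fin χ) → Proper H col → NoBlueParts graph (classSize col)
    noBlueParts {χ} col proper A uA dA size≤ allBlue = noBlueMap f inj λ e e∈ ue le →
        allBlue _ ue le (λ y∈ → case ∈-map⁻ f y∈ of λ { (x , _ , refl) → col x , f∈ x })
          (λ i e⊆ → proper e e∈ i λ {x} x∈ → ∈ₛ-tabulate⁺ (λ v → col v ≟ᶠ i) (own i x (All.lookup e⊆ (∈-map⁺ f (∈-elements⁺ x∈)))))
      where
      class : Fin χ → List (Fin v)
      class i = elements (colourClass col i)
      fits : ∀ i → length (class i) ≤ length (A i)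
      fits i = ≤-trans (≤-reflexive (length-elements (colourClass col i))) (size≤ i)
      -- The vertex at a position of the class goes to the same position of the part.
      place : ∀ i {x} → x ∈ class i → Fin N
      place i x∈ = lookup (A i) (inject≤ (index x∈) (fits i))
      place∈ : ∀ i {x} (x∈ : x ∈ class i) → place i x∈ ∈ A i
      place∈ i x∈ = ∈-lookup (inject≤ (index x∈) (fits i))
      place-injective : ∀ i j {x y} (x∈ : x ∈ class i) (y∈ : y ∈ class j) → place i x∈ ≡ place j y∈ → x ≡ y
      place-injective i j x∈ y∈ eq with i ≟ᶠ j
      ... | no i≢j = ⊥-elim (dA i≢j (place∈ i x∈ , subst (_∈ A j) (sym eq) (place∈ j y∈)))
      ... | yes refl = trans (lookup-index x∈) (trans
              (cong (lookup (class i)) (inject≤-injective (fits i) (fits i) (index x∈) (index y∈) (lookup-unique (uA i) eq)))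
              (sym (lookup-index y∈)))
      in-class : ∀ x → x ∈ class (col x)
      in-class x = ∈-elements⁺ (∈ₛ-tabulate⁺ (λ v → col v ≟ᶠ col x) refl)
      f : Fin v → Fin N
      f x = place (col x) (in-class x)
      f∈ : ∀ x → f x ∈ A (col x)
      f∈ x = place∈ (col x) (in-class x)
      inj : ∀ {x y} → f x ≡ f y → x ≡ y
      inj {x} {y} = place-injective (col x) (col y) (in-class x) (in-class y)
      -- The parts are disjoint, so the part of an image determines the colour: an edge mapped into
      -- one part would lie in one colour class.
      own : ∀ i x → f x ∈ A i → col x ≡ i
      own i x fx∈ with col x ≟ᶠ i
      ... | yes eq = eq
      ... | no ≢i = ⊥-elim (dA ≢i (f∈ x , fx∈))

-- Closed red paths as copies of the loose cycle

module _ {A : Set} where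

  -- A relation on numbers rather than `lookup`, because the positions arise as sums and remainders
  -- and not as elements of `Fin`.
  data At : List A → ℕ → A → Set where
    here  : ∀ {x xs} → At (x ∷ xs) 0 x
    there : ∀ {x xs i y} → At xs i y → At (x ∷ xs) (suc i) y

  At-lookup : ∀ xs i → At xs (toℕ i) (lookup xs i)
  At-lookup (x ∷ xs) zero = here
  At-lookup (x ∷ xs) (suc i) = there (At-lookup xs i)

  At-functional : ∀ {xs i y z} → At xs i y → At xs i z → y ≡ z
  At-functional here here = refl
  At-functional (there p) (there q) = At-functional p q

  At-< : ∀ {xs i y} → At xs i y → i < length xs
  At-< here = s≤s z≤n
  At-< (there p) = s≤s (At-< p)

  At-∷ʳ⁻ : ∀ xs {a i y} → At (xs ++ [ a ]) i y → At xs i y ⊎ (i ≡ length xs × y ≡ a)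
  At-∷ʳ⁻ [] here = inj₂ (refl , refl)
  At-∷ʳ⁻ (x ∷ xs) here = inj₁ here
  At-∷ʳ⁻ (x ∷ xs) (there p) with At-∷ʳ⁻ xs p
  ... | inj₁ q = inj₁ (there q)
  ... | inj₂ (eq , eq′) = inj₂ (cong suc eq , eq′)

  At-++ : ∀ {xs ys i y} → At xs i y → At (xs ++ ys) i y
  At-++ here = here
  At-++ (there p) = there (At-++ p)

  At-length : ∀ xs {a : A} → At (xs ++ [ a ]) (length xs) a
  At-length [] = here
  At-length (x ∷ xs) = there (At-length xs)

  At-drop⁻ : ∀ s xs {i y} → At (drop s xs) i y → At xs (s + i) y
  At-drop⁻ zero xs p = p
  At-drop⁻ (suc s) (x ∷ xs) p = there (At-drop⁻ s xs p)

  At-drop⁺ : ∀ s xs {i y} → At xs (s + i) y → At (drop s xs) i y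
  At-drop⁺ zero xs p = p
  At-drop⁺ (suc s) (x ∷ xs) (there p) = At-drop⁺ s xs p

  At-take⁻ : ∀ j xs {y} → y ∈ take j xs → ∃[ i ] i < j × At xs i y
  At-take⁻ (suc j) (x ∷ xs) (here refl) = 0 , s≤s z≤n , here
  At-take⁻ (suc j) (x ∷ xs) (there p) with At-take⁻ j xs p
  ... | i , i< , q = suc i , s≤s i< , there q

  At-take⁺ : ∀ {j xs i y} → i < j → At xs i y → y ∈ take j xs
  At-take⁺ (s≤s _) here = here refl
  At-take⁺ (s≤s i<) (there p) = there (At-take⁺ i< p)

module CycleCopy {κ′ N : ℕ} (c : EdgeColouring (2 + κ′) N) (m₀ : ℕ) where

  open Coloured c
  open RedGraph graph
  open Necks graph m₀

  -- Edge i occupies the k consecutive positions from i * K₁ on. The appended `b` is the last vertex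
  -- of the last edge, in a cycle the first vertex once more.
  redWindow : ∀ {a b vs} i → Path a b vs → suc i * K₁ ≤ length vs → Red (take k (drop (i * K₁) (vs ++ [ b ])))
  redWindow zero (edge {b = d} {a = a} {ws = ws} {vs = vs} r l p) _ with head-Neck p
  ... | us , eq = Red-↭ (↭-trans (perm 3 (λ d a w → d ∙ a ∙ w ⇌ a ∙ w ∙ d) ↭-refl [ d ] [ a ] ws) (↭-reflexive (sym window))) r
    where
    window : take k ((a ∷ ws ++ vs) ++ [ _ ]) ≡ a ∷ ws ++ [ d ]
    window = cong (a ∷_) (trans (cong (take K₁) (trans (++-assoc ws vs _) (cong (ws ++_) eq)))
      (trans (cong (λ n → take (suc n) (ws ++ d ∷ us)) (sym l)) (prefix ws)))
      where
      prefix : ∀ ws → take (suc (length ws)) (ws ++ d ∷ us) ≡ ws ++ [ d ]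
      prefix [] = refl
      prefix (w ∷ ws) = cong (w ∷_) (prefix ws)
  redWindow {b = b} (suc i) (edge {a = a} {ws = ws} {vs = vs} r l p) le =
    subst (λ xs → Red (take k xs)) (sym dropped) (redWindow i p (+-cancelˡ-≤ K₁ _ _
      (≤-trans le (≤-reflexive (cong suc (trans (length-++ ws) (cong (_+ length vs) l)))))))
    where
    dropAll : ∀ ws j xs → drop (length ws + j) (ws ++ xs) ≡ drop j xs
    dropAll [] j xs = refl
    dropAll (w ∷ ws) j xs = dropAll ws j xs
    dropped : drop (suc i * K₁) ((a ∷ ws ++ vs) ++ [ b ]) ≡ drop (i * K₁) (vs ++ [ b ])
    dropped = trans (cong₂ (λ n xs → drop (n + i * K₁) xs) (sym l) (++-assoc ws vs [ b ])) (dropAll ws (i * K₁) (vs ++ [ b ]))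

  redCycle : ∀ {q a vs} → Path a a vs → Unique vs → length vs ≡ q * K₁ → HasCopy c red (looseCycle k q)
  redCycle {q} {a} {vs} p u l = f , inj , λ e e∈ → case fromT (anyᶠ? λ i → ≡-dec Bool._≟_ e (looseCycleEdge k q i)) e∈ of λ
      { (i , refl) → subst RedSet (sym (image≡ i)) (redWindow (toℕ i) p (≤-trans (*-monoˡ-≤ K₁ (toℕ<n i)) (≤-reflexive (sym l)))) }
    where
    n = q * K₁
    vertices : ∀ {n} → length vs ≡ n → Σ (Fin n → Fin N) λ f → (∀ {x y} → f x ≡ f y → x ≡ y) × (∀ x → At vs (toℕ x) (f x))
    vertices refl = lookup vs , lookup-unique u , At-lookup vs
    f : Fin n → Fin N
    f = proj₁ (vertices l)
    inj : ∀ {x y} → f x ≡ f y → x ≡ y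
    inj = proj₁ (proj₂ (vertices l))
    f-at : ∀ x → At vs (toℕ x) (f x)
    f-at = proj₂ (proj₂ (vertices l))
    edge? : ∀ i (v : Fin n) → let instance _ = nonZeroIndex v in Dec (∃[ j ] (toℕ i * K₁ + toℕ {k} j) % n ≡ toℕ v)
    edge? i v = let instance _ = nonZeroIndex v in anyᶠ? λ j → (toℕ i * K₁ + toℕ {k} j) % n ≟ toℕ v
    window : Fin q → List (Fin N)
    window i = take k (drop (toℕ i * K₁) (vs ++ [ a ]))
    first : ∀ {b us} → Path a b us → 0 < length us → At us 0 a
    first (edge _ _ _) _ = here
    image≡ : ∀ i → image f (looseCycleEdge k q i) ≡ ⟦ window i ⟧
    image≡ i = trans (image≡⟦map⟧ f (looseCycleEdge k q i)) (⟦⟧-cong (All.tabulate to) (All.tabulate from))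
      where
      s = toℕ i * K₁
      to : ∀ {y} → y ∈ map f (elements (looseCycleEdge k q i)) → y ∈ window i
      to y∈ with ∈-map⁻ f y∈
      ... | v , v∈ , refl with ∈ₛ-tabulate⁻ (edge? i) (∈-elements⁻ (looseCycleEdge k q i) v∈)
      ...   | j , eq = At-take⁺ (toℕ<n j) (At-drop⁺ s (vs ++ [ a ]) (at (m≤n⇒m<n∨m≡n bound)))
        where
        instance _ = nonZeroIndex v
        bound : s + toℕ j ≤ n
        bound = ≤-trans (+-monoʳ-≤ s (s≤s⁻¹ (toℕ<n j))) (≤-trans (≤-reflexive (+-comm s K₁)) (*-monoˡ-≤ K₁ (toℕ<n i)))
        at : s + toℕ j < n ⊎ s + toℕ j ≡ n → At (vs ++ [ a ]) (s + toℕ j) (f v)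
        at (inj₁ lt) = At-++ (subst (λ p → At vs p (f v)) (trans (sym eq) (m<n⇒m%n≡m lt)) (f-at v))
        -- Position n is 0 modulo n; position 0 and the appended position n both carry `a`.
        at (inj₂ refl′) = subst₂ (At (vs ++ [ a ])) (trans l (sym refl′))
          (At-functional (first p (≤-trans (s≤s z≤n) (At-< (f-at v)))) (subst (λ p → At vs p (f v)) (trans (sym eq) (trans (cong (_% n) refl′) (n%n≡0 n))) (f-at v)))
          (At-length vs)
      found : ∀ {y} v (j : Fin k) → At vs (toℕ v) y → (let instance _ = nonZeroIndex v in (s + toℕ j) % n ≡ toℕ v) →
        y ∈ map f (elements (looseCycleEdge k q i))
      found v j at eq = subst (_∈ map f (elements (looseCycleEdge k q i))) (At-functional (f-at v) at)
        (∈-map⁺ f (∈-elements⁺ (∈ₛ-tabulate⁺ (edge? i) (j , eq))))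
      from : ∀ {y} → y ∈ window i → y ∈ map f (elements (looseCycleEdge k q i))
      from {y} y∈ with At-take⁻ k (drop s (vs ++ [ a ])) y∈
      ... | j , j<k , at = place (At-∷ʳ⁻ vs (At-drop⁻ s (vs ++ [ a ]) at))
        where
        place : At vs (s + j) y ⊎ (s + j ≡ length vs × y ≡ a) → y ∈ map f (elements (looseCycleEdge k q i))
        place (inj₁ at′) = found (fromℕ< lt) (fromℕ< j<k) (subst (λ p → At vs p y) (sym (toℕ-fromℕ< lt)) at′)
            (trans (cong (λ j → _%_ (s + j) n {{nonZeroIndex (fromℕ< lt)}}) (toℕ-fromℕ< j<k))
              (trans (m<n⇒m%n≡m {{nonZeroIndex (fromℕ< lt)}} lt) (sym (toℕ-fromℕ< lt))))
          where
          lt : s + j < n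
          lt = ≤-trans (At-< at′) (≤-reflexive l)
        place (inj₂ (eq , refl)) = found (fromℕ< 0<n) (fromℕ< j<k)
            (subst (λ p → At vs p a) (sym (toℕ-fromℕ< 0<n)) (first p (≤-trans 0<n (≤-reflexive (sym l)))))
            (trans (cong (λ j → _%_ (s + j) n {{nonZeroIndex (fromℕ< 0<n)}}) (toℕ-fromℕ< j<k))
              (trans (cong (λ p → _%_ p n {{nonZeroIndex (fromℕ< 0<n)}}) (trans eq l))
                (trans (n%n≡0 n {{nonZeroIndex (fromℕ< 0<n)}}) (sym (toℕ-fromℕ< 0<n)))))
          where
          0<n : 0 < n
          0<n = ≤-trans (s≤s z≤n) (*-monoˡ-≤ K₁ (≤-trans (s≤s z≤n) (toℕ<n i)))

-- The defining property of τ, applied to lists of vertices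

greatest : (P : ℕ → Set) → P 0 → ∀ b → (∀ a → P a → a ≤ b) → (∀ a → IsGreatest P a → ⊥) → ⊥
greatest P p₀ zero bound cont = cont 0 (p₀ , bound)
greatest P p₀ (suc b) bound cont = byCases (P (suc b)) (λ p → cont (suc b) (p , bound))
  λ ¬p → greatest P p₀ b (λ a pa → s≤s⁻¹ (≤∧≢⇒< (bound a pa) λ { refl → ¬p pa })) cont

module TauBound {κ′ N : ℕ} (c : EdgeColouring (2 + κ′) N) {σ τ : ℕ} (isTau : IsTau (1 + κ′) σ τ) where

  open Coloured c
  open RedGraph graph hiding (_∈?_)
  open import Data.List.Membership.DecPropositional (_≟ᶠ_ {N}) using () renaming (_∈?_ to _∈ᶠ?_)

  module _ (L : List (Fin N)) (uL : Unique L) (Q : List (Fin N) → Set) (Q? : Decidable Q)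
    (Q-resp : ∀ {f g} → All (_∈ g) f → All (_∈ f) g → Q f → Q g)
    (Q-crossing : ∀ {f g w} → Unique f → Unique g → length f ≡ K₁ → length g ≡ K₁ → All (_∈ L) f → All (_∈ L) g → Q f → Q g →
      w ∈ f → w ∈ g → ¬ (∀ {x} → x ∈ f → x ∈ g → x ≡ w)) where

    private
      ℓ : ℕ
      ℓ = length L

    vertices : Subset ℓ → List (Fin N)
    vertices e = map (lookup L) (elements e)

    vertices-unique : ∀ e → Unique (vertices e)
    vertices-unique e = Unique.map⁺ (lookup-unique uL) (Unique-elements e)

    length-vertices : ∀ e → length (vertices e) ≡ ∣ e ∣
    length-vertices e = trans (length-map (lookup L) (elements e)) (length-elements e)

    vertices⊆ : ∀ e → All (_∈ L) (vertices e)
    vertices⊆ e = All.tabulate λ x∈ → case ∈-map⁻ (lookup L) x∈ of λ { (i , _ , refl) → ∈-lookup i }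

    ∈-vertices⁻ : ∀ e {i} → lookup L i ∈ vertices e → i ∈ₛ e
    ∈-vertices⁻ e i∈ with ∈-map⁻ (lookup L) i∈
    ... | j , j∈ , eq = subst (_∈ₛ e) (sym (lookup-unique uL eq)) (∈-elements⁻ e j∈)

    edge? : ∀ e → Dec (∣ e ∣ ≡ K₁ × Q (vertices e))
    edge? e = (∣ e ∣ ≟ K₁) ×-dec Q? (vertices e)

    F : Hypergraph ℓ
    F e = does (edge? e)

    noSingleton : NoSingletonIntersection F
    noSingleton e f e∈ f∈ _ one with fromT (edge? e) e∈ | fromT (edge? f) f∈ | elements (e ∩ f) in eq
    ... | le , qe | lf , qf | [] = case trans (sym (cong length eq)) (trans (length-elements (e ∩ f)) one) of λ ()
    ... | le , qe | lf , qf | _ ∷ _ ∷ _ = case trans (sym (cong length eq)) (trans (length-elements (e ∩ f)) one) of λ ()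
    ... | le , qe | lf , qf | w ∷ [] with Subset.x∈p∩q⁻ e f (∈-elements⁻ (e ∩ f) (subst (w ∈_) (sym eq) (here refl)))
    ...   | w∈e , w∈f = Q-crossing (vertices-unique e) (vertices-unique f) (trans (length-vertices e) le) (trans (length-vertices f) lf)
              (vertices⊆ e) (vertices⊆ f) qe qf (∈-map⁺ (lookup L) (∈-elements⁺ w∈e)) (∈-map⁺ (lookup L) (∈-elements⁺ w∈f)) only
      where
      only : ∀ {x} → x ∈ vertices e → x ∈ vertices f → x ≡ lookup L w
      only x∈e x∈f with ∈-map⁻ (lookup L) x∈e
      ... | i , i∈e , refl = case subst (i ∈_) eq (∈-elements⁺ (Subset.x∈p∩q⁺ (∈-elements⁻ e i∈e , ∈-vertices⁻ f x∈f))) of λ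
            { (here refl) → refl }

    free : ∀ S → Independent F S → ∀ T → T ⊑ vertices S → ∀ {f} → Unique f → length f ≡ K₁ → All (_∈ T) f → ¬ Q f
    free S indep T T⊑ {f} uf lf f⊆ qf = indep e (toT (edge? e) (size , Q-resp f⊆e e⊆f qf)) λ i∈ →
        ∈-vertices⁻ S (∈-⊑ T⊑ (All.lookup f⊆ (∈ₛ-tabulate⁻ in-f? i∈)))
      where
      in-f? : ∀ i → Dec (lookup L i ∈ f)
      in-f? i = lookup L i ∈ᶠ? f
      e : Subset ℓ
      e = Vec.tabulate (λ i → does (in-f? i))
      e⊆f : All (_∈ f) (vertices e)
      e⊆f = All.tabulate λ x∈ → case ∈-map⁻ (lookup L) x∈ of λ { (i , i∈ , refl) → ∈ₛ-tabulate⁻ in-f? (∈-elements⁻ e i∈) }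
      f⊆e : All (_∈ vertices e) f
      f⊆e = All.tabulate λ {x} x∈ →
        let x∈L = All.lookup (vertices⊆ S) (∈-⊑ T⊑ (All.lookup f⊆ x∈))
            eq = lookup-index x∈L
        in subst (_∈ vertices e) (sym eq) (∈-map⁺ (lookup L) (∈-elements⁺ (∈ₛ-tabulate⁺ in-f? (subst (_∈ f) eq x∈))))
      size : ∣ e ∣ ≡ K₁
      size = trans (sym (length-vertices e)) (trans (≤-antisym (unique-⊆⇒length (vertices-unique e) e⊆f) (unique-⊆⇒length uf f⊆e)) lf)

    -- If no independent set had σ elements, the independence number of `F` would be below σ, and
    -- `F` itself would show ℓ ≤ τ.
    tau : τ < ℓ → (∀ T → T ⊑ L → length T ≡ σ → (∀ {f} → Unique f → length f ≡ K₁ → All (_∈ T) f → ¬ Q f) → ⊥) → ⊥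
    tau τ<ℓ cont = byCases (∃[ S ] Independent F S × σ ≤ ∣ S ∣) found λ none →
      greatest (λ a → ∃[ S ] Independent F S × ∣ S ∣ ≡ a) empty ℓ
        (λ { _ (S , _ , refl) → Subset.∣p∣≤n S }) λ a gr@((S , indep , l) , _) →
        <⇒≱ τ<ℓ (proj₂ isTau ℓ (F , (λ e e∈ → proj₁ (fromT (edge? e) e∈)) ,
          (a , gr , ≰⇒> λ σ≤a → none (S , indep , ≤-trans σ≤a (≤-reflexive (sym l)))) , noSingleton))
      where
      empty : ∃[ S ] Independent F S × ∣ S ∣ ≡ 0
      empty = Subset.⊥ , (λ e e∈ e⊆ → <⇒≱ (≤-trans (s≤s z≤n) (≤-reflexive (sym (proj₁ (fromT (edge? e) e∈)))))
        (≤-trans (Subset.p⊆q⇒∣p∣≤∣q∣ e⊆) (≤-reflexive (Subset.∣⊥∣≡0 ℓ)))) , Subset.∣⊥∣≡0 ℓ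
      found : ¬ (∃[ S ] Independent F S × σ ≤ ∣ S ∣)
      found (S , indep , σ≤) with split σ (vertices S) (≤-trans σ≤ (≤-reflexive (sym (length-vertices S))))
      ... | T , rest , eq , lT = cont T (⊑-trans T⊑ (unique-⊆⇒⊑ (vertices-unique S) (vertices⊆ S))) lT (free S indep T T⊑)
        where
        T⊑ : T ⊑ vertices S
        T⊑ = subst (T ⊑_) (sym eq) (++-⊑ˡ T rest)

  tauBound : IsTauBound graph τ σ
  tauBound L uL τ< Q Q? Q-resp Q-crossing = tau L uL Q Q? Q-resp Q-crossing τ<

-- Decidability, which turns the refutations above into constructions

∀Subset? : ∀ {n} {P : Subset n → Set} → Decidable P → Dec (∀ s → P s)
∀Subset? {zero} P? = map′ (λ { p Vec.[] → p }) (λ p → p Vec.[]) (P? Vec.[])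
∀Subset? {suc n} P? = map′ (λ { (p , q) (true Vec.∷ s) → p s ; (p , q) (false Vec.∷ s) → q s })
  (λ p → (λ s → p (true Vec.∷ s)) , λ s → p (false Vec.∷ s))
  (∀Subset? (λ s → P? (true Vec.∷ s)) ×-dec ∀Subset? (λ s → P? (false Vec.∷ s)))

-- Functions are enumerated only up to pointwise equality, hence the condition that `P` respects it;
-- likewise in `∀predicate?`.
∃function? : ∀ {m n} {P : (Fin m → Fin n) → Set} → (∀ {f g} → (∀ x → f x ≡ g x) → P f → P g) → Decidable P → Dec (∃ P)
∃function? {zero} {n} {P} resp P? = map′ (λ p → none , p) (λ (f , p) → resp {f} {none} (λ ()) p) (P? none)
  where
  none : Fin 0 → Fin n
  none ()
∃function? {suc m} {n} {P} resp P? = map′ (λ (y , f , p) → (y ∷ᶠ f) , p)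
    (λ (f , p) → f zero , (f ∘ suc) , resp {f} {f zero ∷ᶠ (f ∘ suc)} (λ { zero → refl ; (suc x) → refl }) p)
    (anyᶠ? λ y → ∃function? {m} {n} {λ f → P (y ∷ᶠ f)} (λ {f} {g} eq → resp {y ∷ᶠ f} {y ∷ᶠ g} λ { zero → refl ; (suc x) → eq x }) (λ f → P? (y ∷ᶠ f)))
  where
  infixr 5 _∷ᶠ_
  _∷ᶠ_ : ∀ {m} → Fin n → (Fin m → Fin n) → Fin (suc m) → Fin n
  (y ∷ᶠ f) zero = y
  (y ∷ᶠ f) (suc x) = f x

∀predicate? : ∀ n {P : (Subset n → Bool) → Set} → (∀ {f g} → (∀ s → f s ≡ g s) → P f → P g) → Decidable P → Dec (∀ f → P f)
∀predicate? zero {P} resp P? = map′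
    (λ { (p , q) f → resp {λ _ → f Vec.[]} {f} (λ { Vec.[] → refl }) (either (f Vec.[]) p q) })
    (λ p → p (λ _ → true) , p (λ _ → false))
    (P? (λ _ → true) ×-dec P? (λ _ → false))
  where
  either : ∀ b → P (λ _ → true) → P (λ _ → false) → P (λ _ → b)
  either true p q = p
  either false p q = q
∀predicate? (suc n) {P} resp P? = map′
    (λ p f → resp {glue (λ s → f (true Vec.∷ s)) (λ s → f (false Vec.∷ s))} {f} (λ { (true Vec.∷ s) → refl ; (false Vec.∷ s) → refl }) (p (λ s → f (true Vec.∷ s)) (λ s → f (false Vec.∷ s))))
    (λ p g h → p (glue g h))
    (∀predicate? n (λ {f} {g} eq p h → resp {glue f h} {glue g h} (λ { (true Vec.∷ s) → eq s ; (false Vec.∷ s) → refl }) (p h))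
      λ g → ∀predicate? n (λ {f} {h} eq → resp {glue g f} {glue g h} λ { (true Vec.∷ s) → refl ; (false Vec.∷ s) → eq s }) λ h → P? (glue g h))
  where
  glue : (Subset n → Bool) → (Subset n → Bool) → Subset (suc n) → Bool
  glue g h (true Vec.∷ s) = g s
  glue g h (false Vec.∷ s) = h s

_≟ᶜ_ : DecidableEquality Colour
red ≟ᶜ red = yes refl
red ≟ᶜ blue = no λ ()
blue ≟ᶜ red = no λ ()
blue ≟ᶜ blue = yes refl

module _ {k N : ℕ} where

  hasCopy? : (c : EdgeColouring k N) (x : Colour) {n : ℕ} (G : Hypergraph n) → Dec (HasCopy c x G)
  hasCopy? c x {n} G = ∃function? transport λ f → injective? f ×-dec ∀Subset? λ e → edge? f e
    where
    coloured? : ∀ s → Dec (Σ (∣ s ∣ ≡ k) λ p → c s p ≡ x)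
    coloured? s with ∣ s ∣ ≟ k
    ... | no ¬p = no (¬p ∘ proj₁)
    ... | yes p = map′ (p ,_) (λ (p′ , eq) → trans (cong (c s) (≡-irrelevant p p′)) eq) (c s p ≟ᶜ x)
    edge? : ∀ f e → Dec (e ∈E G → Σ (∣ image f e ∣ ≡ k) λ p → c (image f e) p ≡ x)
    edge? f e = Bool.T? (G e) →-dec coloured? (image f e)
    injective? : (f : Fin n → Fin N) → Dec (∀ {i j} → f i ≡ f j → i ≡ j)
    injective? f = map′ (λ p {i} {j} → p i j) (λ p i j → p) (allᶠ? λ i → allᶠ? λ j → (f i ≟ᶠ f j) →-dec (i ≟ᶠ j))
    transport : ∀ {f g : Fin n → Fin N} → (∀ i → f i ≡ g i) →
      (∀ {i j} → f i ≡ f j → i ≡ j) × (∀ e → e ∈E G → Σ (∣ image f e ∣ ≡ k) λ p → c (image f e) p ≡ x) →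
      (∀ {i j} → g i ≡ g j → i ≡ j) × (∀ e → e ∈E G → Σ (∣ image g e ∣ ≡ k) λ p → c (image g e) p ≡ x)
    transport {f} {g} f≗g (inj , good) = (λ eq → inj (trans (f≗g _) (trans eq (sym (f≗g _))))) ,
      λ e e∈ → subst (λ s → Σ (∣ s ∣ ≡ k) λ p → c s p ≡ x) (image-cong e) (good e e∈)
      where
      image-cong : ∀ e → image f e ≡ image g e
      image-cong e = trans (image≡⟦map⟧ f e) (trans (cong ⟦_⟧ (map-cong f≗g (elements e))) (sym (image≡⟦map⟧ g e)))

  HasCopy-resp : ∀ {c d : EdgeColouring k N} {x n} {G : Hypergraph n} → (∀ e p → c e p ≡ d e p) → HasCopy c x G → HasCopy d x G
  HasCopy-resp c≗d (f , inj , good) = f , inj , λ e e∈ → let p , eq = good e e∈ in p , trans (sym (c≗d _ p)) eq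

  toColour : Bool → Colour
  toColour true = red
  toColour false = blue

  arrows? : ∀ {m n} (G : Hypergraph m) (H : Hypergraph n) → Dec ((c : EdgeColouring k N) → HasCopy c red G ⊎ HasCopy c blue H)
  arrows? G H = map′
      (λ p c → copies (λ e q → code-correct c e q) (p (code c)))
      (λ p f → p (colouring f))
      (∀predicate? N (λ eq → copies λ e _ → cong toColour (eq e)) λ f → hasCopy? (colouring f) red G ⊎-dec hasCopy? (colouring f) blue H)
    where
    colouring : (Subset N → Bool) → EdgeColouring k N
    colouring f e _ = toColour (f e)
    copies : ∀ {c d : EdgeColouring k N} → (∀ e p → c e p ≡ d e p) → HasCopy c red G ⊎ HasCopy c blue H → HasCopy d red G ⊎ HasCopy d blue H
    copies eq (inj₁ r) = inj₁ (HasCopy-resp eq r)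
    copies eq (inj₂ b) = inj₂ (HasCopy-resp eq b)
    code : EdgeColouring k N → Subset N → Bool
    code c e with ∣ e ∣ ≟ k
    -- An arbitrary value: a colouring is never applied to a set of the wrong size.
    ... | no _ = false
    ... | yes p = does (c e p ≟ᶜ red)
    code-correct : ∀ c e p → toColour (code c e) ≡ c e p
    code-correct c e p with ∣ e ∣ ≟ k
    ... | no ¬p = ⊥-elim (¬p p)
    ... | yes p′ rewrite ≡-irrelevant p′ p with c e p
    ...   | red = refl
    ...   | blue = refl

least : {P : ℕ → Set} → Decidable P → ∀ {n} → P n → ∃[ R ] IsLeast P R × R ≤ n
least {P} P? {n} pn = search n 0 (+-identityʳ n) λ m ()
  where
  search : ∀ fuel a → fuel + a ≡ n → (∀ m → m < a → ¬ P m) → ∃[ R ] IsLeast P R × R ≤ n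
  search zero a refl below = a , (pn , λ m pm → ≮⇒≥ λ m<a → below m m<a pm) , ≤-refl
  search (suc fuel) a eq below with P? a
  ... | yes pa = a , (pa , λ m pm → ≮⇒≥ λ m<a → below m m<a pm) , ≤-trans (m≤n+m a (suc fuel)) (≤-reflexive eq)
  ... | no ¬pa = search fuel (suc a) (trans (+-suc fuel a) eq) λ m m≤a pm → case m≤n⇒m<n∨m≡n (s≤s⁻¹ m≤a) of λ
        { (inj₁ m<a) → below m m<a pm ; (inj₂ refl) → ¬pa pm }

theorem1p9 : ∀ (k : ℕ) → 3 ≤ k → ∀ {v : ℕ} (H : Hypergraph v) → Uniform k H →
    ∀ (χ σ τ : ℕ) → IsChromaticNumber H χ → IsSmallestColourClass H χ σ → IsTau (k ∸ 1) σ τ →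
    ∃[ n₀ ] (∀ (n : ℕ) → n₀ ≤ n → (d : (k ∸ 1) ∣ n) →
    ∃[ R ] (IsRamseyNumber k (looseCycle k (quotient d)) H R ×
    R ≤ (χ ∸ 1) * (n ∸ 1) + 4 * k * ((χ ∸ 1) C 2) + τ + 1))
theorem1p9 (suc zero) (s≤s ())
theorem1p9 (suc (suc zero)) (s≤s (s≤s ()))
-- With no colours there is no colour class whose size σ could be.
theorem1p9 (suc (suc (suc κ₀))) 3≤k H uniform zero σ τ _ ((_ , _ , () , _) , _) isTau
theorem1p9 k@(suc (suc κ@(suc κ₀))) 3≤k {v} H uniform (suc t) σ τ _ ((col , proper , i₀ , size-i₀) , _) isTau = threshold , bound
  where
  open Constants κ v t σ using (threshold; m₀)
  bound : ∀ n → threshold ≤ n → (d : (k ∸ 1) ∣ n) →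
    ∃[ R ] (IsRamseyNumber k (looseCycle k (quotient d)) H R × R ≤ t * (n ∸ 1) + 4 * k * (t C 2) + τ + 1)
  -- The threshold is positive, which excludes n = 0; so n ∸ 1 is `n₁` without truncation.
  bound (suc n₁) large d = least (λ N → arrows? {N = N} (looseCycle k (quotient d)) H) arrows
    where
    q N : ℕ
    q = quotient d
    N = t * n₁ + 4 * k * (t C 2) + τ + 1
    arrows : (c : EdgeColouring k N) → HasCopy c red (looseCycle k q) ⊎ HasCopy c blue H
    arrows c with hasCopy? c red (looseCycle k q) | hasCopy? c blue H
    ... | yes r | _ = inj₁ r
    ... | no _ | yes b = inj₂ b
    ... | no noRed | no noBlue = ⊥-elim (Conclusion.contradict graph (s≤s z≤n) v t σ τ
            (noBlueClique H uniform noBlue) (noBlueParts H uniform noBlue col proper)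
            (λ i → Subset.∣p∣≤n (colourClass col i)) i₀ size-i₀ (TauBound.tauBound c isTau)
            (allFin N) (Unique.allFin⁺ N) ∈-allFin q n₁ (sym (_∣_.equality d)) large (length-tabulate id)
            λ p u l → noRed (CycleCopy.redCycle c m₀ {q = q} p u l))
      where open Coloured c
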